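{- Let $n \geq 6$ and $3 \leq d \leq n-2$ be integers. Among all unicyclic graphs of order $n$ with diameter $d$, the graph $C_{3}(P^{n-d-2}_{\lceil \frac{d-1}{2} \rceil}, P_{\lfloor \frac{d-1}{2} \rfloor +1}, S_{1})$ is the unique graph (up to isomorphism) with minimum edge Szeged index.
   Context: All graphs are finite, simple, undirected and connected. A unicyclic graph of order $n$ is a connected graph with $n$ vertices and $n$ edges. The diameter of $G$ is the maximum distance $d(u,v|G)$ over all pairs of vertices. For an edge $f=ab$ and a vertex $w$, the distance is $d(f,w|G)=\min\{d(a,w|G),d(b,w|G)\}$. For an edge $e=uv$, let $m_u(e|G)$ be the number of edges $f\in E(G)$ with $d(f,u|G)<d(f,v|G)$, and $m_v(e|G)$ the number of edges $f$ with $d(f,v|G)<d(f,u|G)$. The edge Szeged index is $Sz_e(G)=\sum_{uv\in E(G)} m_u(uv|G)\,m_v(uv|G)$. The graph $C_{3}(P^{n-d-2}_{\lceil \frac{d-1}{2} \rceil}, P_{\lfloor \frac{d-1}{2} \rfloor +1}, S_{1})$ is defined as follows: take a triangle $v_1v_2v_3v_1$; at $v_1$ attach a pendent path with $\lceil \frac{d-1}{2}\rceil$ edges (i.e. $v_1$ is an end vertex of a path on $\lceil \frac{d-1}{2}\rceil+1$ vertices) together with $n-d-2$ pendent vertices adjacent to $v_1$; at $v_2$ attach a pendent path with $\lfloor \frac{d-1}{2}\rfloor$ edges (i.e. $v_2$ is an end vertex of a path on $\lfloor \frac{d-1}{2}\rfloor+1$ vertices); $v_3$ has no further neighbours. This graph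 has $n$ vertices and diameter $d$. -}

module Defs where

open import Data.Bool.Base using (if_then_else_)
open import Data.Empty using (⊥)
open import Data.Fin.Base using (Fin; zero; suc; _↑ʳ_)
open import Data.Fin.Properties using (_≟_; _<?_; any?)
open import Data.List.Base
  using (List; length; filter; map; allFin; cartesianProduct)
open import Data.List.Extrema.Nat using (max)
open import Data.Nat.Base using (ℕ; zero; suc; _+_; _*_; _∸_; _≤_; _⊓_; ⌊_/2⌋; ⌈_/2⌉)
open import Data.Nat.ListAction using (sum)
import Data.Nat.Properties as ℕₚ
open import Data.Product.Base using (∃; _×_; _,_; uncurry)
open import Function.Bundles using (_↔_; _⇔_; Inverse)
open import Level using (0ℓ)
open import Relation.Binary.Core using (Rel)
open import Relation.Binary.Definitions using (Symmetric; Irreflexive; Decidable)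
open import Relation.Binary.PropositionalEquality using (_≡_; _≢_; refl; ≢-sym)
open import Relation.Nullary.Decidable using (no; does; ¬?; _×-dec_)
import Relation.Unary as U

record Graph (n : ℕ) : Set₁ where
  field
    Adj    : Rel (Fin n) 0ℓ
    adj?   : Decidable Adj
    symm   : Symmetric Adj
    irrefl : Irreflexive _≡_ Adj

open Graph public

record _≅_ {m n : ℕ} (G : Graph m) (H : Graph n) : Set where
  field
    bijection : Fin m ↔ Fin n
    adj⇔      : ∀ u v → Adj G u v ⇔ Adj H (Inverse.to bijection u) (Inverse.to bijection v)

-- The least k < b with P k, or b if there is none.
leastBelow : ∀ (b : ℕ) {P : ℕ → Set} → U.Decidable P → ℕ
leastBelow zero    P? = zero
leastBelow (suc b) P? =
  if does (P? zero) then zero else suc (leastBelow b (λ k → P? (suc k)))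

module _ {n : ℕ} (G : Graph n) where

  -- Walks with exactly the given number of edges.
  Walk : ℕ → Rel (Fin n) 0ℓ
  Walk zero    u v = u ≡ v
  Walk (suc k) u v = ∃ λ w → Adj G u w × Walk k w v

  walk? : ∀ k → Decidable (Walk k)
  walk? zero    u v = u ≟ v
  walk? (suc k) u v = any? (λ w → adj? G u w ×-dec walk? k w v)

  Connected : Set
  Connected = ∀ u v → ∃ λ k → Walk k u v

  -- Two vertices joined by a walk are joined by one with fewer than n edges,
  -- so the bound only matters for vertices in different components (value n).
  dist : Fin n → Fin n → ℕ
  dist u v = leastBelow n (λ k → walk? k u v)

  diameter : ℕ
  diameter = max 0 (map (uncurry dist) (cartesianProduct (allFin n) (allFin n)))

  -- Each undirected edge is listed once, smaller endpoint first.
  edges : List (Fin n × Fin n)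
  edges = filter (λ (u , v) → u <? v ×-dec adj? G u v)
                 (cartesianProduct (allFin n) (allFin n))

  size : ℕ
  size = length edges

  edgeDist : Fin n × Fin n → Fin n → ℕ
  edgeDist (a , b) w = dist a w ⊓ dist b w

  edgesCloserTo : Fin n → Fin n → ℕ
  edgesCloserTo u v = length (filter (λ f → edgeDist f u ℕₚ.<? edgeDist f v) edges)

  edgeSzeged : ℕ
  edgeSzeged = sum (map (λ (u , v) → edgesCloserTo u v * edgesCloserTo v u) edges)

record UnicyclicWithDiameter (n d : ℕ) {m : ℕ} (G : Graph m) : Set where
  field
    order≡    : m ≡ n
    connected : Connected G
    size≡     : size G ≡ n
    diameter≡ : diameter G ≡ d

record HasMinimumEdgeSzeged (n d : ℕ) {m : ℕ} (G : Graph m) : Set₁ where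
  field
    member  : UnicyclicWithDiameter n d G
    minimal : ∀ {k} (H : Graph k) → UnicyclicWithDiameter n d H →
              edgeSzeged G ≤ edgeSzeged H

triangle : Graph 3
triangle = record
  { Adj    = _≢_
  ; adj?   = λ u v → ¬? (u ≟ v)
  ; symm   = ≢-sym
  ; irrefl = λ u≡v u≢v → u≢v u≡v
  }

-- The new vertex is zero; an old vertex w becomes suc w.
attachVertex : ∀ {n} → Graph n → Fin n → Graph (suc n)
attachVertex {n} G v = record
  { Adj    = A
  ; adj?   = A?
  ; symm   = λ {u} {w} → A-sym {u} {w}
  ; irrefl = λ {u} {w} → A-irrefl {u} {w}
  }
  where
  A : Rel (Fin (suc n)) 0ℓ
  A zero    zero    = ⊥
  A zero    (suc w) = w ≡ v
  A (suc u) zero    = u ≡ v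
  A (suc u) (suc w) = Adj G u w

  A? : Decidable A
  A? zero    zero    = no λ ()
  A? zero    (suc w) = w ≟ v
  A? (suc u) zero    = u ≟ v
  A? (suc u) (suc w) = adj? G u w

  A-sym : Symmetric A
  A-sym {zero}  {suc w} p = p
  A-sym {suc u} {zero}  p = p
  A-sym {suc u} {suc w} p = symm G p

  A-irrefl : Irreflexive _≡_ A
  A-irrefl {suc u} refl p = irrefl G refl p

-- An old vertex w becomes k ↑ʳ w, both here and in attachPath.
attachPendants : ∀ {n} (k : ℕ) → Graph n → Fin n → Graph (k + n)
attachPendants zero    G v = G
attachPendants (suc k) G v = attachVertex (attachPendants k G v) (k ↑ʳ v)

-- The far end of a path with k edges attached at v.
pathEnd : ∀ {n} (k : ℕ) → Fin n → Fin (k + n)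
pathEnd zero    v = v
pathEnd (suc k) v = zero

attachPath : ∀ {n} (k : ℕ) → Graph n → Fin n → Graph (k + n)
attachPath zero    G v = G
attachPath (suc k) G v = attachVertex (attachPath k G v) (pathEnd k v)

-- The triangle with a path of a edges and p pendent vertices attached at one
-- vertex v₁, and a path of b edges attached at another vertex v₂.
C₃ : (p a b : ℕ) → Graph (p + (b + (a + 3)))
C₃ p a b =
  attachPendants p
    (attachPath b (attachPath a triangle v₁) (a ↑ʳ v₂))
    (b ↑ʳ (a ↑ʳ v₁))
  where
  v₁ v₂ : Fin 3
  v₁ = zero
  v₂ = suc zero

extremal : (n d : ℕ) →
           Graph ((n ∸ d ∸ 2) + (⌊ d ∸ 1 /2⌋ + (⌈ d ∸ 1 /2⌉ + 3)))
extremal n d = C₃ (n ∸ d ∸ 2) ⌈ d ∸ 1 /2⌉ ⌊ d ∸ 1 /2⌋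

{-# OPTIONS --safe #-}
module Submission where

-- A unicyclic graph is a cycle with trees directed towards it, so its edges are {v , σ v} for a map σ
-- on the vertices.  If e₁, …, e_d is a diametral path and eᵢ is a bridge, then at least i − 1 edges lie
-- on one side of eᵢ, at least d − i on the other and n − 1 on both together, so eᵢ contributes at least
-- kᵢ (n − 1 − kᵢ) with kᵢ = min (i − 1) (d − i).  If the path avoids the edges of the cycle, these
-- contribute at least 2n − 4 on top of that.  Otherwise every cycle edge on the path is paired with an
-- edge across the cycle, and the pairs exceed the sum of the kᵢ (n − 1 − kᵢ) by at least 2n − 2 − 2b,
-- b = ⌊(d − 1)/2⌋, unless the cycle is a triangle.  On a triangle the excess is at least 2n − 3 − 2b,
-- which is the value for the extremal graph, and equality leaves no freedom: one corner carries
-- nothing, one carries a path of b edges, and every edge off the path is pendent at the third corner.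
-- The index of the extremal graph itself is obtained by attaching its vertices one at a time: a new
-- vertex at v adds the sum, over all edges, of the number of edges on the side away from v.

open import Defs
open import Data.Fin.Base using (Fin; zero; suc; toℕ; fromℕ<; _↑ʳ_)
import Data.Fin.Base as Fin
open import Data.Fin.Properties using (_≟_; _<?_; any?; toℕ<n; toℕ-fromℕ<; pigeonhole; ¬∀⟶∃¬)
import Data.Fin.Properties as Finₚ
open import Data.List.Base
  using (List; []; _∷_; length; filter; map; allFin; cartesianProduct; tabulate; _++_; applyUpTo)
open import Data.List.Extrema.Nat using (max≤v⁺; v≤max⁺; argmax-sel)
import Data.List.Membership.DecPropositional as Membership
open import Data.List.Membership.Propositional using (_∈_; _∉_)
open import Data.List.Membership.Propositional.Properties
  using (∈-applyUpTo⁺; ∈-applyUpTo⁻; ∈-map⁺; ∈-map⁻; ∈-cartesianProduct⁺; ∈-allFin)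
open import Data.List.Properties
  using (map-tabulate; map-++; map-∘; map-cong; length-applyUpTo; length-++)
open import Data.List.Relation.Unary.All using (All; []; _∷_)
import Data.List.Relation.Unary.All as All
import Data.List.Relation.Unary.All.Properties as Allₚ
open import Data.List.Relation.Unary.AllPairs using ([]; _∷_)
open import Data.List.Relation.Unary.Any using (here; there)
import Data.List.Relation.Unary.Any as Any
open import Data.List.Relation.Unary.Unique.Propositional using (Unique)
import Data.List.Relation.Unary.Unique.Propositional.Properties as Uniqueₚ
open import Data.Nat.Base
open import Data.Nat.DivMod using (_%_; m%n<n; m<n⇒m%n≡m; [m+n]%n≡m%n; %-distribˡ-+; n%n≡0)
open import Data.Nat.Induction using (<-wellFounded)
open import Data.Nat.ListAction using (sum)
open import Data.Nat.ListAction.Properties using (sum-++)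
import Data.Nat.Properties as ℕₚ
open import Data.Nat.Properties hiding (_≟_; _<?_)
open import Data.Nat.Tactic.RingSolver using (solve-∀)
open import Data.Product.Base using (_×_; _,_; proj₁; proj₂; ∃-syntax; uncurry)
open import Data.Sum.Base using (_⊎_; inj₁; inj₂; [_,_]; swap; map₂)
open import Function.Base using (_∘_; id)
open import Function.Bundles using (mk↔ₛ′; mk⇔)
open import Induction.WellFounded using (Acc; acc)
open import Relation.Binary.Definitions using (tri<; tri≈; tri>; Tri)
open import Relation.Binary.PropositionalEquality hiding ([_])
open import Relation.Nullary.Decidable using (Dec; yes; no; ¬?; _×-dec_; _⊎-dec_)
open import Relation.Nullary.Negation using (¬_; contradiction)
import Relation.Unary as U
import Algebra.Properties.CommutativeMonoid.Sum +-0-commutativeMonoid as Sum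

-- Naming the edge {v , σ v} by v turns sums over edges into sums over vertices, so a list of
-- distinct vertices already gives a lower bound.
--
-- Pairing is forced. On an odd cycle the edges hanging from the corner opposite to a cycle edge lie
-- on neither of its sides, on an even cycle the opposite edge lies on neither, and so one cycle
-- edge of the path may contribute less than kᵢ (n - 1 - kᵢ). The edge across the cycle supplies
-- what is missing.
--
-- The excess 2n - 2 - 2b is one more than that of the extremal graph, and every case except the
-- equality case on a triangle reaches it. Hence a single dichotomy, an index strictly above the
-- extremal value or the extremal structure, gives minimality and uniqueness together.
--
-- The bound n ≥ 6 matters for uniqueness: for n = 5 and d = 3 the four-cycle with one pendent
-- vertex and the extremal graph both have index 8. The estimate that is tight there is
-- `middle-poly` at q = 0.

private variable
  n m : ℕ
  A B : Set

-- Indicators and sums over finite sets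

⟦_⟧ : Dec A → ℕ
⟦ yes _ ⟧ = 1
⟦ no _ ⟧ = 0

⟦⟧-yes : (d : Dec A) → A → ⟦ d ⟧ ≡ 1
⟦⟧-yes (yes _) _ = refl
⟦⟧-yes (no ¬p) p = contradiction p ¬p

⟦⟧-no : (d : Dec A) → ¬ A → ⟦ d ⟧ ≡ 0
⟦⟧-no (yes p) ¬p = contradiction p ¬p
⟦⟧-no (no _) _ = refl

⟦⟧-cong : (d : Dec A) (e : Dec B) → (A → B) → (B → A) → ⟦ d ⟧ ≡ ⟦ e ⟧
⟦⟧-cong (yes p) e f _ = sym (⟦⟧-yes e (f p))
⟦⟧-cong (no ¬p) e _ g = sym (⟦⟧-no e (¬p ∘ g))

⟦⟧-mono : (d : Dec A) (e : Dec B) → (A → B) → ⟦ d ⟧ ≤ ⟦ e ⟧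
⟦⟧-mono (yes p) e f = ≤-reflexive (sym (⟦⟧-yes e (f p)))
⟦⟧-mono (no _) _ _ = z≤n

-- Opaque so that unification can read the summand off a sum.
opaque
  ∑ : (Fin n → ℕ) → ℕ
  ∑ = Sum.sum

opaque
  unfolding ∑

  ∑-suc : (f : Fin (suc n) → ℕ) → ∑ f ≡ f zero + ∑ (f ∘ suc)
  ∑-suc f = refl

  ∑-empty : (f : Fin 0 → ℕ) → ∑ f ≡ 0
  ∑-empty f = refl

  ∑-cong : {f g : Fin n → ℕ} → (∀ i → f i ≡ g i) → ∑ f ≡ ∑ g
  ∑-cong = Sum.sum-cong-≗

  ∑-+ : (f g : Fin n → ℕ) → ∑ (λ i → f i + g i) ≡ ∑ f + ∑ g
  ∑-+ = Sum.∑-distrib-+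

  ∑-swap : ∀ {m} (f : Fin m → Fin n → ℕ) → ∑ (λ i → ∑ (f i)) ≡ ∑ (λ j → ∑ (λ i → f i j))
  ∑-swap = Sum.∑-comm

  ∑-mono : {f g : Fin n → ℕ} → (∀ i → f i ≤ g i) → ∑ f ≤ ∑ g
  ∑-mono {zero} _ = z≤n
  ∑-mono {suc n} h = +-mono-≤ (h zero) (∑-mono (h ∘ suc))

  ∑-const : ∀ n c → ∑ {n} (λ _ → c) ≡ n * c
  ∑-const zero c = refl
  ∑-const (suc n) c = cong (c +_) (∑-const n c)

  ∑-zero : ∀ n → ∑ {n} (λ _ → 0) ≡ 0
  ∑-zero n = trans (∑-const n 0) (*-zeroʳ n)

  ∑-one : ∀ n → ∑ {n} (λ _ → 1) ≡ n
  ∑-one n = trans (∑-const n 1) (*-identityʳ n)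

  ∑-δ : (x : Fin n) (f : Fin n → ℕ) → ∑ (λ v → ⟦ v ≟ x ⟧ * f v) ≡ f x
  ∑-δ {suc n} zero f = begin
    1 * f zero + ∑ {n} (λ v → ⟦ suc v ≟ zero ⟧ * f (suc v))
        ≡⟨ cong₂ _+_ (*-identityˡ (f zero)) (trans (∑-cong
        (λ v → cong (_* f (suc v)) (⟦⟧-no (suc v ≟ zero) λ ()))) (∑-zero n)) ⟩
    f zero + 0 ≡⟨ +-identityʳ _ ⟩
    f zero ∎
    where open ≡-Reasoning
  ∑-δ {suc n} (suc x) f = trans
    (∑-cong (λ v → cong (_* f (suc v)) (⟦⟧-cong (suc v ≟ suc x) (v ≟ x) Finₚ.suc-injective (cong suc))))
    (∑-δ x (f ∘ suc))

  ∑-tight : {f g : Fin n → ℕ} → (∀ i → f i ≤ g i) → ∑ g ≤ ∑ f → ∀ i → f i ≡ g i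
  ∑-tight {suc n} {f} {g} h le zero =
    ≤-antisym (h zero) (+-cancelʳ-≤ (∑ (f ∘ suc)) (g zero) (f zero)
      (≤-trans (+-monoʳ-≤ (g zero) (∑-mono (h ∘ suc))) le))
  ∑-tight {suc n} {f} {g} h le (suc i) =
    ∑-tight (h ∘ suc) (+-cancelˡ-≤ (f zero) _ _ (≤-trans (+-monoˡ-≤ _ (h zero)) le)) i

-- Source of most lower bounds below: once edges are named by vertices, listing distinct ones bounds
-- the index and the edge counts. In the induction step `g` is `f` with its value at the head set to
-- zero; the tail avoids the head and loses nothing.
∑-Unique : {xs : List (Fin n)} → Unique xs → (f : Fin n → ℕ) → sum (map f xs) ≤ ∑ f
∑-Unique [] f = z≤n
∑-Unique {n} {x ∷ xs} (x∉ ∷ u) f = begin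
  f x + sum (map f xs)                              ≤⟨ +-monoʳ-≤ (f x) (mapmono xs x∉) ⟩
  f x + sum (map g xs)                              ≤⟨ +-monoʳ-≤ (f x) (∑-Unique u g) ⟩
  f x + ∑ g                                         ≡⟨ cong (_+ ∑ g) (∑-δ x f) ⟨
  ∑ (λ v → ⟦ v ≟ x ⟧ * f v) + ∑ g                   ≡⟨ ∑-+ (λ v → ⟦ v ≟ x ⟧ * f v) g ⟨
  ∑ (λ v → ⟦ v ≟ x ⟧ * f v + g v)                   ≡⟨ ∑-cong split ⟩
  ∑ f                                               ∎
  where
  open ≤-Reasoning
  g : Fin n → ℕ
  g v = ⟦ ¬? (v ≟ x) ⟧ * f v
  mapmono : ∀ ys → All (x ≢_) ys → sum (map f ys) ≤ sum (map g ys)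
  mapmono [] [] = z≤n
  mapmono (y ∷ ys) (p ∷ ps) = +-mono-≤
    (≤-reflexive (sym (trans (cong (_* f y) (⟦⟧-yes (¬? (y ≟ x)) (≢-sym p))) (*-identityˡ (f y)))))
    (mapmono ys ps)
  split : ∀ v → ⟦ v ≟ x ⟧ * f v + g v ≡ f v
  split v with v ≟ x
  ... | yes _ = trans (+-identityʳ _) (*-identityˡ _)
  ... | no _ = *-identityˡ _

count-Unique : {P : Fin n → Set} (P? : U.Decidable P) {xs : List (Fin n)} →
  Unique xs → All P xs → length xs ≤ ∑ (λ v → ⟦ P? v ⟧)
count-Unique P? {xs} u ps = ≤-trans (go xs ps) (∑-Unique u _)
  where
  go : ∀ ys → All _ ys → length ys ≤ sum (map (λ v → ⟦ P? v ⟧) ys)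
  go [] [] = z≤n
  go (y ∷ ys) (q ∷ qs) = +-mono-≤ (≤-reflexive (sym (⟦⟧-yes (P? y) q))) (go ys qs)

sum-allFin : (f : Fin n → ℕ) → sum (map f (allFin n)) ≡ ∑ f
sum-allFin f = trans (cong sum (map-tabulate (λ i → i) f)) (go f)
  where
  go : ∀ {m} (f : Fin m → ℕ) → sum (tabulate f) ≡ ∑ f
  go {zero} f = sym (∑-empty f)
  go {suc m} f = trans (cong (f zero +_) (go (f ∘ suc))) (sym (∑-suc f))

sum-product : ∀ {A B : Set} (h : A × B → ℕ) (xs : List A) (ys : List B) →
  sum (map h (cartesianProduct xs ys)) ≡ sum (map (λ x → sum (map (λ y → h (x , y)) ys)) xs)
sum-product h [] ys = refl
sum-product h (x ∷ xs) ys = begin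
  sum (map h (map (x ,_) ys ++ cartesianProduct xs ys)) ≡⟨ cong sum (map-++ h (map (x ,_) ys) _) ⟩
  sum (map h (map (x ,_) ys) ++ map h (cartesianProduct xs ys)) ≡⟨ sum-++ (map h (map (x ,_) ys)) _ ⟩
  sum (map h (map (x ,_) ys)) + sum (map h (cartesianProduct xs ys))
      ≡⟨ cong₂ _+_ (cong sum (sym (map-∘ ys))) (sum-product h xs ys) ⟩
  sum (map (λ y → h (x , y)) ys) + _ ∎
  where open ≡-Reasoning

sum-filter : ∀ {A : Set} {P : A → Set} (P? : U.Decidable P) (h : A → ℕ) xs →
  sum (map h (filter P? xs)) ≡ sum (map (λ x → ⟦ P? x ⟧ * h x) xs)
sum-filter P? h [] = refl
sum-filter P? h (x ∷ xs) with P? x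
... | yes _ = cong₂ _+_ (sym (*-identityˡ (h x))) (sum-filter P? h xs)
... | no _ = sum-filter P? h xs

length-sum : ∀ {A : Set} (xs : List A) → length xs ≡ sum (map (λ _ → 1) xs)
length-sum [] = refl
length-sum (x ∷ xs) = cong suc (length-sum xs)

-- Distances in connected graphs

leastBelow-≤ : ∀ b {P : ℕ → Set} (P? : U.Decidable P) {k} → P k → leastBelow b P? ≤ k
leastBelow-≤ zero P? p = z≤n
leastBelow-≤ (suc b) P? {k} p with P? 0
... | yes _ = z≤n
leastBelow-≤ (suc b) P? {zero} p | no ¬p = contradiction p ¬p
leastBelow-≤ (suc b) P? {suc k} p | no ¬p = s≤s (leastBelow-≤ b (λ k → P? (suc k)) p)

leastBelow-sat : ∀ b {P : ℕ → Set} (P? : U.Decidable P) {k} → k < b → P k → P (leastBelow b P?)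
leastBelow-sat (suc b) P? {k} k<b p with P? 0
... | yes p₀ = p₀
leastBelow-sat (suc b) P? {zero} k<b p | no ¬p = contradiction p ¬p
leastBelow-sat (suc b) P? {suc k} k<b p | no ¬p = leastBelow-sat b (λ k → P? (suc k)) (s<s⁻¹ k<b) p

module _ (G : Graph n) where

  ∑ᴱ : (Fin n → Fin n → ℕ) → ℕ
  ∑ᴱ h = ∑ λ u → ∑ λ v → ⟦ u <? v ×-dec adj? G u v ⟧ * h u v

  sum-edges : ∀ h → sum (map h (edges G)) ≡ ∑ᴱ (λ u v → h (u , v))
  sum-edges h = begin
    sum (map h (edges G)) ≡⟨ sum-filter _ h (cartesianProduct (allFin n) (allFin n)) ⟩
    sum (map h′ (cartesianProduct (allFin n) (allFin n))) ≡⟨ sum-product h′ (allFin n) (allFin n) ⟩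
    sum (map (λ u → sum (map (λ v → h′ (u , v)) (allFin n))) (allFin n)) ≡⟨ sum-allFin _ ⟩
    ∑ (λ u → sum (map (λ v → h′ (u , v)) (allFin n))) ≡⟨ ∑-cong (λ u → sum-allFin _) ⟩
    ∑ᴱ (λ u v → h (u , v)) ∎
    where
    open ≡-Reasoning
    h′ : Fin n × Fin n → ℕ
    h′ (u , v) = ⟦ u <? v ×-dec adj? G u v ⟧ * h (u , v)

  size-∑ : size G ≡ ∑ᴱ (λ _ _ → 1)
  size-∑ = trans (length-sum (edges G)) (sum-edges (λ _ → 1))

  -- Opaque because unfolding the search for a shortest walk makes unification explode.
  opaque
    distance : Fin n → Fin n → ℕ
    distance = dist G

  opaque
    unfolding distance

    dist≡ : ∀ u v → distance u v ≡ dist G u v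
    dist≡ u v = refl

    closer-∑ : ∀ u v → edgesCloserTo G u v ≡ ∑ᴱ (λ a b →
        ⟦ distance a u ⊓ distance b u ℕₚ.<? distance a v ⊓ distance b v ⟧)
    closer-∑ u v = begin
      edgesCloserTo G u v ≡⟨ length-sum (filter Q? (edges G)) ⟩
      sum (map (λ _ → 1) (filter Q? (edges G))) ≡⟨ sum-filter Q? (λ _ → 1) (edges G) ⟩
      sum (map (λ f → ⟦ Q? f ⟧ * 1) (edges G)) ≡⟨ cong sum (map-cong (λ f → *-identityʳ ⟦ Q? f ⟧) (edges G)) ⟩
      sum (map (λ f → ⟦ Q? f ⟧) (edges G)) ≡⟨ sum-edges (λ f → ⟦ Q? f ⟧) ⟩
      ∑ᴱ (λ a b → ⟦ distance a u ⊓ distance b u ℕₚ.<? distance a v ⊓ distance b v ⟧) ∎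
      where
      open ≡-Reasoning
      Q? : ∀ f → Dec (edgeDist G f u < edgeDist G f v)
      Q? f = edgeDist G f u ℕₚ.<? edgeDist G f v

  Sz-∑ : edgeSzeged G ≡ ∑ᴱ (λ u v → edgesCloserTo G u v * edgesCloserTo G v u)
  Sz-∑ = sum-edges _

  walk-++ : ∀ i {j u v w} → Walk G i u v → Walk G j v w → Walk G (i + j) u w
  walk-++ zero refl q = q
  walk-++ (suc i) (x , a , p) q = x , a , walk-++ i p q

  walk-snoc : ∀ i {u v w} → Walk G i u v → Adj G v w → Walk G (suc i) u w
  walk-snoc zero refl a = _ , a , refl
  walk-snoc (suc i) (x , b , p) a = x , b , walk-snoc i p a

  walk-reverse : ∀ i {u v} → Walk G i u v → Walk G i v u
  walk-reverse zero p = sym p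
  walk-reverse (suc i) (x , a , p) = walk-snoc i (walk-reverse i p) (symm G a)

  vertexAt : ∀ k {u v} → Walk G k u v → ℕ → Fin n
  vertexAt k {u} p zero = u
  vertexAt zero {u} p (suc i) = u
  vertexAt (suc k) (x , a , p) (suc i) = vertexAt k p i

  walk-take : ∀ k {u v} (p : Walk G k u v) {i} → i ≤ k → Walk G i u (vertexAt k p i)
  walk-take k p z≤n = refl
  walk-take (suc k) (x , a , p) (s≤s i≤k) = x , a , walk-take k p i≤k

  walk-drop : ∀ k {u v} (p : Walk G k u v) {i} → i ≤ k → Walk G (k ∸ i) (vertexAt k p i) v
  walk-drop k p z≤n = p
  walk-drop (suc k) (x , a , p) (s≤s i≤k) = walk-drop k p i≤k

  vertexAt-adj : ∀ k {u v} (p : Walk G k u v) {i} → i < k → Adj G (vertexAt k p i) (vertexAt k p (suc i))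
  vertexAt-adj (suc zero) (x , a , p) {zero} i<k = a
  vertexAt-adj (suc (suc k)) (x , a , p) {zero} i<k = a
  vertexAt-adj (suc k) (x , a , p) {suc i} (s≤s i<k) = vertexAt-adj k p i<k

  -- `dist` only searches lengths below `n`, so arbitrary walks must be cut down first. The `k + 1`
  -- positions of the walk outnumber the vertices, and the stretch between two equal ones is
  -- dropped.
  walk-shorten : ∀ k {u v} → Walk G k u v → n ≤ k → ∃[ k′ ] (k′ < k × Walk G k′ u v)
  walk-shorten k {u} {v} p n≤k
    with pigeonhole (s≤s n≤k) (λ i → vertexAt k p (toℕ i))
  ... | i , j , i<j , eq = toℕ i + (k ∸ toℕ j) , shorter ,
        walk-++ (toℕ i) (walk-take k p (≤-trans (<⇒≤ i<j) j≤k))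
                (subst (λ x → Walk G (k ∸ toℕ j) x v) (sym eq) (walk-drop k p j≤k))
    where
    j≤k = s≤s⁻¹ (toℕ<n j)
    shorter : toℕ i + (k ∸ toℕ j) < k
    shorter = ≤-trans (+-monoˡ-≤ (k ∸ toℕ j) i<j) (≤-reflexive (m+[n∸m]≡n j≤k))

  opaque
    unfolding distance

    dist-minimal : ∀ {k u v} → Walk G k u v → distance u v ≤ k
    dist-minimal {u = u} {v} p = leastBelow-≤ n (λ k → walk? G k u v) p

  dist-self : ∀ u → distance u u ≡ 0
  dist-self u = n≤0⇒n≡0 (dist-minimal {0} refl)

  module _ (conn : Connected G) where

    opaque
      unfolding distance

      dist-walk : ∀ u v → Walk G (distance u v) u v
      dist-walk u v = let k , p = conn u v in go k (<-wellFounded k) p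
        where
        go : ∀ k → Acc _<_ k → Walk G k u v → Walk G (distance u v) u v
        go k (acc rs) p with k ℕₚ.<? n
        ... | yes k<n = leastBelow-sat n (λ k → walk? G k u v) k<n p
        ... | no k≮n with walk-shorten k p (≮⇒≥ k≮n)
        ...   | k′ , k′<k , p′ = go k′ (rs k′<k) p′

    dist-sym : ∀ u v → distance u v ≡ distance v u
    dist-sym u v = ≤-antisym (dist-minimal (walk-reverse _ (dist-walk v u)))
                             (dist-minimal (walk-reverse _ (dist-walk u v)))

    dist-triangle : ∀ u v w → distance u w ≤ distance u v + distance v w
    dist-triangle u v w = dist-minimal (walk-++ _ (dist-walk u v) (dist-walk v w))

    dist≡0 : ∀ {u v} → distance u v ≡ 0 → u ≡ v
    dist≡0 {u} {v} eq = subst (λ k → Walk G k u v) eq (dist-walk u v)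

    dist-adj : ∀ {u v} w → Adj G u v → distance u w ≤ suc (distance v w)
    dist-adj w a = dist-minimal (_ , a , dist-walk _ w)

    opaque
      parent : ∀ {k} u v → distance u v ≡ suc k → ∃[ w ] (Adj G u w × distance w v ≡ k)
      parent {k} u v eq with subst (λ k → Walk G k u v) eq (dist-walk u v)
      ... | w , a , p = w , a , ≤-antisym (dist-minimal p)
            (s≤s⁻¹ (≤-trans (≤-reflexive (sym eq)) (dist-adj v a)))

    record Geodesic (d : ℕ) (u v : Fin n) : Set where
      field
        at    : ℕ → Fin n
        start : at 0 ≡ u
        steps : ∀ {i} → i < d → Adj G (at i) (at (suc i))
        fromStart : ∀ {i} → i ≤ d → distance u (at i) ≡ i
        toEnd : ∀ {i} → i ≤ d → distance (at i) v ≡ d ∸ i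

    opaque
      geodesic : ∀ u v → Geodesic (distance u v) u v
      geodesic u v = record
        { at = vertexAt d w ; start = refl ; steps = vertexAt-adj d w
        ; fromStart = λ {i} i≤d → ≤-antisym (take≤ i≤d)
            (+-cancelʳ-≤ (d ∸ i) _ _ (≤-trans (≤-reflexive (m+[n∸m]≡n i≤d))
              (≤-trans (dist-triangle u _ v) (+-monoʳ-≤ (distance u _) (drop≤ i≤d)))))
        ; toEnd = λ {i} i≤d → ≤-antisym (drop≤ i≤d)
            (+-cancelˡ-≤ i _ _ (≤-trans (≤-reflexive (m+[n∸m]≡n i≤d))
              (≤-trans (dist-triangle u _ v) (+-monoˡ-≤ _ (take≤ i≤d)))))
        }
        where
        d : ℕ
        d = distance u v
        w : Walk G d u v
        w = dist-walk u v
        take≤ : ∀ {i} → i ≤ d → distance u (vertexAt d w i) ≤ i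
        take≤ i≤d = dist-minimal (walk-take d w i≤d)
        drop≤ : ∀ {i} → i ≤ d → distance (vertexAt d w i) v ≤ d ∸ i
        drop≤ i≤d = dist-minimal (walk-drop d w i≤d)

-- The structure of unicyclic graphs

-- A connected graph with as many edges as vertices is a cycle with trees hanging from it.
-- Orienting the cycle and directing the trees towards it makes every edge {v , σ v} for a unique v.
-- The cycle is c 0, …, c k with c extended periodically, δ is the height above the cycle and
-- ρ the index of the cycle vertex below.
record CycleForest (G : Graph n) : Set where
  field
    k        : ℕ
    2≤k      : 2 ≤ k
    σ        : Fin n → Fin n
    δ ρ      : Fin n → ℕ
    c        : ℕ → Fin n
    c-period : ∀ i → c (i + suc k) ≡ c i
    ρ≤k      : ∀ v → ρ v ≤ k
    c-ρ      : ∀ v → δ v ≡ 0 → c (ρ v) ≡ v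
    δ-c      : ∀ i → δ (c i) ≡ 0
    ρ-c      : ∀ {i} → i ≤ k → ρ (c i) ≡ i
    σ-c      : ∀ i → σ (c i) ≡ c (suc i)
    δ-σ      : ∀ v {j} → δ v ≡ suc j → δ (σ v) ≡ j
    ρ-σ      : ∀ v {j} → δ v ≡ suc j → ρ (σ v) ≡ ρ v
    σ-adj    : ∀ v → Adj G v (σ v)
    adj-σ    : ∀ {u v} → Adj G u v → v ≡ σ u ⊎ u ≡ σ v

∑-functional : (τ : Fin n → Fin n) (h : Fin n → Fin n → ℕ) → (∀ u v → h u v ≡ h v u) →
  ∑ (λ u → ∑ (λ v → ⟦ u <? v ⟧ * (⟦ v ≟ τ u ⟧ + ⟦ u ≟ τ v ⟧) * h u v)) ≡
  ∑ (λ u → (⟦ u <? τ u ⟧ + ⟦ τ u <? u ⟧) * h u (τ u))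
-- On the left an edge is listed by its smaller end, as in `edges`; on the right by the `u` whose
-- image is the other end. Summing out the deltas passes from one to the other. A 2-cycle of `τ`
-- counts twice and a fixed point not at all, on both sides.
∑-functional τ h h-sym = begin
  ∑ (λ u → ∑ (λ v → ⟦ u <? v ⟧ * (⟦ v ≟ τ u ⟧ + ⟦ u ≟ τ v ⟧) * h u v))
    ≡⟨ ∑-cong (λ u → trans (∑-cong (λ v → shuffle ⟦ u <? v ⟧ ⟦ v ≟ τ u ⟧ ⟦ u ≟ τ v ⟧ (h u v))) (∑-+ _ _)) ⟩
  ∑ (λ u → ∑ (λ v → ⟦ v ≟ τ u ⟧ * (⟦ u <? v ⟧ * h u v)) + ∑ (λ v → ⟦ u ≟ τ v ⟧ * (⟦ u <? v ⟧ * h u v)))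
    ≡⟨ ∑-+ _ _ ⟩
  ∑ (λ u → ∑ (λ v → ⟦ v ≟ τ u ⟧ * (⟦ u <? v ⟧ * h u v))) + ∑
      (λ u → ∑ (λ v → ⟦ u ≟ τ v ⟧ * (⟦ u <? v ⟧ * h u v)))
    ≡⟨ cong₂ _+_ (∑-cong (λ u → ∑-δ (τ u) _)) (trans (∑-swap _) (∑-cong (λ v → ∑-δ (τ v) _))) ⟩
  ∑ (λ u → ⟦ u <? τ u ⟧ * h u (τ u)) + ∑ (λ v → ⟦ τ v <? v ⟧ * h (τ v) v)
    ≡⟨ cong (∑ (λ u → ⟦ u <? τ u ⟧ * h u (τ u)) +_) (∑-cong (λ v → cong (⟦ τ v <? v ⟧ *_) (h-sym (τ v) v))) ⟩
  ∑ (λ u → ⟦ u <? τ u ⟧ * h u (τ u)) + ∑ (λ u → ⟦ τ u <? u ⟧ * h u (τ u))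
    ≡⟨ ∑-+ _ _ ⟨
  ∑ (λ u → ⟦ u <? τ u ⟧ * h u (τ u) + ⟦ τ u <? u ⟧ * h u (τ u))
    ≡⟨ ∑-cong (λ u → *-distribʳ-+ (h u (τ u)) ⟦ u <? τ u ⟧ ⟦ τ u <? u ⟧) ⟨
  ∑ (λ u → (⟦ u <? τ u ⟧ + ⟦ τ u <? u ⟧) * h u (τ u)) ∎
  where
  open ≡-Reasoning
  shuffle : ∀ a b c h → a * (b + c) * h ≡ b * (a * h) + c * (a * h)
  shuffle a b c h = trans (cong (_* h) (*-comm a (b + c)))
    (trans (*-assoc (b + c) a h) (*-distribʳ-+ (a * h) b c))

one-direction : {u v : Fin n} → u ≢ v → ⟦ u <? v ⟧ + ⟦ v <? u ⟧ ≡ 1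
one-direction {u = u} {v} u≢v with Finₚ.<-cmp u v
... | tri< u<v _ v≮u = cong₂ _+_ (⟦⟧-yes (u <? v) u<v) (⟦⟧-no (v <? u) v≮u)
... | tri≈ _ u≡v _ = contradiction u≡v u≢v
... | tri> u≮v _ v<u = cong₂ _+_ (⟦⟧-no (u <? v) u≮v) (⟦⟧-yes (v <? u) v<u)

module _ {G : Graph n} (conn : Connected G) (r : Fin n) where

  private
    -- `distance` is opaque, so its value is passed as `j` together with the equation, and proofs
    -- match on `j`.
    neighbour : ∀ w j → distance G w r ≡ j → Fin n
    neighbour w zero _ = w
    neighbour w (suc j) e = proj₁ (parent G conn w r e)

    neighbour-root : ∀ j (e : distance G r r ≡ j) → neighbour r j e ≡ r
    neighbour-root zero _ = refl
    neighbour-root (suc j) e = contradiction (trans (sym e) (dist-self G r)) λ ()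

    neighbour-step : ∀ w j e {i} → j ≡ suc i → Adj G w (neighbour w j e) × distance G (neighbour w j e) r ≡ i
    neighbour-step w (suc j) e refl = proj₂ (parent G conn w r e)

  towards : Fin n → Fin n
  towards w = neighbour w (distance G w r) refl

  towards-root : towards r ≡ r
  towards-root = neighbour-root (distance G r r) refl

  towards-step : ∀ w {j} → distance G w r ≡ suc j → Adj G w (towards w) × distance G (towards w) r ≡ j
  towards-step w = neighbour-step w (distance G w r) refl

  Extra : Fin n → Fin n → Set
  Extra x y = Adj G x y × y ≢ towards x × x ≢ towards y

  opaque
    -- If every edge were {u , towards u}, each could be charged to such a `u`. The root is fixed by
    -- `towards` and is charged nothing, which leaves at most n - 1 edges.
    extra-edge : size G ≡ n → ∃[ x ] ∃[ y ] Extra x y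
    extra-edge size≡ with any? (λ x → any? (λ y → adj? G x y ×-dec ¬? (y ≟ towards x) ×-dec ¬?
        (x ≟ towards y)))
    ... | yes p = p
    ... | no none = contradiction n≤ (<⇒≱ (n>r _))
      where
      n>r : ∀ m → m < suc m
      n>r m = ≤-refl
      covered : ∀ {u v} → Adj G u v → 1 ≤ ⟦ v ≟ towards u ⟧ + ⟦ u ≟ towards v ⟧
      covered {u} {v} a with v ≟ towards u | u ≟ towards v
      ... | yes _ | _ = s≤s z≤n
      ... | no _ | yes _ = s≤s z≤n
      ... | no p | no q = contradiction (u , v , a , p , q) none
      bound : ∀ u v → ⟦ u <? v ×-dec adj? G u v ⟧ * 1 ≤ ⟦ u <? v ⟧ * (⟦ v ≟ towards u ⟧ + ⟦ u ≟ towards v ⟧) *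
          1
      bound u v with u <? v | adj? G u v
      ... | no _ | _ = z≤n
      ... | yes _ | no _ = z≤n
      ... | yes _ | yes a = ≤-trans (covered a) (≤-reflexive (sym (trans (*-identityʳ _) (*-identityˡ _))))
      term : ∀ u → (⟦ u <? towards u ⟧ + ⟦ towards u <? u ⟧) * 1 ≤ ⟦ ¬? (u ≟ r) ⟧
      term u with u ≟ r
      ... | yes refl rewrite towards-root | ⟦⟧-no (r <? r) (Finₚ.<-irrefl refl) = z≤n
      ... | no u≢r with u ≟ towards u
      ...   | yes e rewrite sym e | ⟦⟧-no (u <? u) (Finₚ.<-irrefl refl) = z≤n
      ...   | no u≢ = ≤-reflexive (cong (_* 1) (one-direction u≢))
      n≤ : suc (∑ (λ u → ⟦ ¬? (u ≟ r) ⟧)) ≤ ∑ (λ u → ⟦ ¬? (u ≟ r) ⟧)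
      n≤ = begin
        suc (∑ (λ u → ⟦ ¬? (u ≟ r) ⟧)) ≡⟨ cong suc (∑-cong (λ u → *-identityʳ _)) ⟨
        1 + ∑ (λ u → ⟦ ¬? (u ≟ r) ⟧ * 1) ≡⟨ cong (_+ ∑ (λ u → ⟦ ¬? (u ≟ r) ⟧ * 1)) (∑-δ r (λ _ → 1)) ⟨
        ∑ (λ u → ⟦ u ≟ r ⟧ * 1) + ∑ (λ u → ⟦ ¬? (u ≟ r) ⟧ * 1) ≡⟨ ∑-+ _ _ ⟨
        ∑ (λ u → ⟦ u ≟ r ⟧ * 1 + ⟦ ¬? (u ≟ r) ⟧ * 1) ≡⟨ ∑-cong (λ u → excl (u ≟ r)) ⟩
        ∑ {n} (λ _ → 1) ≡⟨ ∑-one n ⟩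
        n ≡⟨ size≡ ⟨
        size G ≡⟨ size-∑ G ⟩
        ∑ᴱ G (λ _ _ → 1) ≤⟨ ∑-mono (λ u → ∑-mono (bound u)) ⟩
        _ ≡⟨ ∑-functional towards (λ _ _ → 1) (λ _ _ → refl) ⟩
        ∑ (λ u → (⟦ u <? towards u ⟧ + ⟦ towards u <? u ⟧) * 1) ≤⟨ ∑-mono term ⟩
        ∑ (λ u → ⟦ ¬? (u ≟ r) ⟧) ∎
        where
        open ≤-Reasoning
        excl : ∀ {P : Set} (d : Dec P) → ⟦ d ⟧ * 1 + ⟦ ¬? d ⟧ * 1 ≡ 1
        excl (yes _) = refl
        excl (no _) = refl

module _ (G : Graph n) (x y : Fin n) where

  deleteEdge : Graph n
  deleteEdge = record
    { Adj = λ u v → Adj G u v × ¬ Same u v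
    ; adj? = λ u v → adj? G u v ×-dec ¬? ((u ≟ x ×-dec v ≟ y) ⊎-dec (u ≟ y ×-dec v ≟ x))
    ; symm = λ (a , ¬s) → symm G a , λ s → ¬s (flip-same s)
    ; irrefl = λ e (a , _) → irrefl G e a
    }
    where
    Same : Fin n → Fin n → Set
    Same u v = (u ≡ x × v ≡ y) ⊎ (u ≡ y × v ≡ x)
    flip-same : ∀ {u v} → Same u v → Same v u
    flip-same (inj₁ (p , q)) = inj₂ (q , p)
    flip-same (inj₂ (p , q)) = inj₁ (q , p)

module _ {G : Graph n} (conn : Connected G) (r : Fin n) {x y} (extra : Extra conn r x y) where

  private
    H : Graph n
    H = deleteEdge G x y

  -- The walks to the root along `towards` avoid the edge xy, because by `Extra` neither end is the
  -- `towards`-image of the other.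
  deleteExtra-connected : Connected H
  deleteExtra-connected u v =
    let i , p = toRoot (distance G u r) u refl
        j , q = toRoot (distance G v r) v refl
    in i + j , walk-++ H i p (walk-reverse H j q)
    where
    toRoot : ∀ j w → distance G w r ≡ j → ∃[ i ] Walk H i w r
    toRoot zero w eq = 0 , dist≡0 G conn eq
    toRoot (suc j) w eq =
      let a , e = towards-step conn r w eq
          i , p = toRoot j (towards conn r w) e
          _ , y≢ , x≢ = extra
      in suc i , towards conn r w ,
         (a , λ { (inj₁ (refl , e)) → y≢ (sym e) ; (inj₂ (refl , e)) → x≢ (sym e) }) , p

record Cycle (G : Graph n) : Set where
  field
    k    : ℕ
    2≤k  : 2 ≤ k
    P    : ℕ → Fin n
    inj  : ∀ {i j} → i ≤ k → j ≤ k → P i ≡ P j → i ≡ j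
    step : ∀ {i} → i < k → Adj G (P i) (P (suc i))
    back : Adj G (P k) (P 0)

module _ {G : Graph n} (x y : Fin n) (a : Adj G x y) (connH : Connected (deleteEdge G x y)) where

  private
    H : Graph n
    H = deleteEdge G x y

  private
    -- Distance 1 would need the deleted edge itself; distance at least 2 makes the closed path a
    -- cycle on three or more vertices.
    far : ∀ m → distance H x y ≡ m → 2 ≤ m
    far 0 eq = contradiction a (irrefl G (dist≡0 H connH eq))
    far 1 eq = let w , (b , ¬s) , e = parent H connH x y eq
               in contradiction (inj₁ (refl , dist≡0 H connH e)) ¬s
    far (suc (suc _)) eq = s≤s (s≤s z≤n)

  open Geodesic (geodesic H connH x y)

  cycleThrough : Cycle G
  cycleThrough = record
    { k = distance H x y ; 2≤k = far _ refl ; P = at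
    ; inj = λ i≤ j≤ e → trans (sym (fromStart i≤)) (trans (cong (distance H x) e) (fromStart j≤))
    ; step = λ i< → proj₁ (steps i<)
    ; back = subst₂ (Adj G) (sym (dist≡0 H connH (trans (toEnd ≤-refl) (n∸n≡0 (distance H x y))))) (sym start)
        (symm G a)
    }

opaque
  -- An edge xy outside a breadth-first tree closes up a shortest path from x to y avoiding it.
  hasCycle : {G : Graph n} → Connected G → size G ≡ n → Fin n → Cycle G
  hasCycle conn size≡ r =
    let x , y , extra = extra-edge conn r size≡
    in cycleThrough x y (proj₁ extra) (deleteExtra-connected conn r extra)

opaque
  wrap : ℕ → ℕ → ℕ
  wrap k i = i % suc k

  wrap≤ : ∀ k i → wrap k i ≤ k
  wrap≤ k i = s≤s⁻¹ (m%n<n i (suc k))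

  wrap-small : ∀ {k i} → i ≤ k → wrap k i ≡ i
  wrap-small i≤k = m<n⇒m%n≡m (s≤s i≤k)

  wrap-period : ∀ k i → wrap k (i + suc k) ≡ wrap k i
  wrap-period k i = [m+n]%n≡m%n i (suc k)

  wrap-top : ∀ k → wrap k (suc k) ≡ 0
  wrap-top k = n%n≡0 (suc k)

  wrap-suc : ∀ {k} → 1 ≤ k → ∀ i → wrap k (suc i) ≡ wrap k (suc (wrap k i))
  wrap-suc {k} 1≤k i = trans (%-distribˡ-+ 1 i (suc k))
    (cong (λ z → (z + wrap k i) % suc k) (m<n⇒m%n≡m {m = 1} (s≤s 1≤k)))

module _ {G : Graph n} (conn : Connected G) (size≡ : size G ≡ n) (C : Cycle G) where

  open Cycle C

  private
    g : ℕ
    g = suc k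

    c : ℕ → Fin n
    c i = P (wrap k i)

    1≤k : 1 ≤ k
    1≤k = ≤-trans (s≤s z≤n) 2≤k

    c-inj : ∀ i j → c i ≡ c j → wrap k i ≡ wrap k j
    c-inj i j = inj (wrap≤ k i) (wrap≤ k j)

    next : ∀ i → wrap k i < k × wrap k (suc i) ≡ suc (wrap k i) ⊎ wrap k i ≡ k × wrap k (suc i) ≡ 0
    next i with m≤n⇒m<n∨m≡n (wrap≤ k i)
    ... | inj₁ lt = inj₁ (lt , trans (wrap-suc 1≤k i) (wrap-small lt))
    ... | inj₂ eq = inj₂ (eq , trans (wrap-suc 1≤k i) (trans (cong (λ z → wrap k (suc z)) eq) (wrap-top k)))

    c-suc : ∀ i → Adj G (c i) (c (suc i))
    c-suc i with next i
    ... | inj₁ (lt , e) = subst (Adj G (c i)) (cong P (sym e)) (step lt)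
    ... | inj₂ (p , q) = subst₂ (Adj G) (cong P (sym p)) (cong P (sym q)) back

    opaque
      on? : ∀ w → Dec (∃[ i ] P (toℕ {g} i) ≡ w)
      on? w = any? (λ i → P (toℕ i) ≟ w)

      par : Fin n → Fin n
      par = towards conn (P 0)

      par-step : ∀ w {j} → distance G w (P 0) ≡ suc j → Adj G w (par w) × distance G (par w) (P 0) ≡ j
      par-step = towards-step conn (P 0)

    σ : Fin n → Fin n
    σ w with on? w
    ... | yes (i , _) = c (suc (toℕ i))
    ... | no _ = par w

    -- The first argument is fuel, started at the distance to `P 0`. Each step to the parent lowers
    -- this distance by one, and `P 0` is on the cycle, so the cycle is met in time and the default
    -- (0 , 0) is never reached from `δ` and `ρ`.
    descend : ℕ → Fin n → ℕ × ℕ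
    descend j w with on? w
    descend j w | yes (i , _) = 0 , toℕ i
    descend zero w | no _ = 0 , 0
    descend (suc j) w | no _ = let d , e = descend j (par w) in suc d , e

    δ ρ : Fin n → ℕ
    δ w = proj₁ (descend (distance G w (P 0)) w)
    ρ w = proj₂ (descend (distance G w (P 0)) w)

    descend-≤k : ∀ j w → proj₂ (descend j w) ≤ k
    descend-≤k j w with on? w
    descend-≤k j w | yes (i , _) = s≤s⁻¹ (toℕ<n i)
    descend-≤k zero w | no _ = z≤n
    descend-≤k (suc j) w | no _ = descend-≤k j (par w)

    dist-off : ∀ {w} → ¬ (∃[ i ] P (toℕ {g} i) ≡ w) → ∃[ j ] distance G w (P 0) ≡ suc j
    dist-off {w} off with distance G w (P 0) in eq
    ... | zero = contradiction (zero , sym (dist≡0 G conn eq)) off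
    ... | suc j = j , refl

    onto : ∀ i → ∃[ j ] P (toℕ {g} j) ≡ c i
    onto i = fromℕ< (s≤s (wrap≤ k i)) , cong P (toℕ-fromℕ< (s≤s (wrap≤ k i)))

    toℕ-wrap : (j : Fin g) → wrap k (toℕ j) ≡ toℕ j
    toℕ-wrap j = wrap-small (s≤s⁻¹ (toℕ<n j))

    σ-c : ∀ i → σ (c i) ≡ c (suc i)
    σ-c i with on? (c i)
    ... | no off = contradiction (onto i) off
    ... | yes (j , e) = cong P (trans (wrap-suc 1≤k (toℕ j))
        (trans (cong (λ z → wrap k (suc z)) eq) (sym (wrap-suc 1≤k i))))
      where
      eq : wrap k (toℕ j) ≡ wrap k i
      eq = trans (toℕ-wrap j) (inj (s≤s⁻¹ (toℕ<n j)) (wrap≤ k i) e)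

    σ-adj : ∀ v → Adj G v (σ v)
    σ-adj v with on? v
    ... | yes (i , e) = subst (λ z → Adj G z (c (suc (toℕ i)))) (trans (cong P (toℕ-wrap i)) e)
        (c-suc (toℕ i))
    ... | no off = proj₁ (par-step v (proj₂ (dist-off off)))

    c-two : ∀ i → c i ≢ c (suc (suc i))
    c-two i e with next i | next (suc i) | c-inj i (suc (suc i)) e
    ... | inj₁ (_ , p) | inj₁ (_ , q) | r = m≢1+n+m (wrap k i) {1} (trans r (trans q (cong suc p)))
    ... | inj₁ (_ , p) | inj₂ (p′ , q) | r = <⇒≢ 2≤k (trans (sym (cong suc (trans r q))) (trans (sym p) p′))
    ... | inj₂ (p , p′) | inj₁ (_ , q) | r = <⇒≢ 2≤k (trans (sym (trans r (trans q (cong suc p′)))) p)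
    ... | inj₂ (p , p′) | inj₂ (q , _) | r = <⇒≢ 1≤k (trans (sym p′) q)

    -- On the cycle there are at least three vertices. Off it, either `par v` is on the cycle, which
    -- `σ` does not leave, or two steps lower the distance to `P 0`. Hence no edge {v , σ v} is
    -- named twice.
    no-2-cycle : ∀ v → σ (σ v) ≢ v
    no-2-cycle v with on? v
    ... | yes (i , q) = λ e → c-two (toℕ i)
            (trans (cong P (toℕ-wrap i)) (trans q (trans (sym e) (σ-c (suc (toℕ i))))))
    ... | no off with on? (par v)
    ...   | yes (i , e) = λ q → off (subst (λ w → ∃[ j ] P (toℕ j) ≡ w) q (onto (suc (toℕ i))))
    ...   | no off′ = λ q → contradiction (cong (λ w → distance G w (P 0)) q) (<⇒≢ lt)
      where
      lt : distance G (par (par v)) (P 0) < distance G v (P 0)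
      lt with j , e ← dist-off off with i , e′ ← dist-off off′ =
        let _ , f = par-step v e
            _ , f′ = par-step (par v) e′
        in subst₂ _<_ (sym f′) (sym (trans e (cong suc (trans (sym f) e′)))) (≤-trans (n≤1+n _) ≤-refl)

    σ≢ : ∀ v → v ≢ σ v
    σ≢ v e = irrefl G e (σ-adj v)

    pairs : Fin n → Fin n → ℕ
    pairs u v = ⟦ u <? v ⟧ * (⟦ v ≟ σ u ⟧ + ⟦ u ≟ σ v ⟧) * 1
    indicator : Fin n → Fin n → ℕ
    indicator u v = ⟦ u <? v ×-dec adj? G u v ⟧ * 1
    pairs≤ : ∀ u v → pairs u v ≤ indicator u v
    pairs≤ u v with u <? v | adj? G u v | v ≟ σ u | u ≟ σ v
    ... | no _ | _ | _ | _ = z≤n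
    ... | yes _ | _ | yes p | yes q = contradiction (sym (trans q (cong σ p))) (no-2-cycle u)
    ... | yes _ | yes _ | yes _ | no _ = ≤-refl
    ... | yes _ | yes _ | no _ | yes _ = ≤-refl
    ... | yes _ | yes _ | no _ | no _ = z≤n
    ... | yes _ | no ¬a | yes refl | no _ = contradiction (σ-adj u) ¬a
    ... | yes _ | no ¬a | no _ | yes refl = contradiction (symm G (σ-adj v)) ¬a
    ... | yes _ | no _ | no _ | no _ = z≤n
    -- The n vertices name n distinct edges, and `size` is n as well. Together with the pointwise
    -- `pairs≤` this forces equality at every pair, so no edge escapes `σ`.
    pairs-total : ∑ (λ u → ∑ (indicator u)) ≤ ∑ (λ u → ∑ (pairs u))
    pairs-total = begin
      ∑ (λ u → ∑ (indicator u)) ≡⟨ size-∑ G ⟨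
      size G ≡⟨ size≡ ⟩
      n ≡⟨ ∑-one n ⟨
      ∑ {n} (λ _ → 1) ≡⟨ ∑-cong (λ u → cong (_* 1) (one-direction (σ≢ u))) ⟨
      ∑ (λ u → (⟦ u <? σ u ⟧ + ⟦ σ u <? u ⟧) * 1) ≡⟨ ∑-functional σ (λ _ _ → 1) (λ _ _ → refl) ⟨
      ∑ (λ u → ∑ (pairs u)) ∎
      where open ≤-Reasoning
    same : ∀ u v → pairs u v ≡ indicator u v
    same u = ∑-tight (pairs≤ u) (≤-reflexive (sym (∑-tight (λ u → ∑-mono (pairs≤ u)) pairs-total u)))
    adj-σ-< : ∀ {u v} → u Fin.< v → Adj G u v → v ≡ σ u ⊎ u ≡ σ v
    adj-σ-< {u} {v} u<v a with same u v
    ... | e with v ≟ σ u | u ≟ σ v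
    ...   | yes p | _ = inj₁ p
    ...   | no _ | yes q = inj₂ q
    ...   | no _ | no _ with u <? v | adj? G u v
    ...     | yes _ | yes _ = contradiction e λ ()
    ...     | no u≮v | _ = contradiction u<v u≮v
    ...     | yes _ | no ¬a = contradiction a ¬a
    adj-σ : ∀ {u v} → Adj G u v → v ≡ σ u ⊎ u ≡ σ v
    adj-σ {u} {v} a with Finₚ.<-cmp u v
    ... | tri< u<v _ _ = adj-σ-< u<v a
    ... | tri≈ _ e _ = contradiction a (irrefl G e)
    ... | tri> _ _ v<u = swap (adj-σ-< v<u (symm G a))

    δ-c : ∀ i → δ (c i) ≡ 0
    δ-c i with on? (c i)
    ... | yes _ = refl
    ... | no off = contradiction (onto i) off

    ρ-c : ∀ {i} → i ≤ k → ρ (c i) ≡ i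
    ρ-c {i} i≤k with on? (c i)
    ... | no off = contradiction (onto i) off
    ... | yes (j , e) = trans (inj (s≤s⁻¹ (toℕ<n j)) (wrap≤ k i) e) (wrap-small i≤k)

    descend-off : ∀ i {v} → ¬ (∃[ i ] P (toℕ {g} i) ≡ v) →
      descend (suc i) v ≡ (suc (proj₁ (descend i (par v))) , proj₂ (descend i (par v)))
    descend-off i {v} off with on? v
    ... | yes on = contradiction on off
    ... | no _ = refl

    σ-off : ∀ {v} → ¬ (∃[ i ] P (toℕ {g} i) ≡ v) → σ v ≡ par v
    σ-off {v} off with on? v
    ... | yes on = contradiction on off
    ... | no _ = refl

    descend-σ : ∀ v {j} → δ v ≡ suc j → descend (distance G v (P 0)) v ≡ (suc (δ (σ v)) , ρ (σ v))
    descend-σ v {j} e = begin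
      descend (distance G v (P 0)) v ≡⟨ cong (λ m → descend m v) (proj₂ (dist-off off)) ⟩
      descend (suc i) v ≡⟨ descend-off i off ⟩
      (suc (proj₁ (descend i (par v))) , proj₂ (descend i (par v)))
        ≡⟨ cong (λ m → (suc (proj₁ (descend m (par v))) , proj₂ (descend m (par v))))
             (sym (proj₂ (par-step v (proj₂ (dist-off off))))) ⟩
      (suc (δ (par v)) , ρ (par v)) ≡⟨ cong (λ w → (suc (δ w) , ρ w)) (sym (σ-off off)) ⟩
      (suc (δ (σ v)) , ρ (σ v)) ∎
      where
      open ≡-Reasoning
      off : ¬ (∃[ i ] P (toℕ {g} i) ≡ v)
      off (i , q) = contradiction (trans (sym e) (trans (cong δ (trans (sym q) (sym (cong P (toℕ-wrap i)))))
          (δ-c (toℕ i)))) λ ()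
      i = proj₁ (dist-off off)

    c-descend : ∀ j v → distance G v (P 0) ≡ j → proj₁ (descend j v) ≡ 0 → c (proj₂ (descend j v)) ≡ v
    c-descend j v d e with on? v
    c-descend j v d e | yes (i , q) = trans (cong P (toℕ-wrap i)) q
    c-descend zero v d e | no off = trans (cong P (wrap-small z≤n)) (sym (dist≡0 G conn d))
    c-descend (suc j) v d () | no off

  cycleForest : CycleForest G
  cycleForest = record
    { k = k ; 2≤k = 2≤k ; σ = σ ; δ = δ ; ρ = ρ ; c = c
    ; c-period = λ i → cong P (wrap-period k i)
    ; ρ≤k = λ v → descend-≤k _ v
    ; c-ρ = λ v → c-descend _ v refl
    ; δ-c = δ-c
    ; ρ-c = ρ-c
    ; σ-c = σ-c
    ; δ-σ = λ v e → suc-injective (trans (sym (cong proj₁ (descend-σ v e))) e)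
    ; ρ-σ = λ v e → sym (cong proj₂ (descend-σ v e))
    ; σ-adj = σ-adj
    ; adj-σ = adj-σ
    }

-- Bridges

-- From (x - m)(y - m) ≥ 0 follows x y ≥ m (x + y - m), and x + y ≥ N - 1. The chain is this
-- computation without negative numbers.
product-bound : ∀ {m x y N} → m ≤ x → m ≤ y → N ≤ suc (x + y) → m * (N ∸ 1 ∸ m) ≤ x * y
product-bound {m} {x} {y} {N} m≤x m≤y N≤ = begin
  m * (N ∸ 1 ∸ m)        ≤⟨ *-monoʳ-≤ m (∸-monoˡ-≤ m (∸-monoˡ-≤ 1 N≤)) ⟩
  m * (x + y ∸ m)        ≡⟨ cong (m *_) (trans (cong (_∸ m) (+-comm x y)) (+-∸-assoc y m≤x)) ⟩
  m * (y + (x ∸ m))      ≡⟨ *-distribˡ-+ m y (x ∸ m) ⟩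
  m * y + m * (x ∸ m)    ≤⟨ +-monoʳ-≤ (m * y) (*-monoˡ-≤ (x ∸ m) m≤y) ⟩
  m * y + y * (x ∸ m)    ≡⟨ cong (m * y +_) (*-comm y (x ∸ m)) ⟩
  m * y + (x ∸ m) * y    ≡⟨ *-distribʳ-+ y m (x ∸ m) ⟨
  (m + (x ∸ m)) * y      ≡⟨ cong (_* y) (m+[n∸m]≡n m≤x) ⟩
  x * y                  ∎
  where open ≤-Reasoning

module Forest {G : Graph n} (conn : Connected G) (F : CycleForest G) where

  open CycleForest F

  V : Set
  V = Fin n

  σ≢ : ∀ v → v ≢ σ v
  σ≢ v e = irrefl G e (σ-adj v)

  δ-σ₀ : ∀ v → δ v ≡ 0 → δ (σ v) ≡ 0
  δ-σ₀ v e = subst (λ w → δ (σ w) ≡ 0) (c-ρ v e) (trans (cong δ (σ-c (ρ v))) (δ-c (suc (ρ v))))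

  c-wrap : c (suc k) ≡ c 0
  c-wrap = c-period 0

  ρ-σ₀ : ∀ v → δ v ≡ 0 → ρ v < k × ρ (σ v) ≡ suc (ρ v) ⊎ ρ v ≡ k × ρ (σ v) ≡ 0
  ρ-σ₀ v e with m≤n⇒m<n∨m≡n (ρ≤k v)
  ... | inj₁ lt = inj₁ (lt , trans (cong ρ σv) (ρ-c lt))
    where
    σv : σ v ≡ c (suc (ρ v))
    σv = trans (cong σ (sym (c-ρ v e))) (σ-c (ρ v))
  ... | inj₂ eq = inj₂ (eq , trans (cong ρ σv) (ρ-c z≤n))
    where
    σv : σ v ≡ c 0
    σv = trans (trans (cong σ (sym (c-ρ v e))) (σ-c (ρ v))) (trans (cong (c ∘ suc) eq) c-wrap)

  no-2-cycle : ∀ v → σ (σ v) ≢ v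
  no-2-cycle v e with δ v in eq
  ... | suc zero = contradiction (trans (sym eq) (trans (cong δ (sym e)) (δ-σ₀ (σ v) (δ-σ v eq)))) λ ()
  ... | suc (suc i) = m≢1+n+m i {1} (trans (sym (δ-σ (σ v) (δ-σ v eq))) (trans (cong δ e) eq))
  ... | zero with ρ-σ₀ v eq | ρ-σ₀ (σ v) (δ-σ₀ v eq)
  ...   | inj₁ (_ , p) | inj₁ (_ , q) = m≢1+n+m (ρ v) {1} (trans (cong ρ (sym e)) (trans q (cong suc p)))
  ...   | inj₁ (_ , p) | inj₂ (p′ , q) = <⇒≢ 2≤k (trans (cong suc (trans (sym q) (cong ρ e)))
      (trans (sym p) p′))
  ...   | inj₂ (p , p′) | inj₁ (_ , q) = <⇒≢ 2≤k (trans (cong suc (sym p′))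
      (trans (sym q) (trans (cong ρ e) p)))
  ...   | inj₂ (p , p′) | inj₂ (q , _) = <⇒≢ (≤-trans (s≤s z≤n) 2≤k) (trans (sym p′) q)

  ∑ᴱ-σ : (h : V → V → ℕ) → (∀ u v → h u v ≡ h v u) → ∑ᴱ G h ≡ ∑ (λ w → h w (σ w))
  ∑ᴱ-σ h h-sym = begin
    ∑ᴱ G h ≡⟨ ∑-cong (λ u → ∑-cong (λ v → cong (_* h u v) (indicator u v))) ⟩
    ∑ (λ u → ∑ (λ v → ⟦ u <? v ⟧ * (⟦ v ≟ σ u ⟧ + ⟦ u ≟ σ v ⟧) * h u v)) ≡⟨ ∑-functional σ h h-sym ⟩
    ∑ (λ u → (⟦ u <? σ u ⟧ + ⟦ σ u <? u ⟧) * h u (σ u)) ≡⟨ ∑-cong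
        (λ u → trans (cong (_* h u (σ u)) (one-direction (σ≢ u))) (*-identityˡ _)) ⟩
    ∑ (λ w → h w (σ w)) ∎
    where
    open ≡-Reasoning
    indicator : ∀ u v → ⟦ u <? v ×-dec adj? G u v ⟧ ≡ ⟦ u <? v ⟧ * (⟦ v ≟ σ u ⟧ + ⟦ u ≟ σ v ⟧)
    indicator u v with u <? v | adj? G u v | v ≟ σ u | u ≟ σ v
    ... | no _ | _ | _ | _ = refl
    ... | yes _ | _ | yes p | yes q = contradiction (sym (trans q (cong σ p))) (no-2-cycle u)
    ... | yes _ | yes _ | yes _ | no _ = refl
    ... | yes _ | yes _ | no _ | yes _ = refl
    ... | yes _ | yes a | no ¬p | no ¬q = contradiction (adj-σ a) [ ¬p , ¬q ]
    ... | yes _ | no ¬a | yes refl | no _ = contradiction (σ-adj u) ¬a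
    ... | yes _ | no ¬a | no _ | yes refl = contradiction (symm G (σ-adj v)) ¬a
    ... | yes _ | no _ | no _ | no _ = refl

  -- `D`, `C` and `p` are `edgeDist`, `edgesCloserTo` and the summand of the index, the edge {z , σ
  -- z} being named by `z`.
  D : V → V → ℕ
  D z x = distance G z x ⊓ distance G (σ z) x

  C : V → V → ℕ
  C u v = ∑ (λ z → ⟦ D z u ℕₚ.<? D z v ⟧)

  p : V → ℕ
  p w = C w (σ w) * C (σ w) w

  closer≡C : ∀ u v → edgesCloserTo G u v ≡ C u v
  closer≡C u v = trans (closer-∑ G u v) (∑ᴱ-σ _ (λ a b →
    cong₂ (λ x y → ⟦ x ℕₚ.<? y ⟧) (⊓-comm (distance G a u) (distance G b u))
        (⊓-comm (distance G a v) (distance G b v))))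

  Sz≡∑p : edgeSzeged G ≡ ∑ p
  Sz≡∑p = trans (Sz-∑ G) (trans
    (∑ᴱ-σ _ (λ u v → *-comm (edgesCloserTo G u v) (edgesCloserTo G v u)))
    (∑-cong (λ w → cong₂ _*_ (closer≡C w (σ w)) (closer≡C (σ w) w))))

  data Below (w : V) : V → Set where
    here : Below w w
    over : ∀ {z j} → δ z ≡ suc j → Below w (σ z) → Below w z

  below⇒≤ : ∀ {w z} → Below w z → δ w ≤ δ z
  below⇒≤ here = ≤-refl
  below⇒≤ (over {z} e b) = ≤-trans (below⇒≤ b) (≤-trans (≤-reflexive (δ-σ z e))
      (≤-trans (n≤1+n _) (≤-reflexive (sym e))))

  below? : ∀ w z → Dec (Below w z)
  below? w z = go (δ z) z refl
    where
    go : ∀ j z → δ z ≡ j → Dec (Below w z)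
    go j z e with z ≟ w
    ... | yes refl = yes here
    go zero z e | no z≢w = no λ { here → z≢w refl ; (over e′ _) → contradiction (trans (sym e) e′) λ () }
    go (suc j) z e | no z≢w with go j (σ z) (δ-σ z e)
    ... | yes b = yes (over e b)
    ... | no ¬b = no λ { here → z≢w refl ; (over _ b) → ¬b b }

  module Bridge (w : V) {j} (δw : δ w ≡ suc j) where

    ¬below-σ : ¬ Below w (σ w)
    ¬below-σ b = 1+n≰n (subst₂ _≤_ δw (δ-σ w δw) (below⇒≤ b))

    below-σ⇒ : ∀ {z} → Below w (σ z) → Below w z
    below-σ⇒ {z} b with δ z in e
    ... | suc i = over e b
    ... | zero = contradiction (subst₂ _≤_ δw (δ-σ₀ z e) (below⇒≤ b)) λ ()

    crossing : ∀ {u v} → Adj G u v → Below w u → ¬ Below w v → u ≡ w × v ≡ σ w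
    crossing a b ¬b with adj-σ a
    crossing a here ¬b | inj₁ e = refl , e
    crossing a (over _ b) ¬b | inj₁ refl = contradiction b ¬b
    crossing a b ¬b | inj₂ refl = contradiction (below-σ⇒ b) ¬b

    -- The walk leaves the subtree at `w` through the edge {w , σ w}, so it has visited `w` before
    -- its end.
    inside : ∀ m {z} → Below w z → Walk G m z (σ w) → distance G z w < m
    inside zero b refl = contradiction b ¬below-σ
    inside (suc m) b (x , a , q) with below? w x
    ... | yes b′ = s≤s (≤-trans (dist-adj G conn w a) (inside m b′ q))
    ... | no ¬b with refl , _ ← crossing a b ¬b = s≤s (≤-trans (≤-reflexive (dist-self G w)) z≤n)

    outside : ∀ m {z} → ¬ Below w z → Walk G m z w → distance G z (σ w) < m
    outside zero ¬b refl = contradiction here ¬b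
    outside (suc m) ¬b (x , a , q) with below? w x
    ... | no ¬b′ = s≤s (≤-trans (dist-adj G conn (σ w) a) (outside m ¬b′ q))
    ... | yes b with _ , refl ← crossing (symm G a) b ¬b = s≤s (≤-trans (≤-reflexive (dist-self G (σ w))) z≤n)

    below-closer : ∀ {z} → Below w z → z ≢ w → D z w < D z (σ w)
    below-closer here z≢w = contradiction refl z≢w
    below-closer {z} b@(over _ b′) _ = ⊓-mono-< (inside _ b (dist-walk G conn z (σ w)))
        (inside _ b′ (dist-walk G conn (σ z) (σ w)))

    outside-closer : ∀ {z} → ¬ Below w z → D z (σ w) < D z w
    outside-closer {z} ¬b = ⊓-mono-< (outside _ ¬b (dist-walk G conn z w))
        (outside _ (¬b ∘ below-σ⇒) (dist-walk G conn (σ z) w))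

    decided : ∀ {z} → z ≢ w → 1 ≤ ⟦ D z w ℕₚ.<? D z (σ w) ⟧ + ⟦ D z (σ w) ℕₚ.<? D z w ⟧
    decided {z} z≢w with below? w z
    ... | yes b = ≤-trans (≤-reflexive (sym (⟦⟧-yes (D z w ℕₚ.<? D z (σ w)) (below-closer b z≢w))))
        (m≤m+n _ _)
    ... | no ¬b = ≤-trans (≤-reflexive (sym (⟦⟧-yes (D z (σ w) ℕₚ.<? D z w) (outside-closer ¬b)))) (m≤n+m _ _)

    -- Only the bridge itself is equidistant from its two ends; `z ≟ w` accounts for it.
    balanced : n ≤ suc (C w (σ w) + C (σ w) w)
    balanced = begin
      n ≡⟨ ∑-one n ⟨
      ∑ {n} (λ _ → 1) ≤⟨ ∑-mono each ⟩
      ∑ (λ z → ⟦ z ≟ w ⟧ * 1 + (a z + b z)) ≡⟨ ∑-+ (λ z → ⟦ z ≟ w ⟧ * 1) (λ z → a z + b z) ⟩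
      ∑ (λ z → ⟦ z ≟ w ⟧ * 1) + ∑ (λ z → a z + b z) ≡⟨ cong₂ _+_ (∑-δ w (λ _ → 1)) (∑-+ a b) ⟩
      suc (C w (σ w) + C (σ w) w) ∎
      where
      open ≤-Reasoning
      a b : V → ℕ
      a z = ⟦ D z w ℕₚ.<? D z (σ w) ⟧
      b z = ⟦ D z (σ w) ℕₚ.<? D z w ⟧
      each : ∀ z → 1 ≤ ⟦ z ≟ w ⟧ * 1 + (a z + b z)
      each z with z ≟ w
      ... | yes _ = s≤s z≤n
      ... | no z≢w = decided z≢w

    bridge-bound : ∀ {m} → m ≤ C w (σ w) → m ≤ C (σ w) w → m * (n ∸ 1 ∸ m) ≤ p w
    bridge-bound m≤ m≤′ = product-bound m≤ m≤′ balanced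

  module _ {d u v} (P : Geodesic G conn d u v) where

    open Geodesic P

    -- The name of the `i`-th edge of the geodesic is whichever end `σ` sends to the other.
    edgeAt : ℕ → V
    edgeAt i with σ (at i) ≟ at (suc i)
    ... | yes _ = at i
    ... | no _ = at (suc i)

    at-injective : ∀ {i j} → i ≤ d → j ≤ d → at i ≡ at j → i ≡ j
    at-injective i≤ j≤ e = trans (sym (fromStart i≤)) (trans (cong (distance G u) e) (fromStart j≤))

    edgeAt-ends : ∀ {i} → i < d →
      edgeAt i ≡ at i × σ (edgeAt i) ≡ at (suc i) ⊎ edgeAt i ≡ at (suc i) × σ (edgeAt i) ≡ at i
    edgeAt-ends {i} i<d with σ (at i) ≟ at (suc i)
    ... | yes e = inj₁ (refl , e)
    ... | no ¬e with adj-σ (steps i<d)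
    ...   | inj₁ e = contradiction (sym e) ¬e
    ...   | inj₂ e = inj₂ (refl , sym e)

    edgeAt-D : ∀ {i} → i < d → ∀ x → D (edgeAt i) x ≡ distance G (at i) x ⊓ distance G (at (suc i)) x
    edgeAt-D {i} i<d x with edgeAt i | edgeAt-ends i<d
    ... | _ | inj₁ (refl , e) = cong (λ y → distance G (at i) x ⊓ distance G y x) e
    ... | _ | inj₂ (refl , e) = trans (cong (λ y → distance G (at (suc i)) x ⊓ distance G y x) e)
        (⊓-comm (distance G (at (suc i)) x) _)

    edgeAt-injective : ∀ {i j} → i < j → j < d → edgeAt i ≢ edgeAt j
    edgeAt-injective {i} {j} i<j j<d e
      with edgeAt-ends (<-trans i<j j<d) | edgeAt-ends j<d
    ... | inj₁ (p , _) | inj₁ (q , _) = <⇒≢ i<j (at-injective (<⇒≤ (<-trans i<j j<d)) (<⇒≤ j<d)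
        (trans (sym p) (trans e q)))
    ... | inj₁ (p , _) | inj₂ (q , _) = <⇒≢ (≤-trans i<j (n≤1+n j))
        (at-injective (<⇒≤ (<-trans i<j j<d)) j<d (trans (sym p) (trans e q)))
    ... | inj₂ (p , _) | inj₂ (q , _) = <⇒≢ (s≤s i<j) (at-injective (<-trans i<j j<d) j<d
        (trans (sym p) (trans e q)))
    ... | inj₂ (p , p′) | inj₁ (q , q′) = <⇒≢ (≤-trans i<j (n≤1+n j))
        (at-injective (<⇒≤ (<-trans i<j j<d)) j<d
            (trans (sym p′) (trans (cong σ e) q′)))

    edges-Unique : Unique (applyUpTo edgeAt d)
    edges-Unique = Uniqueₚ.applyUpTo⁺₁ edgeAt d edgeAt-injective

  -- All edges of a geodesic from `u` to `x` are counted: if one of its vertices were as close to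
  -- `y` as to `x`, then `y` would not be further from `u` than `x`.
  closer-≥ : ∀ u {x y} → Adj G x y → distance G u y ≡ suc (distance G u x) → distance G u x ≤ C x y
  closer-≥ u {x} {y} a e = begin
    d ≡⟨ length-applyUpTo (edgeAt P) d ⟨
    length (applyUpTo (edgeAt P) d) ≤⟨ count-Unique (λ z → D z x ℕₚ.<? D z y) (edges-Unique P)
        (Allₚ.applyUpTo⁺₁ (edgeAt P) d nearer) ⟩
    C x y ∎
    where
    open ≤-Reasoning
    d : ℕ
    d = distance G u x
    P : Geodesic G conn d u x
    P = geodesic G conn u x
    open Geodesic P
    far : ∀ {i} → i ≤ d → suc (d ∸ i) ≤ distance G (at i) y
    far {i} i≤d = +-cancelˡ-≤ i _ _ (begin
      i + suc (d ∸ i) ≡⟨ +-suc i (d ∸ i) ⟩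
      suc (i + (d ∸ i)) ≡⟨ cong suc (m+[n∸m]≡n i≤d) ⟩
      suc d ≡⟨ e ⟨
      distance G u y ≤⟨ dist-triangle G conn u (at i) y ⟩
      distance G u (at i) + distance G (at i) y ≡⟨ cong (_+ distance G (at i) y) (fromStart i≤d) ⟩
      i + distance G (at i) y ∎)
    nearer : ∀ {i} → i < d → D (edgeAt P i) x < D (edgeAt P i) y
    nearer {i} i<d = begin-strict
      D (edgeAt P i) x ≡⟨ edgeAt-D P i<d x ⟩
      distance G (at i) x ⊓ distance G (at (suc i)) x ≤⟨ m⊓n≤n _ _ ⟩
      distance G (at (suc i)) x ≡⟨ toEnd i<d ⟩
      d ∸ suc i <⟨ ⊓-glb (≤-trans (s≤s (∸-monoʳ-≤ d (n≤1+n i))) (far (<⇒≤ i<d))) (far i<d) ⟩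
      distance G (at i) y ⊓ distance G (at (suc i)) y ≡⟨ edgeAt-D P i<d y ⟨
      D (edgeAt P i) y ∎

  -- Along each edge `ψ` changes by at most one, so a walk from `z` to its zero `x` has at least
  -- `ψ z` steps. This replaces any discussion of shortest paths round the cycle.
  ≤-potential : ∀ {x} (ψ : V → ℕ) → ψ x ≡ 0 → (∀ v → ψ v ≤ suc (ψ (σ v))) → (∀ v → ψ (σ v) ≤ suc (ψ v)) →
    ∀ z → ψ z ≤ distance G z x
  ≤-potential {x} ψ ψx up down z = go _ (dist-walk G conn z x)
    where
    go : ∀ m {z} → Walk G m z x → ψ z ≤ m
    go zero refl = ≤-reflexive ψx
    go (suc m) (w , a , q) with adj-σ a
    ... | inj₁ refl = ≤-trans (up _) (s≤s (go m q))
    ... | inj₂ refl = ≤-trans (down w) (s≤s (go m q))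

  dist-root : ∀ z → distance G z (c (ρ z)) ≤ δ z
  dist-root z = go (δ z) z refl
    where
    go : ∀ j z → δ z ≡ j → distance G z (c (ρ z)) ≤ j
    go zero z e = ≤-reflexive (trans (cong (distance G z) (c-ρ z e)) (dist-self G z))
    go (suc j) z e = ≤-trans (dist-adj G conn _ (σ-adj z))
      (s≤s (subst (λ i → distance G (σ z) (c i) ≤ j) (ρ-σ z e) (go j (σ z) (δ-σ z e))))

  dist-along : ∀ m i → distance G (c i) (c (m + i)) ≤ m
  dist-along zero i = ≤-reflexive (dist-self G (c i))
  dist-along (suc m) i = begin
    distance G (c i) (c (suc m + i)) ≤⟨ dist-adj G conn _ (subst (Adj G (c i)) (σ-c i) (σ-adj (c i))) ⟩
    suc (distance G (c (suc i)) (c (suc m + i))) ≡⟨ cong (λ j → suc (distance G (c (suc i)) (c j)))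
        (+-suc m i) ⟨
    suc (distance G (c (suc i)) (c (m + suc i))) ≤⟨ s≤s (dist-along m (suc i)) ⟩
    suc m ∎
    where open ≤-Reasoning

  dist-forward : ∀ z {j} → ρ z ≤ j → distance G z (c j) ≤ δ z + (j ∸ ρ z)
  dist-forward z {j} ρ≤ = ≤-trans (dist-triangle G conn z (c (ρ z)) (c j))
    (+-mono-≤ (dist-root z) (subst (λ i → distance G (c (ρ z)) (c i) ≤ j ∸ ρ z) (m∸n+n≡m ρ≤)
        (dist-along (j ∸ ρ z) (ρ z))))

  dist-backward : ∀ z → distance G z (c 0) ≤ δ z + ρ z
  dist-backward z = ≤-trans (dist-triangle G conn z (c (ρ z)) (c 0))
    (+-mono-≤ (dist-root z) (≤-trans (≤-reflexive (dist-sym G conn (c (ρ z)) (c 0)))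
      (subst (λ i → distance G (c 0) (c i) ≤ ρ z) (+-identityʳ (ρ z)) (dist-along (ρ z) 0))))

  c₀-c_k : Adj G (c k) (c 0)
  c₀-c_k = subst (Adj G (c k)) (trans (σ-c k) c-wrap) (σ-adj (c k))

  -- In both potentials the two arguments of ⊓ are the lengths of the two ways round the cycle.
  dist-c₀ : ∀ z → distance G z (c 0) ≡ δ z + (ρ z ⊓ (suc k ∸ ρ z))
  dist-c₀ z = ≤-antisym
    (≤-trans (⊓-glb (dist-backward z) (subst (λ x → distance G z x ≤ δ z + (suc k ∸ ρ z)) c-wrap
        (dist-forward z (≤-trans (ρ≤k z) (n≤1+n k)))))
      (≤-reflexive (sym (+-distribˡ-⊓ (δ z) (ρ z) _))))
    (≤-potential ψ (cong₂ (λ x y → x + (y ⊓ (suc k ∸ y))) (δ-c 0) (ρ-c z≤n)) up down z)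
    where
    ψ : V → ℕ
    ψ z = δ z + (ρ z ⊓ (suc k ∸ ρ z))
    up : ∀ v → ψ v ≤ suc (ψ (σ v))
    up v with δ v in e
    ... | suc j rewrite δ-σ v e | ρ-σ v e = ≤-refl
    ... | zero rewrite δ-σ₀ v e with ρ-σ₀ v e
    ...   | inj₁ (lt , q) rewrite q = ⊓-glb (≤-trans (m⊓n≤m _ _) (≤-trans (n≤1+n _) (n≤1+n _)))
                                          (≤-trans (m⊓n≤n (ρ v) _) (≤-reflexive (+-∸-assoc 1 (<⇒≤ lt)))) 
    ...   | inj₂ (eq , q) rewrite q | eq = ≤-trans (m⊓n≤n k _) (≤-reflexive (m+n∸n≡m 1 k))
    down : ∀ v → ψ (σ v) ≤ suc (ψ v)
    down v with δ v in e
    ... | suc j rewrite δ-σ v e | ρ-σ v e = ≤-trans (n≤1+n _) (n≤1+n _)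
    ... | zero rewrite δ-σ₀ v e with ρ-σ₀ v e
    ...   | inj₁ (lt , q) rewrite q = ⊓-glb (m⊓n≤m _ _) (≤-trans (m⊓n≤n (suc (ρ v)) _)
        (≤-trans (∸-monoʳ-≤ k (≤-refl {ρ v})) (≤-trans (∸-monoˡ-≤ (ρ v) (n≤1+n k)) (n≤1+n _))))
    ...   | inj₂ (eq , q) rewrite q = z≤n

  dist-c_k : ∀ z → distance G z (c k) ≡ δ z + (suc (ρ z) ⊓ (k ∸ ρ z))
  dist-c_k z = ≤-antisym
    (≤-trans (⊓-glb (≤-trans (dist-triangle G conn z (c 0) (c k))
        (≤-trans (+-mono-≤ (dist-backward z) (≤-trans (dist-adj G conn (c k) (symm G c₀-c_k))
            (s≤s (≤-reflexive (dist-self G (c k)))))) (≤-reflexive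
            (trans (+-assoc (δ z) (ρ z) 1) (cong (δ z +_) (+-comm (ρ z) 1))))))
      (dist-forward z (ρ≤k z)))
      (≤-reflexive (sym (+-distribˡ-⊓ (δ z) (suc (ρ z)) _))))
    (≤-potential ψ (trans (cong₂ (λ x y → x + (suc y ⊓ (k ∸ y))) (δ-c k) (ρ-c ≤-refl))
        (trans (cong (suc k ⊓_) (n∸n≡0 k)) refl)) up down z)
    where
    ψ : V → ℕ
    ψ z = δ z + (suc (ρ z) ⊓ (k ∸ ρ z))
    up : ∀ v → ψ v ≤ suc (ψ (σ v))
    up v with δ v in e
    ... | suc j rewrite δ-σ v e | ρ-σ v e = ≤-refl
    ... | zero rewrite δ-σ₀ v e with ρ-σ₀ v e
    ...   | inj₁ (lt , q) rewrite q = ⊓-glb (≤-trans (m⊓n≤m _ _) (≤-trans (n≤1+n _) (n≤1+n _)))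
                                          (≤-trans (m⊓n≤n (suc (ρ v)) _) (≤-reflexive (+-∸-assoc 1 lt)))
    ...   | inj₂ (eq , q) rewrite q | eq = ≤-trans (m⊓n≤n (suc k) _) (≤-trans (≤-reflexive (n∸n≡0 k)) z≤n)
    down : ∀ v → ψ (σ v) ≤ suc (ψ v)
    down v with δ v in e
    ... | suc j rewrite δ-σ v e | ρ-σ v e = ≤-trans (n≤1+n _) (n≤1+n _)
    ... | zero rewrite δ-σ₀ v e with ρ-σ₀ v e
    ...   | inj₁ (lt , q) rewrite q = ⊓-glb (m⊓n≤m _ _) (≤-trans (m⊓n≤n (suc (suc (ρ v))) _)
        (≤-trans (∸-monoʳ-≤ k (n≤1+n (ρ v))) (n≤1+n _)))
    ...   | inj₂ (eq , q) rewrite q = ≤-trans (m⊓n≤m 1 k) (s≤s z≤n)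

-- Edges of the cycle

-- The index of c x when the numbering of a cycle of length suc k starts at c j.
renumber : ℕ → ℕ → ℕ → ℕ
renumber k j x with j ≤? x
... | yes _ = x ∸ j
... | no _ = (x + suc k) ∸ j

renumber-≥ : ∀ k {j x} → j ≤ x → renumber k j x ≡ x ∸ j
renumber-≥ k {j} {x} j≤x with j ≤? x
... | yes _ = refl
... | no j≰x = contradiction j≤x j≰x

renumber-< : ∀ k {j x} → x < j → renumber k j x ≡ (x + suc k) ∸ j
renumber-< k {j} {x} x<j with j ≤? x
... | yes j≤x = contradiction j≤x (<⇒≱ x<j)
... | no _ = refl

-- Every estimate for a cycle edge is proved for {c k , c 0} only. Renumbering from `c j` makes the
-- edge entering `c j` the closing one and leaves `σ` and the heights unchanged.
rotate : {G : Graph n} (F : CycleForest G) (j : ℕ) → j ≤ CycleForest.k F → CycleForest G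
rotate F j j≤k = record
  { k = k ; 2≤k = 2≤k ; σ = σ ; δ = δ
  ; ρ = λ v → renumber k j (ρ v)
  ; c = λ i → c (i + j)
  ; c-period = λ i → trans (cong c (trans (+-assoc i (suc k) j)
      (trans (cong (i +_) (+-comm (suc k) j)) (sym (+-assoc i j (suc k)))))) (c-period (i + j))
  ; ρ≤k = λ v → bounded (ρ v) (ρ≤k v)
  ; c-ρ = λ v e → trans (same (ρ v)) (c-ρ v e)
  ; δ-c = λ i → δ-c (i + j)
  ; ρ-c = index
  ; σ-c = λ i → σ-c (i + j)
  ; δ-σ = δ-σ
  ; ρ-σ = λ v e → cong (renumber k j) (ρ-σ v e)
  ; σ-adj = σ-adj ; adj-σ = adj-σ
  }
  where
  open CycleForest F
  bounded : ∀ x → x ≤ k → renumber k j x ≤ k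
  bounded x x≤k with j ≤? x
  ... | yes _ = ≤-trans (m∸n≤m x j) x≤k
  ... | no j≰x = s≤s⁻¹ (+-cancelʳ-≤ j _ _ (≤-trans (≤-reflexive
      (cong suc (m∸n+n≡m (≤-trans j≤k (≤-trans (n≤1+n k) (m≤n+m (suc k) x))))))
                   (≤-trans (≤-reflexive (cong suc (+-comm x (suc k))))
                       (≤-trans (≤-reflexive (sym (+-suc (suc k) x))) (+-monoʳ-≤ (suc k) (≰⇒> j≰x))))))
  same : ∀ x → c (renumber k j x + j) ≡ c x
  same x with j ≤? x
  ... | yes j≤x = cong c (m∸n+n≡m j≤x)
  ... | no _ = trans (cong c (m∸n+n≡m (≤-trans j≤k (≤-trans (n≤1+n k) (m≤n+m (suc k) x))))) (c-period x)
  index : ∀ {i} → i ≤ k → renumber k j (ρ (c (i + j))) ≡ i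
  index {i} i≤k with i + j ≤? k
  ... | yes i+j≤k = trans (cong (renumber k j) (ρ-c i+j≤k)) (trans (renumber-≥ k (m≤n+m j i)) (m+n∸n≡m i j))
  ... | no i+j≰k = begin
    renumber k j (ρ (c (i + j))) ≡⟨ cong (λ x → renumber k j (ρ (c x))) wrapped ⟨
    renumber k j (ρ (c (x + suc k))) ≡⟨ cong (λ v → renumber k j (ρ v)) (c-period x) ⟩
    renumber k j (ρ (c x)) ≡⟨ cong (renumber k j) (ρ-c (≤-trans (<⇒≤ x<j) j≤k)) ⟩
    renumber k j x ≡⟨ renumber-< k x<j ⟩
    x + suc k ∸ j ≡⟨ cong (_∸ j) wrapped ⟩
    i + j ∸ j ≡⟨ m+n∸n≡m i j ⟩
    i ∎
    where
    open ≡-Reasoning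
    x : ℕ
    x = i + j ∸ suc k
    wrapped : x + suc k ≡ i + j
    wrapped = m∸n+n≡m (≰⇒> i+j≰k)
    x<j : x < j
    x<j = +-cancelʳ-≤ k _ _ (≤-trans (≤-reflexive (trans (sym (+-suc x k)) wrapped))
        (≤-trans (+-monoˡ-≤ j i≤k) (≤-reflexive (+-comm k j))))

module Counting {G : Graph n} (conn : Connected G) (F : CycleForest G) where

  open CycleForest F
  open Forest conn F

  climb : ℕ → V → V
  climb zero v = v
  climb (suc i) v = σ (climb i v)

  climb-δρ : ∀ i v {j} → δ v ≡ i + j → δ (climb i v) ≡ j × ρ (climb i v) ≡ ρ v
  climb-δρ zero v e = e , refl
  climb-δρ (suc i) v {j} e = let p , q = climb-δρ i v (trans e (sym (+-suc i j)))
                             in δ-σ _ p , trans (ρ-σ _ p) q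

  climb-δ : ∀ {i v} → i ≤ δ v → δ (climb i v) ≡ δ v ∸ i
  climb-δ {i} {v} i≤ = proj₁ (climb-δρ i v (sym (m+[n∸m]≡n i≤)))

  climb-ρ : ∀ {i v} → i ≤ δ v → ρ (climb i v) ≡ ρ v
  climb-ρ {i} {v} i≤ = proj₂ (climb-δρ i v (sym (m+[n∸m]≡n i≤)))

  chain : V → List V
  chain v = applyUpTo (λ i → climb i v) (δ v)

  chain-Unique : ∀ v → Unique (chain v)
  chain-Unique v = Uniqueₚ.applyUpTo⁺₁ _ (δ v) λ {i} {j} i<j j<δ e → <⇒≢ i<j
    (∸-cancelˡ-≡ (<⇒≤ (<-trans i<j j<δ)) (<⇒≤ j<δ) (trans (sym (climb-δ (<⇒≤ (<-trans i<j j<δ))))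
        (trans (cong δ e) (climb-δ (<⇒≤ j<δ)))))

  chain-δ : ∀ v → All (λ w → 0 < δ w) (chain v)
  chain-δ v = Allₚ.applyUpTo⁺₁ _ (δ v) λ i< → ≤-trans (m<n⇒0<n∸m i<) (≤-reflexive (sym (climb-δ (<⇒≤ i<))))

  chain-ρ : ∀ v → All (λ w → ρ w ≡ ρ v) (chain v)
  chain-ρ v = Allₚ.applyUpTo⁺₁ _ (δ v) λ i< → climb-ρ (<⇒≤ i<)

  arc : ℕ → ℕ → List V
  arc l m = applyUpTo (λ i → c (l + i)) m

  arc-Unique : ∀ {l m} → l + m ≤ suc k → Unique (arc l m)
  arc-Unique {l} {m} l+m≤ = Uniqueₚ.applyUpTo⁺₁ _ m λ {i} {j} i<j j<m e → <⇒≢ i<j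
    (+-cancelˡ-≡ l i j (trans (sym (ρ-c (small (<-trans i<j j<m)))) (trans (cong ρ e) (ρ-c (small j<m)))))
    where
    small : ∀ {i} → i < m → l + i ≤ k
    small i<m = s≤s⁻¹ (≤-trans (≤-reflexive (sym (+-suc l _))) (≤-trans (+-monoʳ-≤ l i<m) l+m≤))

  arc-δ : ∀ l m → All (λ w → δ w ≡ 0) (arc l m)
  arc-δ l m = Allₚ.applyUpTo⁺₁ _ m λ {i} _ → δ-c (l + i)

  arc-ρ : ∀ {l m} → l + m ≤ suc k → All (λ w → l ≤ ρ w × ρ w < l + m) (arc l m)
  arc-ρ {l} {m} l+m≤ = Allₚ.applyUpTo⁺₁ _ m λ {i} i<m →
    let e = ρ-c {l + i} (s≤s⁻¹ (≤-trans (+-monoʳ-< l i<m) l+m≤))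
    in ≤-trans (m≤m+n l i) (≤-reflexive (sym e)) , ≤-trans (s≤s (≤-reflexive e)) (+-monoʳ-< l i<m)

  -- The `m` cycle vertices from `c l` on have height 0 and the chain of `u` has positive heights,
  -- so all these vertices are distinct.
  count-ρ : ∀ {P : ℕ → Set} (P? : U.Decidable P) l m → l + m ≤ suc k → (∀ {x} → l ≤ x → x < l + m → P x) →
    ∀ u → P (ρ u) → m + δ u ≤ ∑ (λ z → ⟦ P? (ρ z) ⟧)
  count-ρ {P} P? l m l+m≤ inside u Pu = begin
    m + δ u ≡⟨ cong₂ _+_ (length-applyUpTo (λ i → c (l + i)) m) (length-applyUpTo (λ i → climb i u) (δ u)) ⟨
    length (arc l m) + length (chain u) ≡⟨ length-++ (arc l m) ⟨
    length (arc l m ++ chain u) ≤⟨ count-Unique (P? ∘ ρ)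
        (Uniqueₚ.++⁺ (arc-Unique l+m≤) (chain-Unique u) (λ (a , b) → <⇒≢ (All.lookup (chain-δ u) b)
            (sym (All.lookup (arc-δ l m) a))))
        (Allₚ.++⁺ (All.map (λ (p , q) → inside p q) (arc-ρ l+m≤))
            (All.map (λ e → subst P (sym e) Pu) (chain-ρ u))) ⟩
    ∑ (λ z → ⟦ P? (ρ z) ⟧) ∎
    where open ≤-Reasoning

  to-c₀ to-c_k : ℕ → ℕ
  to-c₀ x = x ⊓ (suc k ∸ x)
  to-c_k x = suc x ⊓ (k ∸ x)

  D-tree : ∀ {z j} → δ z ≡ suc j → D z (c 0) ≡ j + to-c₀ (ρ z) × D z (c k) ≡ j + to-c_k (ρ z)
  D-tree {z} {j} e =
    trans (cong₂ _⊓_ (trans (dist-c₀ z) (cong (_+ to-c₀ (ρ z)) e))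
        (trans (dist-c₀ (σ z)) (cong₂ (λ x y → x + to-c₀ y) (δ-σ z e) (ρ-σ z e)))) (m≥n⇒m⊓n≡n (n≤1+n _)) ,
    trans (cong₂ _⊓_ (trans (dist-c_k z) (cong (_+ to-c_k (ρ z)) e))
        (trans (dist-c_k (σ z)) (cong₂ (λ x y → x + to-c_k y) (δ-σ z e) (ρ-σ z e)))) (m≥n⇒m⊓n≡n (n≤1+n _))

  D-cycle : ∀ {z} → δ z ≡ 0 → ρ z < k →
    D z (c 0) ≡ to-c₀ (ρ z) ⊓ to-c₀ (suc (ρ z)) × D z (c k) ≡ to-c_k (ρ z) ⊓ to-c_k (suc (ρ z))
  D-cycle {z} e ρ<k with ρ-σ₀ z e
  ... | inj₂ (q , _) = contradiction q (<⇒≢ ρ<k)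
  ... | inj₁ (_ , q) =
    cong₂ _⊓_ (trans (dist-c₀ z) (cong (_+ to-c₀ (ρ z)) e))
        (trans (dist-c₀ (σ z)) (cong₂ (λ x y → x + to-c₀ y) (δ-σ₀ z e) q)) ,
    cong₂ _⊓_ (trans (dist-c_k z) (cong (_+ to-c_k (ρ z)) e))
        (trans (dist-c_k (σ z)) (cong₂ (λ x y → x + to-c_k y) (δ-σ₀ z e) q))

  closer-c₀-tree : ∀ {z} → 0 < δ z → ρ z + ρ z < k → D z (c 0) < D z (c k)
  closer-c₀-tree {z} δ> ρ< with δ z in e
  ... | suc j = subst₂ _<_ (sym (proj₁ (D-tree e))) (sym (proj₂ (D-tree e)))
    (+-monoʳ-< j (≤-trans (s≤s (m⊓n≤m (ρ z) _)) (⊓-glb ≤-refl (m+n≤o⇒m≤o∸n (suc (ρ z)) ρ<))))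

  closer-c_k-tree : ∀ {z} → 0 < δ z → k < ρ z + ρ z → D z (c k) < D z (c 0)
  closer-c_k-tree {z} δ> ρ> with δ z in e
  ... | suc j = subst₂ _<_ (sym (proj₂ (D-tree e))) (sym (proj₁ (D-tree e)))
    (+-monoʳ-< j (≤-trans (s≤s (m⊓n≤n (suc (ρ z)) _))
      (⊓-glb (+-cancelʳ-< (ρ z) _ _ (≤-trans (≤-reflexive (cong suc (m∸n+n≡m (ρ≤k z)))) ρ>))
          (≤-reflexive (sym (+-∸-assoc 1 (ρ≤k z)))))))

  -- Here `z` names the edge from index ρ to ρ + 1, and both ends count, which moves the threshold
  -- from 2ρ < k for tree edges to 2ρ + 1 < k. At 2ρ + 1 = k the edge is the one opposite on an even
  -- cycle.
  closer-c₀-cycle : ∀ {z} → δ z ≡ 0 → suc (ρ z + ρ z) < k → D z (c 0) < D z (c k)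
  closer-c₀-cycle {z} e ρ< = subst₂ _<_ (sym (proj₁ q)) (sym (proj₂ q))
    (≤-trans (s≤s (≤-trans (m⊓n≤m _ _) (m⊓n≤m (ρ z) _)))
      (⊓-glb (⊓-glb ≤-refl (m+n≤o⇒m≤o∸n (suc (ρ z)) (≤-trans (n≤1+n _) ρ<)))
             (⊓-glb (n≤1+n _) (m+n≤o⇒m≤o∸n (suc (ρ z)) (≤-trans (≤-reflexive (cong suc (+-suc (ρ z) (ρ z))))
                 ρ<)))))
    where
    q = D-cycle e (≤-trans (s≤s (≤-trans (m≤m+n (ρ z) (ρ z)) (n≤1+n _))) ρ<)

  closer-c_k-cycle : ∀ {z} → δ z ≡ 0 → ρ z < k → k ≤ ρ z + ρ z → D z (c k) < D z (c 0)
  closer-c_k-cycle {z} e ρ<k ρ> = subst₂ _<_ (sym (proj₂ q)) (sym (proj₁ q))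
    (≤-trans (s≤s (≤-trans (m⊓n≤n (to-c_k (ρ z)) _) (m⊓n≤n (suc (suc (ρ z))) _)))
      (⊓-glb (⊓-glb small (≤-trans (≤-reflexive r) (∸-monoˡ-≤ (ρ z) (n≤1+n k))))
             (⊓-glb (≤-trans small (n≤1+n _)) (≤-reflexive r))))
    where
    q = D-cycle e ρ<k
    r : suc (k ∸ suc (ρ z)) ≡ k ∸ ρ z
    r = sym (+-∸-assoc 1 ρ<k)
    small : suc (k ∸ suc (ρ z)) ≤ ρ z
    small = ≤-trans (≤-reflexive r) (m≤n+o⇒m∸n≤o k (ρ z) ρ>)

module CycleEdges {G : Graph n} (conn : Connected G) (F : CycleForest G) where

  open CycleForest F
  open Forest conn F
  open Counting conn F

  before after : ℕ → ℕ
  before h = ∑ (λ z → ⟦ ρ z ℕₚ.<? h ⟧)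
  after h = ∑ (λ z → ⟦ h ℕₚ.<? ρ z ⟧)
  level : ℕ → ℕ
  level h = ∑ (λ z → ⟦ ρ z ℕₚ.≟ h ⟧)

  partition : ∀ h → before h + (level h + after h) ≡ n
  partition h = begin
    before h + (level h + after h) ≡⟨ cong (before h +_) (∑-+ _ _) ⟨
    before h + ∑ (λ z → ⟦ ρ z ℕₚ.≟ h ⟧ + ⟦ h ℕₚ.<? ρ z ⟧) ≡⟨ ∑-+ _ _ ⟨
    ∑ (λ z → ⟦ ρ z ℕₚ.<? h ⟧ + (⟦ ρ z ℕₚ.≟ h ⟧ + ⟦ h ℕₚ.<? ρ z ⟧)) ≡⟨ ∑-cong (λ z → one (ρ z)) ⟩
    ∑ {n} (λ _ → 1) ≡⟨ ∑-one n ⟩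
    n ∎
    where
    open ≡-Reasoning
    one : ∀ x → ⟦ x ℕₚ.<? h ⟧ + (⟦ x ℕₚ.≟ h ⟧ + ⟦ h ℕₚ.<? x ⟧) ≡ 1
    one x with <-cmp x h
    ... | tri< p q r = cong₂ _+_ (⟦⟧-yes (x ℕₚ.<? h) p) (cong₂ _+_ (⟦⟧-no (x ℕₚ.≟ h) q) (⟦⟧-no (h ℕₚ.<? x) r))
    ... | tri≈ p q r = cong₂ _+_ (⟦⟧-no (x ℕₚ.<? h) p) (cong₂ _+_ (⟦⟧-yes (x ℕₚ.≟ h) q) (⟦⟧-no (h ℕₚ.<? x) r))
    ... | tri> p q r = cong₂ _+_ (⟦⟧-no (x ℕₚ.<? h) p) (cong₂ _+_ (⟦⟧-no (x ℕₚ.≟ h) q) (⟦⟧-yes (h ℕₚ.<? x) r))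

  p-c_k : p (c k) ≡ C (c k) (c 0) * C (c 0) (c k)
  p-c_k = cong (λ v → C (c k) v * C v (c k)) (trans (σ-c k) c-wrap)

  cycle-vertex : ∀ {z i} → δ z ≡ 0 → ρ z ≡ i → z ≡ c i
  cycle-vertex {z} e refl = sym (c-ρ z e)

  ∑-with : ∀ (f : V → ℕ) x → ∑ (λ z → f z + ⟦ z ≟ x ⟧) ≡ suc (∑ f)
  ∑-with f x = trans (∑-+ f _) (trans (cong (∑ f +_) (trans (∑-cong (λ z → sym (*-identityʳ _)))
      (∑-δ x (λ _ → 1)))) (+-comm (∑ f) 1))

  module Odd (h : ℕ) (k≡ : k ≡ h + h) where

    before≤ : before h ≤ C (c 0) (c k)
    before≤ = ∑-mono λ z → ⟦⟧-mono (ρ z ℕₚ.<? h) (D z (c 0) ℕₚ.<? D z (c k)) (near z)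
      where
      near : ∀ z → ρ z < h → D z (c 0) < D z (c k)
      near z ρ<h with δ z in e
      ... | suc j = closer-c₀-tree (≤-trans (s≤s z≤n) (≤-reflexive (sym e)))
          (≤-trans (+-mono-<-≤ ρ<h (<⇒≤ ρ<h)) (≤-reflexive (sym k≡)))
      ... | zero = closer-c₀-cycle e (≤-trans (≤-reflexive (cong suc (sym (+-suc (ρ z) (ρ z)))))
          (≤-trans (+-mono-≤ ρ<h ρ<h) (≤-reflexive (sym k≡))))

    h<k : h < k
    h<k = half-< h k≡
      where
      half-< : ∀ h → k ≡ h + h → h < k
      half-< zero e = contradiction (subst (2 ≤_) e 2≤k) λ ()
      half-< (suc h) e = ≤-trans (s≤s (m≤n+m (suc h) h)) (≤-reflexive (sym e))

    -- The edge {c h , c (suc h)} is closer to c k although ρ (c h) = h; it makes up for the edge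
    -- {c k , c 0} itself.
    after≤ : after h ≤ C (c k) (c 0)
    after≤ = s≤s⁻¹ (begin
      suc (after h) ≡⟨ ∑-with _ (c h) ⟨
      ∑ (λ z → ⟦ h ℕₚ.<? ρ z ⟧ + ⟦ z ≟ c h ⟧) ≤⟨ ∑-mono each ⟩
      ∑ (λ z → ⟦ D z (c k) ℕₚ.<? D z (c 0) ⟧ + ⟦ z ≟ c k ⟧) ≡⟨ ∑-with _ (c k) ⟩
      suc (C (c k) (c 0)) ∎)
      where
      open ≤-Reasoning
      h≤k : h ≤ k
      h≤k = <⇒≤ h<k
      far : ∀ z → z ≢ c k → h < ρ z → D z (c k) < D z (c 0)
      far z z≢ h<ρ with δ z in e
      ... | suc j = closer-c_k-tree (≤-trans (s≤s z≤n) (≤-reflexive (sym e)))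
          (≤-trans (≤-reflexive (cong suc k≡)) (+-mono-<-≤ h<ρ (<⇒≤ h<ρ)))
      ... | zero = closer-c_k-cycle e (≤∧≢⇒< (ρ≤k z) (λ q → z≢ (cycle-vertex e q)))
          (≤-trans (≤-reflexive k≡) (+-mono-≤ (<⇒≤ h<ρ) (<⇒≤ h<ρ)))
      each : ∀ z → ⟦ h ℕₚ.<? ρ z ⟧ + ⟦ z ≟ c h ⟧ ≤ ⟦ D z (c k) ℕₚ.<? D z (c 0) ⟧ + ⟦ z ≟ c k ⟧
      each z with h ℕₚ.<? ρ z | z ≟ c h | z ≟ c k
      ... | no _ | no _ | _ = z≤n
      ... | yes h<ρ | yes refl | _ = contradiction (ρ-c h≤k) (<⇒≢ h<ρ ∘ sym)
      ... | yes _ | no _ | yes _ = m≤n+m 1 _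
      ... | yes h<ρ | no _ | no z≢ = ≤-trans (≤-reflexive
          (sym (⟦⟧-yes (D z (c k) ℕₚ.<? D z (c 0)) (far z z≢ h<ρ)))) (m≤m+n _ 0)
      ... | no _ | yes _ | yes _ = m≤n+m 1 _
      ... | no _ | yes refl | no _ = ≤-trans (≤-reflexive (sym (⟦⟧-yes (D (c h) (c k) ℕₚ.<? D (c h) (c 0))
             (closer-c_k-cycle (δ-c h) (≤-trans (s≤s (≤-reflexive (ρ-c h≤k))) h<k)
                 (≤-reflexive (trans k≡ (sym (cong₂ _+_ (ρ-c h≤k) (ρ-c h≤k))))))))) (m≤m+n _ 0)

    edge-bound : before h * after h ≤ p (c k)
    edge-bound = ≤-trans (≤-trans (*-mono-≤ before≤ after≤) (≤-reflexive (*-comm (C (c 0) (c k)) _)))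
        (≤-reflexive (sym p-c_k))

  module Even (m : ℕ) (k≡ : k ≡ suc (m + m)) where

    -- `c m` names the edge opposite to {c k , c 0}, which lies on neither side; the `suc` on the
    -- right stands for it. In `after≤` the corresponding name is `c k`, the edge itself.
    before≤ : before (suc m) ≤ suc (C (c 0) (c k))
    before≤ = ≤-trans (∑-mono each) (≤-reflexive (∑-with _ (c m)))
      where
      near : ∀ z → z ≢ c m → ρ z ≤ m → D z (c 0) < D z (c k)
      near z z≢ ρ≤m with δ z in e
      ... | suc j = closer-c₀-tree (≤-trans (s≤s z≤n) (≤-reflexive (sym e)))
          (≤-trans (s≤s (+-mono-≤ ρ≤m ρ≤m)) (≤-reflexive (sym k≡)))
      ... | zero = closer-c₀-cycle e (≤-trans (s≤s (+-mono-<-≤ (≤∧≢⇒< ρ≤m (λ q → z≢ (cycle-vertex e q))) ρ≤m))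
          (≤-reflexive (sym k≡)))
      each : ∀ z → ⟦ ρ z ℕₚ.<? suc m ⟧ ≤ ⟦ D z (c 0) ℕₚ.<? D z (c k) ⟧ + ⟦ z ≟ c m ⟧
      each z with ρ z ℕₚ.<? suc m | z ≟ c m
      ... | no _ | _ = z≤n
      ... | yes _ | yes _ = m≤n+m 1 _
      ... | yes ρ< | no z≢ = ≤-trans (≤-reflexive (sym (⟦⟧-yes (D z (c 0) ℕₚ.<? D z (c k))
          (near z z≢ (s≤s⁻¹ ρ<))))) (m≤m+n _ 0)

    after≤ : after m ≤ suc (C (c k) (c 0))
    after≤ = ≤-trans (∑-mono each) (≤-reflexive (∑-with _ (c k)))
      where
      far : ∀ z → z ≢ c k → m < ρ z → D z (c k) < D z (c 0)
      far z z≢ m<ρ with δ z in e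
      ... | suc j = closer-c_k-tree (≤-trans (s≤s z≤n) (≤-reflexive (sym e)))
          (≤-trans (≤-reflexive (trans (cong suc k≡) (cong suc (sym (+-suc m m))))) (+-mono-≤ m<ρ m<ρ))
      ... | zero = closer-c_k-cycle e (≤∧≢⇒< (ρ≤k z) (λ q → z≢ (cycle-vertex e q)))
          (≤-trans (≤-reflexive k≡) (+-mono-<-≤ m<ρ (<⇒≤ m<ρ)))
      each : ∀ z → ⟦ m ℕₚ.<? ρ z ⟧ ≤ ⟦ D z (c k) ℕₚ.<? D z (c 0) ⟧ + ⟦ z ≟ c k ⟧
      each z with m ℕₚ.<? ρ z | z ≟ c k
      ... | no _ | _ = z≤n
      ... | yes _ | yes _ = m≤n+m 1 _
      ... | yes m<ρ | no z≢ = ≤-trans (≤-reflexive (sym (⟦⟧-yes (D z (c k) ℕₚ.<? D z (c 0)) (far z z≢ m<ρ))))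
          (m≤m+n _ 0)

    partition′ : before (suc m) + after m ≡ n
    partition′ = trans (sym (∑-+ _ _)) (trans (∑-cong (λ z → one (ρ z))) (∑-one n))
      where
      one : ∀ x → ⟦ x ℕₚ.<? suc m ⟧ + ⟦ m ℕₚ.<? x ⟧ ≡ 1
      one x with m ℕₚ.<? x
      ... | yes m<x = cong (_+ 1) (⟦⟧-no (x ℕₚ.<? suc m) (λ q → <⇒≱ m<x (s≤s⁻¹ q)))
      ... | no m≮x = cong (_+ 0) (⟦⟧-yes (x ℕₚ.<? suc m) (s≤s (≮⇒≥ m≮x)))

    edge-bound : ∀ {K} → suc K ≤ before (suc m) → suc K ≤ after m → K * (n ∸ 2 ∸ K) ≤ p (c k)
    edge-bound {K} K< K<′ = begin
      K * (n ∸ 2 ∸ K) ≡⟨ cong (λ x → K * (x ∸ K)) (∸-+-assoc n 1 1) ⟨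
      K * (n ∸ 1 ∸ 1 ∸ K) ≤⟨ product-bound (s≤s⁻¹ (≤-trans K<′ after≤)) (s≤s⁻¹ (≤-trans K< before≤)) total ⟩
      C (c k) (c 0) * C (c 0) (c k) ≡⟨ p-c_k ⟨
      p (c k) ∎
      where
      open ≤-Reasoning
      total : n ∸ 1 ≤ suc (C (c k) (c 0) + C (c 0) (c k))
      total = ∸-monoˡ-≤ 1 (begin
        n ≡⟨ partition′ ⟨
        before (suc m) + after m ≤⟨ +-mono-≤ before≤ after≤ ⟩
        suc (C (c 0) (c k)) + suc (C (c k) (c 0)) ≡⟨ cong suc
            (trans (+-suc _ _) (cong suc (+-comm (C (c 0) (c k)) _))) ⟩
        suc (suc (C (c k) (c 0) + C (c 0) (c k))) ∎)

-- On an odd cycle the edges hanging opposite to the edge {c k , c 0} count on neither of its sides;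
-- the loss is recovered from the edge {c m , c (suc m)} across the cycle.
module Opposite {G : Graph n} (conn : Connected G) (F : CycleForest G) (m : ℕ) where

  open CycleForest F
  open Forest conn F
  open Counting conn F
  open CycleEdges conn F

  private
    h : ℕ
    h = suc m

  c-opposite : c (k + h) ≡ c m
  c-opposite = trans (cong c (trans (+-suc k m) (trans (cong suc (+-comm k m)) (sym (+-suc m k)))))
      (c-period m)

  module _ (k≡ : k ≡ h + h) where

    private
      h≤k : h ≤ k
      h≤k = ≤-trans (m≤m+n h h) (≤-reflexive (sym k≡))
      F′ : CycleForest G
      F′ = rotate F h h≤k
      module R = CycleEdges conn F′

    after′ : before h ≤ R.after h
    after′ = ∑-mono λ z → ⟦⟧-mono (ρ z ℕₚ.<? h) (h ℕₚ.<? renumber k h (ρ z)) λ ρ<h →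
      ≤-trans (≤-trans (m≤n+m (suc h) (ρ z)) (m+n≤o⇒m≤o∸n (ρ z + suc h)
          (≤-reflexive (trans (+-assoc (ρ z) (suc h) h) (cong (λ x → ρ z + suc x) (sym k≡))))))
        (≤-reflexive (sym (renumber-< k ρ<h)))

    -- After rotation by `h` the indices below `h` are the old h, ..., 2h - 1: everything over
    -- `c h`, the corner lost to {c k , c 0}, and at least the `m` cycle vertices after it.
    before′ : level h + m ≤ R.before h
    before′ = begin
      level h + m ≤⟨ +-monoʳ-≤ (level h) inner ⟩
      level h + ∑ (λ z → ⟦ (suc h ℕₚ.≤? ρ z) ×-dec (ρ z ℕₚ.<? h + h) ⟧) ≡⟨ ∑-+ _ _ ⟨
      ∑ (λ z → ⟦ ρ z ℕₚ.≟ h ⟧ + ⟦ (suc h ℕₚ.≤? ρ z) ×-dec (ρ z ℕₚ.<? h + h) ⟧) ≤⟨ ∑-mono (λ z → each (ρ z)) ⟩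
      R.before h ∎
      where
      open ≤-Reasoning
      fits : suc h + m ≤ suc k
      fits = ≤-trans (≤-reflexive (sym (+-suc h m))) (≤-trans (≤-reflexive (sym k≡)) (n≤1+n k))
      inner : m ≤ ∑ (λ z → ⟦ (suc h ℕₚ.≤? ρ z) ×-dec (ρ z ℕₚ.<? h + h) ⟧)
      inner = ≤-trans (≤-reflexive (sym (length-applyUpTo (λ i → c (suc h + i)) m)))
        (count-Unique (λ z → (suc h ℕₚ.≤? ρ z) ×-dec (ρ z ℕₚ.<? h + h)) (arc-Unique fits)
          (All.map (λ (l , u) → l , ≤-trans u (≤-reflexive (sym (+-suc h m)))) (arc-ρ fits)))
      small : ∀ {x} → h ≤ x → x < h + h → renumber k h x < h
      small h≤x x<2h = ≤-trans (s≤s (≤-reflexive (renumber-≥ k h≤x)))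
          (+-cancelʳ-≤ h _ _ (≤-trans (≤-reflexive (cong suc (m∸n+n≡m h≤x))) x<2h))
      each : ∀ x → ⟦ x ℕₚ.≟ h ⟧ + ⟦ (suc h ℕₚ.≤? x) ×-dec (x ℕₚ.<? h + h) ⟧ ≤ ⟦ renumber k h x ℕₚ.<? h ⟧
      each x with x ℕₚ.≟ h | (suc h ℕₚ.≤? x) ×-dec (x ℕₚ.<? h + h)
      ... | no _ | no _ = z≤n
      ... | yes refl | yes (l , _) = contradiction l 1+n≰n
      ... | yes refl | no _ = ≤-reflexive (sym (⟦⟧-yes (renumber k h h ℕₚ.<? h)
          (small ≤-refl (m<m+n h (s≤s z≤n)))))
      ... | no _ | yes (l , u) = ≤-reflexive (sym (⟦⟧-yes (renumber k h x ℕₚ.<? h) (small (<⇒≤ l) u)))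

    -- Let x, l, y be `before h`, `level h`, `after h`. The two edges give x y + (l + m) x = x (l -
    -- 1 + y) + x h. As x + (l - 1) + y = n - 1, the first product is bounded as for a bridge: the
    -- corner `c h` has been recovered, with K h to spare.
    odd-pair : ∀ {K} → K ≤ before h → K ≤ after h → K * (n ∸ 1 ∸ K) + K * h ≤ p (c k) + p (c m)
    odd-pair {K} K≤ K≤′ = begin
      K * (n ∸ 1 ∸ K) + K * h ≤⟨ +-mono-≤ (product-bound K≤ (≤-trans K≤′ (m≤n+m _ z)) total) (*-monoˡ-≤ h K≤)
          ⟩
      before h * (z + after h) + before h * h ≡⟨ regroup ⟩
      before h * after h + (level h + m) * before h ≤⟨ +-mono-≤ (Odd.edge-bound h k≡)
          (*-mono-≤ before′ after′) ⟩
      p (c k) + R.before h * R.after h ≤⟨ +-monoʳ-≤ (p (c k)) (R.Odd.edge-bound h k≡) ⟩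
      p (c k) + p (c (k + h)) ≡⟨ cong (λ v → p (c k) + p v) c-opposite ⟩
      p (c k) + p (c m) ∎
      where
      open ≤-Reasoning
      z : ℕ
      z = level h ∸ 1
      nonempty : 1 ≤ level h
      nonempty = count-Unique (λ z → ρ z ℕₚ.≟ h) {c h ∷ []} ([] ∷ []) (ρ-c h≤k ∷ [])
      level≡ : level h ≡ suc z
      level≡ = sym (m+[n∸m]≡n nonempty)
      total : n ≤ suc (before h + (z + after h))
      total = ≤-reflexive (trans (sym (partition h)) (trans (cong (λ l → before h + (l + after h)) level≡)
          (+-suc (before h) _)))
      solve-ring : ∀ x z y m → x * (z + y) + x * suc m ≡ x * y + (suc z + m) * x
      solve-ring = solve-∀
      regroup : before h * (z + after h) + before h * h ≡ before h * after h + (level h + m) * before h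
      regroup = trans (solve-ring (before h) z (after h) m)
          (cong (λ l → before h * after h + (l + m) * before h) (sym level≡))

  module _ (k≡ : k ≡ suc (m + m)) where

    private
      h≤k : h ≤ k
      h≤k = ≤-trans (s≤s (m≤m+n m m)) (≤-reflexive (sym k≡))
      F′ : CycleForest G
      F′ = rotate F h h≤k
      module R = CycleEdges conn F′

    -- Rotation by `h` exchanges the two sides, so the opposite edge obeys the same bound as {c k ,
    -- c 0}.
    even-pair : ∀ {K} → suc K ≤ before h → suc K ≤ after m → K * (n ∸ 2 ∸ K) ≤ p (c k) × K * (n ∸ 2 ∸ K) ≤ p
        (c m)
    even-pair {K} K< K<′ = Even.edge-bound m k≡ K< K<′ ,
      ≤-trans (R.Even.edge-bound m k≡ (≤-trans K<′ before″) (≤-trans K< after″))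
          (≤-reflexive (cong p c-opposite))
      where
      before″ : after m ≤ R.before h
      before″ = ∑-mono λ z → ⟦⟧-mono (m ℕₚ.<? ρ z) (renumber k h (ρ z) ℕₚ.<? h) λ m<ρ →
        ≤-trans (s≤s (≤-reflexive (renumber-≥ k m<ρ))) (s≤s
            (≤-trans (∸-monoˡ-≤ h (≤-trans (ρ≤k z) (≤-reflexive (trans k≡ (sym (+-suc m m))))))
            (≤-reflexive (m+n∸n≡m m h))))
      after″ : before h ≤ R.after m
      after″ = ∑-mono λ z → ⟦⟧-mono (ρ z ℕₚ.<? h) (m ℕₚ.<? renumber k h (ρ z)) λ ρ<h →
        ≤-trans (≤-trans (m≤n+m h (ρ z)) (m+n≤o⇒m≤o∸n (ρ z + h)
            (≤-reflexive (trans (+-assoc (ρ z) h h) (cong (ρ z +_)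
            (trans (cong suc (+-suc m m)) (cong suc (sym k≡))))))))
          (≤-reflexive (sym (renumber-< k ρ<h)))

-- Inequalities between products

Σ< : ℕ → (ℕ → ℕ) → ℕ
Σ< zero f = 0
Σ< (suc m) f = f 0 + Σ< m (f ∘ suc)

sum-applyUpTo : ∀ {A : Set} (h : A → ℕ) (f : ℕ → A) m → sum (map h (applyUpTo f m)) ≡ Σ< m (h ∘ f)
sum-applyUpTo h f zero = refl
sum-applyUpTo h f (suc m) = cong (h (f 0) +_) (sum-applyUpTo h (f ∘ suc) m)

Σ<-cong : ∀ m {f g : ℕ → ℕ} → (∀ {i} → i < m → f i ≡ g i) → Σ< m f ≡ Σ< m g
Σ<-cong zero h = refl
Σ<-cong (suc m) h = cong₂ _+_ (h z<s) (Σ<-cong m (λ i< → h (s<s i<)))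

Σ<-mono : ∀ m {f g : ℕ → ℕ} → (∀ {i} → i < m → f i ≤ g i) → Σ< m f ≤ Σ< m g
Σ<-mono zero h = z≤n
Σ<-mono (suc m) h = +-mono-≤ (h z<s) (Σ<-mono m (λ i< → h (s<s i<)))

Σ<-split : ∀ m l (f : ℕ → ℕ) → Σ< (m + l) f ≡ Σ< m f + Σ< l (λ i → f (m + i))
Σ<-split zero l f = refl
Σ<-split (suc m) l f = trans (cong (f 0 +_) (Σ<-split m l (f ∘ suc))) (sym (+-assoc (f 0) _ _))

Σ<-+ : ∀ m (f g : ℕ → ℕ) → Σ< m (λ i → f i + g i) ≡ Σ< m f + Σ< m g
Σ<-+ zero f g = refl
Σ<-+ (suc m) f g = trans (cong (f 0 + g 0 +_) (Σ<-+ m (f ∘ suc) (g ∘ suc))) (shuffle (f 0) (g 0) _ _)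
  where
  shuffle : ∀ a b c d → a + b + (c + d) ≡ a + c + (b + d)
  shuffle = solve-∀

Σ<-last : ∀ m (f : ℕ → ℕ) → Σ< (suc m) f ≡ Σ< m f + f m
Σ<-last m f = trans (cong (λ x → Σ< x f) (sym (+-comm m 1)))
  (trans (Σ<-split m 1 f) (cong (Σ< m f +_) (trans (+-identityʳ _) (cong f (+-identityʳ m)))))

Σ<-reverse : ∀ m (f : ℕ → ℕ) → Σ< m (λ i → f (m ∸ suc i)) ≡ Σ< m f
Σ<-reverse zero f = refl
Σ<-reverse (suc m) f = trans (cong (f m +_) (Σ<-reverse m f)) (trans (+-comm (f m) _) (sym (Σ<-last m f)))

Σ<-excess : ∀ t {F G : ℕ → ℕ} {D} j → j < t → (∀ {i} → i < t → F i ≤ G i) → F j + D ≤ G j → Σ< t F + D ≤ Σ< t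
    G
Σ<-excess (suc t) {F} {G} {D} zero _ le ex = ≤-trans
  (≤-reflexive (trans (+-assoc (F 0) _ D) (trans (cong (F 0 +_) (+-comm _ D)) (sym (+-assoc (F 0) D _)))))
  (+-mono-≤ ex (Σ<-mono t (λ i< → le (s<s i<))))
Σ<-excess (suc t) {F} {G} {D} (suc j) (s≤s j<t) le ex = ≤-trans
  (≤-reflexive (+-assoc (F 0) _ D))
  (+-mono-≤ (le z<s) (Σ<-excess t j j<t (λ i< → le (s<s i<)) ex))

-- For a surplus visible only on two terms together. The surplus `d` of the later term is carried by
-- `Σ<-excess` on the tail, and the earlier term owes just the remainder.
Σ<-excess₂ : ∀ t {F G : ℕ → ℕ} {D} j l → j < l → l < t → (∀ {i} → i < t → F i ≤ G i) →
  F j + F l + D ≤ G j + G l → Σ< t F + D ≤ Σ< t G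
Σ<-excess₂ (suc t) {F} {G} {D} zero (suc l) _ (s≤s l<t) le ex = begin
  F 0 + Σ< t (F ∘ suc) + D     ≡⟨ rot₁ (F 0) _ D ⟩
  (F 0 + D) + Σ< t (F ∘ suc)   ≤⟨ +-monoˡ-≤ _ head ⟩
  G 0 + d + Σ< t (F ∘ suc)     ≡⟨ rot₂ (G 0) d _ ⟩
  G 0 + (Σ< t (F ∘ suc) + d)   ≤⟨ +-monoʳ-≤ (G 0) (Σ<-excess t l l<t (λ i< → le (s<s i<)) (≤-reflexive Gl)) ⟩
  G 0 + Σ< t (G ∘ suc)         ∎
  where
  open ≤-Reasoning
  d : ℕ
  d = G (suc l) ∸ F (suc l)
  Gl : F (suc l) + d ≡ G (suc l)
  Gl = m+[n∸m]≡n (le (s<s l<t))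
  rot₁ : ∀ a b c → a + b + c ≡ a + c + b
  rot₁ = solve-∀
  rot₂ : ∀ a b c → a + b + c ≡ a + (c + b)
  rot₂ = solve-∀
  rot₃ : ∀ a b c → b + (a + c) ≡ a + b + c
  rot₃ = solve-∀
  rot₄ : ∀ a b c → a + (b + c) ≡ b + (a + c)
  rot₄ = solve-∀
  head : F 0 + D ≤ G 0 + d
  head = +-cancelˡ-≤ (F (suc l)) _ _ (begin
    F (suc l) + (F 0 + D)      ≡⟨ rot₃ (F 0) (F (suc l)) D ⟩
    F 0 + F (suc l) + D        ≤⟨ ex ⟩
    G 0 + G (suc l)            ≡⟨ cong (G 0 +_) (sym Gl) ⟩
    G 0 + (F (suc l) + d)      ≡⟨ rot₄ (G 0) (F (suc l)) d ⟩
    F (suc l) + (G 0 + d)      ∎)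
Σ<-excess₂ (suc t) {F} {G} {D} (suc j) (suc l) (s≤s j<l) (s≤s l<t) le ex = ≤-trans
  (≤-reflexive (+-assoc (F 0) _ D))
  (+-mono-≤ (le z<s) (Σ<-excess₂ t j l j<l l<t (λ i< → le (s<s i<)) ex))

-- f n m is m_u m_v for a bridge uv with m edges on one side; fᵉ is the same on an even cycle,
-- where the opposite edge is equidistant too.
opaque
  f : ℕ → ℕ → ℕ
  f n m = m * (n ∸ 1 ∸ m)

  fᵉ : ℕ → ℕ → ℕ
  fᵉ n m = m * (n ∸ 2 ∸ m)

opaque
  unfolding f fᵉ

  f-def : ∀ n m → f n m ≡ m * (n ∸ 1 ∸ m)
  f-def n m = refl

  fᵉ-def : ∀ n m → fᵉ n m ≡ m * (n ∸ 2 ∸ m)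
  fᵉ-def n m = refl

  f-mono : ∀ n {i m} → i ≤ m → suc (m + m) ≤ n → f n i ≤ f n m
  f-mono n {i} {m} i≤m le = product-bound i≤m (≤-trans i≤m m≤)
      (≤-reflexive (trans (sym (m+[n∸m]≡n (≤-trans (s≤s z≤n) le)))
      (cong suc (sym (m+[n∸m]≡n (≤-trans (m≤n+m m m) (∸-monoˡ-≤ 1 le)))))))
    where
    m≤ : m ≤ n ∸ 1 ∸ m
    m≤ = m+n≤o⇒m≤o∸n m (∸-monoˡ-≤ 1 le)

  f-at : ∀ {n i} x → n ≡ suc (i + x) → f n i ≡ i * x
  f-at {i = i} x refl = cong (i *_) (m+n∸m≡n i x)

  fᵉ-at : ∀ {n i} x → n ≡ suc (suc (i + x)) → fᵉ n i ≡ i * x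
  fᵉ-at {i = i} x refl = cong (i *_) (m+n∸m≡n i x)

  fᵉ-mono : ∀ n {i m} → i ≤ m → suc (suc (m + m)) ≤ n → fᵉ n i ≤ fᵉ n m
  fᵉ-mono (suc n) {i} {m} i≤m (s≤s le) = f-mono n i≤m le

  f-zero : ∀ n → f n 0 ≡ 0
  f-zero n = refl

slack : ∀ {x y} z → y ≡ x + z → x ≤ y
slack {x} z refl = m≤m+n x z

∃-slack : ∀ {x y} → x ≤ y → ∃[ z ] y ≡ x + z
∃-slack {x} {y} le = y ∸ x , sym (m+[n∸m]≡n le)

-- In the lemmas below D stands for 2n − 2 − 2b, and the numbers are written as sums of
-- their lower bounds and slacks, so that no subtraction occurs.

-- On an even cycle the opposite edge is lost, so `fᵉ` alone can fall below `f`; the two edges of a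
-- pair together make up for this.
f≤2fᵉ : ∀ n {i m} → i ≤ m → suc (suc (m + m)) ≤ n → f n i ≤ fᵉ n m + fᵉ n m
f≤2fᵉ n {zero} i≤m le = ≤-trans (≤-reflexive (f-zero n)) z≤n
f≤2fᵉ n {suc i} {m} i≤m le with x , refl ← ∃-slack le with y , refl ← ∃-slack i≤m = begin
  f n′ (suc i)                                ≡⟨ f-at (suc (suc i + y + y + x)) (e₁ i y x) ⟩
  suc i * suc (suc i + y + y + x)             ≤⟨ slack _ (fin i y x) ⟩
  _                                           ≡⟨ cong₂ _+_ fm fm ⟨
  fᵉ n′ (suc i + y) + fᵉ n′ (suc i + y)       ∎
  where
  open ≤-Reasoning
  n′ : ℕ
  n′ = suc (suc (suc i + y + (suc i + y))) + x
  e₁ : ∀ i y x → suc (suc (suc i + y + (suc i + y))) + x ≡ suc (suc i + suc (suc i + y + y + x))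
  e₁ = solve-∀
  e₂ : ∀ i y x → suc (suc (suc i + y + (suc i + y))) + x ≡ suc (suc (suc i + y + (suc i + y + x)))
  e₂ = solve-∀
  fm : fᵉ n′ (suc i + y) ≡ (suc i + y) * (suc i + y + x)
  fm = fᵉ-at (suc i + y + x) (e₂ i y x)
  fin : ∀ i y x → (suc i + y) * (suc i + y + x) + (suc i + y) * (suc i + y + x) ≡
    suc i * suc (suc i + y + y + x) + (suc i * i + 2 * suc i * y + 2 * y * y + suc i * x + 2 * y * x)
  fin = solve-∀

-- `fᵉ` increases up to the middle, and its value at 1 is n - 3.
fᵉ-large : ∀ {n m} → 1 ≤ m → suc (suc (m + m)) ≤ n → n ≤ fᵉ n m + 3
fᵉ-large {n} {m} 1≤m le = begin
  n              ≤⟨ m≤n+m∸n n 3 ⟩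
  3 + (n ∸ 3)    ≡⟨ trans (+-comm 3 _) (cong (_+ 3) (trans (sym (∸-+-assoc n 2 1))
      (trans (sym (*-identityˡ _)) (sym (fᵉ-def n 1))))) ⟩
  fᵉ n 1 + 3     ≤⟨ +-monoˡ-≤ 3 (fᵉ-mono n 1≤m le) ⟩
  fᵉ n m + 3     ∎
  where open ≤-Reasoning

D-bound : ∀ {n D b} → 1 ≤ b → D + (2 * b + 2) ≡ 2 * n → D + 4 ≤ 2 * n
D-bound {n} {D} {b} 1≤b D≡ = ≤-trans (+-monoʳ-≤ D (+-monoˡ-≤ 2 (*-monoʳ-≤ 2 1≤b))) (≤-reflexive D≡)

f+2≤2fᵉ : ∀ {n q K} → q < K → suc (suc (K + K)) ≤ n → f n q + 2 ≤ fᵉ n K + fᵉ n K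
f+2≤2fᵉ {n} {q} {K} q<K le = ≤-trans step (+-mono-≤ (fᵉ-mono n q<K le) (fᵉ-mono n q<K le))
  where
  step : f n q + 2 ≤ fᵉ n (suc q) + fᵉ n (suc q)
  step with x , refl ← ∃-slack (≤-trans (s≤s (s≤s (+-mono-≤ q<K q<K))) le) = begin
    f _ q + 2 ≡⟨ cong (_+ 2) (f-at (q + 3 + x) (e₁ q x)) ⟩
    q * (q + 3 + x) + 2 ≤⟨ slack _ (fin q x) ⟩
    _ ≡⟨ cong₂ _+_ (fᵉ-at (q + 1 + x) (e₂ q x)) (fᵉ-at (q + 1 + x) (e₂ q x)) ⟨
    fᵉ _ (suc q) + fᵉ _ (suc q) ∎
    where
    open ≤-Reasoning
    e₁ : ∀ q x → suc (suc (suc q + suc q)) + x ≡ suc (q + (q + 3 + x))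
    e₁ = solve-∀
    e₂ : ∀ q x → suc (suc (suc q + suc q)) + x ≡ suc (suc (suc q + (q + 1 + x)))
    e₂ = solve-∀
    fin : ∀ q x → suc q * (q + 1 + x) + suc q * (q + 1 + x) ≡ q * (q + 3 + x) + 2 +
        (q * q + q + q * x + 2 * x)
    fin = solve-∀

-- The second pair is one that the path does not use. It gives at least 2 (n - 3), while D ≤ 2n - 4;
-- the missing 2 comes from the first pair by `f+2≤2fᵉ`.
even-apart : ∀ {n q K m D b} → q < K → suc (suc (K + K)) ≤ n → 1 ≤ m → suc (suc (m + m)) ≤ n → 1 ≤ b →
  D + (2 * b + 2) ≡ 2 * n → f n q + D ≤ (fᵉ n K + fᵉ n K) + (fᵉ n m + fᵉ n m)
even-apart {n} {q} {K} {m} {D} {b} q<K leK 1≤m lem 1≤b D≡ = +-cancelʳ-≤ 6 _ _ (begin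
  f n q + D + 6                                   ≡⟨ e₁ (f n q) D ⟩
  (f n q + 2) + (D + 4)                           ≤⟨ +-mono-≤ (f+2≤2fᵉ q<K leK) (D-bound {n} 1≤b D≡) ⟩
  (fᵉ n K + fᵉ n K) + 2 * n                       ≤⟨ +-monoʳ-≤ (fᵉ n K + fᵉ n K)
      (*-monoʳ-≤ 2 (fᵉ-large 1≤m lem)) ⟩
  (fᵉ n K + fᵉ n K) + 2 * (fᵉ n m + 3)            ≡⟨ e₂ (fᵉ n K + fᵉ n K) (fᵉ n m) ⟩
  (fᵉ n K + fᵉ n K) + (fᵉ n m + fᵉ n m) + 6       ∎)
  where
  open ≤-Reasoning
  e₁ : ∀ x y → x + y + 6 ≡ x + 2 + (y + 4)
  e₁ = solve-∀
  e₂ : ∀ x y → x + 2 * (y + 3) ≡ x + (y + y) + 6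
  e₂ = solve-∀

even-off : ∀ {n m D b} → 1 ≤ m → suc (suc (m + m)) ≤ n → 1 ≤ b → 6 ≤ n →
  D + (2 * b + 2) ≡ 2 * n → D ≤ (fᵉ n m + fᵉ n m) + (fᵉ n m + fᵉ n m)
even-off {n} {m} {D} {b} 1≤m le 1≤b 6≤n D≡ = +-cancelʳ-≤ 12 _ _ (begin
  D + 12                          ≡⟨ +-assoc D 4 8 ⟨
  D + 4 + 8                       ≤⟨ +-mono-≤ (D-bound {n} 1≤b D≡) (≤-trans (m≤m+n 8 4) (*-monoʳ-≤ 2 6≤n)) ⟩
  2 * n + 2 * n                   ≤⟨ +-mono-≤ (*-monoʳ-≤ 2 large) (*-monoʳ-≤ 2 large) ⟩
  2 * (fᵉ n m + 3) + 2 * (fᵉ n m + 3) ≡⟨ e (fᵉ n m) ⟩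
  (fᵉ n m + fᵉ n m) + (fᵉ n m + fᵉ n m) + 12 ∎)
  where
  open ≤-Reasoning
  large : n ≤ fᵉ n m + 3
  large = fᵉ-large 1≤m le
  e : ∀ x → 2 * (x + 3) + 2 * (x + 3) ≡ (x + x) + (x + x) + 12
  e = solve-∀

from-slack : ∀ (P : ℕ → Set) {l u} → (∀ y → P (l + y)) → l ≤ u → P u
from-slack P h l≤u = subst P (m+[n∸m]≡n l≤u) (h _)

low-poly : ∀ q x b → q ≤ b → 1 ≤ b →
  q * (q + 3 + x) + q * (q + 3 + x) + 2 * (2 * q + 4 + x) ≤ 4 * (suc q * (q + 1 + x)) + (2 * b + 2)
low-poly zero x (suc b) _ _ = slack (2 * x + 2 * b) (eq x b)
  where
  eq : ∀ x y → 4 * (suc zero * (zero + 1 + x)) + (2 * suc y + 2) ≡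
    zero * (zero + 3 + x) + zero * (zero + 3 + x) + 2 * (2 * zero + 4 + x) + (2 * x + 2 * y)
  eq = solve-∀
low-poly (suc q) x b q≤b _ = from-slack
  (λ b → suc q * (suc q + 3 + x) + suc q * (suc q + 3 + x) + 2 * (2 * suc q + 4 + x) ≤ 4 *
      (suc (suc q) * (suc q + 1 + x)) + (2 * b + 2))
  (λ y → slack (2 * q * q + 4 * q + 2 * suc q * x + 2 * x + 2 * y) (eq q x y)) q≤b
  where
  eq : ∀ q x y → 4 * (suc (suc q) * (suc q + 1 + x)) + (2 * (suc q + y) + 2) ≡
    suc q * (suc q + 3 + x) + suc q * (suc q + 3 + x) + 2 * (2 * suc q + 4 + x) +
        (2 * q * q + 4 * q + 2 * suc q * x + 2 * x + 2 * y)
  eq = solve-∀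

middle-poly : ∀ q x b → 1 ≤ x → 6 ≤ 2 * q + 4 + x → suc q ≤ b →
  q * (q + 3 + x) + suc q * (q + 2 + x) + 2 * (2 * q + 4 + x) ≤ 4 * (suc q * (q + 1 + x)) + (2 * b + 2)
-- For q = 0 and b = 1 the claim is 10 + 3x ≤ 8 + 4x, so x ≥ 2, that is n ≥ 6, is used in full.
middle-poly zero x b _ 6≤ q<b = from-slack
  (λ x → zero * (zero + 3 + x) + suc zero * (zero + 2 + x) + 2 * (2 * zero + 4 + x) ≤ 4 *
      (suc zero * (zero + 1 + x)) + (2 * b + 2))
  (λ z → from-slack (λ b → zero * (zero + 3 + (2 + z)) + suc zero * (zero + 2 + (2 + z)) + 2 *
      (2 * zero + 4 + (2 + z)) ≤ 4 * (suc zero * (zero + 1 + (2 + z))) + (2 * b + 2))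
    (λ y → slack (z + 2 * y) (eq z y)) q<b)
  (+-cancelˡ-≤ 4 2 x 6≤)
  where
  eq : ∀ z y → 4 * (suc zero * (zero + 1 + (2 + z))) + (2 * (1 + y) + 2) ≡
    zero * (zero + 3 + (2 + z)) + suc zero * (zero + 2 + (2 + z)) + 2 * (2 * zero + 4 + (2 + z)) + (z + 2 * y)
  eq = solve-∀
middle-poly (suc q) (suc x) b 1≤x _ q<b = from-slack
  (λ b → suc q * (suc q + 3 + suc x) + suc (suc q) * (suc q + 2 + suc x) + 2 * (2 * suc q + 4 + suc x) ≤ 4 *
      (suc (suc q) * (suc q + 1 + suc x)) + (2 * b + 2))
  (λ y → slack (2 * q * q + 6 * q + 2 * q * x + 3 * x + 3 + 2 * y) (eq q x y)) q<b
  where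
  eq : ∀ q x y → 4 * (suc (suc q) * (suc q + 1 + suc x)) + (2 * (suc (suc q) + y) + 2) ≡
    suc q * (suc q + 3 + suc x) + suc (suc q) * (suc q + 2 + suc x) + 2 * (2 * suc q + 4 + suc x) +
        (2 * q * q + 6 * q + 2 * q * x + 3 * x + 3 + 2 * y)
  eq = solve-∀

high-poly : ∀ l x b → 2 + l ≤ b →
  (2 + l) * (l + 4 + x) + (2 + l) * (l + 4 + x) + 2 * (2 * (2 + l) + 3 + x) ≤ 4 * ((2 + l) * (l + 3 + x)) +
      (2 * b + 2)
high-poly l x b = from-slack
  (λ b → (2 + l) * (l + 4 + x) + (2 + l) * (l + 4 + x) + 2 * (2 * (2 + l) + 3 + x) ≤ 4 *
      ((2 + l) * (l + 3 + x)) + (2 * b + 2))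
  (λ y → slack (2 * l * l + 6 * l + 2 * x + 2 * l * x + 2 * y) (eq l x y))
  where
  eq : ∀ l x y → 4 * ((2 + l) * (l + 3 + x)) + (2 * (2 + l + y) + 2) ≡
    (2 + l) * (l + 4 + x) + (2 + l) * (l + 4 + x) + 2 * (2 * (2 + l) + 3 + x) +
        (2 * l * l + 6 * l + 2 * x + 2 * l * x + 2 * y)
  eq = solve-∀

odd-poly : ∀ l q x b → q ≤ b →
  q * (2 * (2 + l) + q + x) + 2 * (suc ((2 + l + q) + (2 + l + q)) + x) ≤
  (2 + l + q) * (2 + l + q + x) + (2 + l + q) * (2 + l) + (2 * b + 2)
odd-poly l q x b = from-slack
  (λ b → q * (2 * (2 + l) + q + x) + 2 * (suc ((2 + l + q) + (2 + l + q)) + x) ≤ (2 + l + q) * (2 + l + q + x)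
      + (2 + l + q) * (2 + l) + (2 * b + 2))
  (λ y → slack (2 * l * l + 4 * l + q * l + x * l + 2 * y) (eq l q x y))
  where
  eq : ∀ l q x y → (2 + l + q) * (2 + l + q + x) + (2 + l + q) * (2 + l) + (2 * (q + y) + 2) ≡
    q * (2 * (2 + l) + q + x) + 2 * (suc ((2 + l + q) + (2 + l + q)) + x) +
        (2 * l * l + 4 * l + q * l + x * l + 2 * y)
  eq = solve-∀

clear-D : ∀ {x y z w D B N} → x ≡ z → y ≡ w → D + B ≡ 2 * N → z + 2 * N ≤ w + B → x + D ≤ y
clear-D {x} {y} {D = D} {B} {N} refl refl D≡ le = +-cancelʳ-≤ B (x + D) y
  (≤-trans (≤-reflexive (trans (+-assoc x D B) (cong (x +_) D≡))) le)

fourfold : ∀ {x y} → x ≡ y → (x + x) + (x + x) ≡ 4 * y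
fourfold {x} refl = eq x
  where
  eq : ∀ x → (x + x) + (x + x) ≡ 4 * x
  eq = solve-∀

-- f q + f k + D ≤ 4 fᵉ K in the three ranges of k.
even-low : ∀ {n q b D} → 2 * q + 4 ≤ n → q ≤ b → 1 ≤ b → D + (2 * b + 2) ≡ 2 * n →
  f n q + f n q + D ≤ (fᵉ n (suc q) + fᵉ n (suc q)) + (fᵉ n (suc q) + fᵉ n (suc q))
even-low {n} {q} {b} {D} le q≤b 1≤b D≡ =
  let x , e = ∃-slack le
      fq = f-at (q + 3 + x) (trans e (e₁ q x))
  in clear-D {N = n} (cong₂ _+_ fq fq) (fourfold (fᵉ-at (q + 1 + x) (trans e (e₂ q x)))) D≡
       (subst (λ N → q * (q + 3 + x) + q * (q + 3 + x) + 2 * N ≤ 4 * (suc q * (q + 1 + x)) + (2 * b + 2))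
           (sym e) (low-poly q x b q≤b 1≤b))
  where
  e₁ : ∀ q x → 2 * q + 4 + x ≡ suc (q + (q + 3 + x))
  e₁ = solve-∀
  e₂ : ∀ q x → 2 * q + 4 + x ≡ suc (suc (suc q + (q + 1 + x)))
  e₂ = solve-∀

even-middle : ∀ {n q b D} → 2 * q + 4 ≤ n → suc q ≤ b → 2 * b + 3 ≤ n → 6 ≤ n → D + (2 * b + 2) ≡ 2 * n →
  f n q + f n (suc q) + D ≤ (fᵉ n (suc q) + fᵉ n (suc q)) + (fᵉ n (suc q) + fᵉ n (suc q))
even-middle {n} {q} {b} {D} le q<b b≤ 6≤n D≡ =
  let x , e = ∃-slack le
      1≤x = +-cancelˡ-≤ (2 * q + 4) 1 x (≤-trans (≤-reflexive (e₃ q))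
          (≤-trans (+-monoˡ-≤ 3 (*-monoʳ-≤ 2 q<b)) (≤-trans b≤ (≤-reflexive e))))
  in clear-D {N = n} (cong₂ _+_ (f-at (q + 3 + x) (trans e (e₁ q x))) (f-at (q + 2 + x) (trans e (e₄ q x))))
       (fourfold (fᵉ-at (q + 1 + x) (trans e (e₂ q x)))) D≡
       (subst (λ N → q * (q + 3 + x) + suc q * (q + 2 + x) + 2 * N ≤ 4 * (suc q * (q + 1 + x)) + (2 * b + 2))
           (sym e)
         (middle-poly q x b 1≤x (≤-trans 6≤n (≤-reflexive e)) q<b))
  where
  e₁ : ∀ q x → 2 * q + 4 + x ≡ suc (q + (q + 3 + x))
  e₁ = solve-∀
  e₂ : ∀ q x → 2 * q + 4 + x ≡ suc (suc (suc q + (q + 1 + x)))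
  e₂ = solve-∀
  e₃ : ∀ q → 2 * q + 4 + 1 ≡ 2 * suc q + 3
  e₃ = solve-∀
  e₄ : ∀ q x → 2 * q + 4 + x ≡ suc (suc q + (q + 2 + x))
  e₄ = solve-∀

even-high : ∀ {n k b D} → 2 ≤ k → k ≤ b → 2 * b + 3 ≤ n → D + (2 * b + 2) ≡ 2 * n →
  f n k + f n k + D ≤ (fᵉ n k + fᵉ n k) + (fᵉ n k + fᵉ n k)
even-high {n} {suc (suc l)} {b} {D} (s≤s (s≤s _)) k≤b b≤ D≡ =
  let x , e = ∃-slack (≤-trans (+-monoˡ-≤ 3 (*-monoʳ-≤ 2 k≤b)) b≤)
      fk = f-at (l + 4 + x) (trans e (e₁ l x))
  in clear-D {N = n} (cong₂ _+_ fk fk) (fourfold (fᵉ-at (l + 3 + x) (trans e (e₂ l x)))) D≡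
       (subst (λ N → (2 + l) * (l + 4 + x) + (2 + l) * (l + 4 + x) + 2 * N ≤ 4 * ((2 + l) * (l + 3 + x)) +
           (2 * b + 2)) (sym e) (high-poly l x b k≤b))
  where
  e₁ : ∀ l x → 2 * (2 + l) + 3 + x ≡ suc ((2 + l) + (l + 4 + x))
  e₁ = solve-∀
  e₂ : ∀ l x → 2 * (2 + l) + 3 + x ≡ suc (suc ((2 + l) + (l + 3 + x)))
  e₂ = solve-∀

-- On an odd cycle of length at least five one pair of edges pays the whole surplus `D`. On a
-- triangle, h = 1, it does not, and `triangle-on` takes the three sides together.
odd-excess : ∀ {n q h b D} → 2 ≤ h → suc ((h + q) + (h + q)) ≤ n → q ≤ b → D + (2 * b + 2) ≡ 2 * n →
  f n q + D ≤ f n (h + q) + (h + q) * h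
odd-excess {n} {q} {suc (suc l)} {b} {D} (s≤s (s≤s _)) le q≤b D≡ =
  let x , e = ∃-slack le
  in clear-D {N = n} (f-at (2 * (2 + l) + q + x) (trans e (e₁ l q x)))
       (cong (_+ (2 + l + q) * (2 + l)) (f-at (2 + l + q + x) (trans e (e₂ l q x)))) D≡
       (subst (λ N → q * (2 * (2 + l) + q + x) + 2 * N ≤ (2 + l + q) * (2 + l + q + x) + (2 + l + q) * (2 + l)
           + (2 * b + 2)) (sym e) (odd-poly l q x b q≤b))
  where
  e₁ : ∀ l q x → suc ((2 + l + q) + (2 + l + q)) + x ≡ suc (q + (2 * (2 + l) + q + x))
  e₁ = solve-∀
  e₂ : ∀ l q x → suc ((2 + l + q) + (2 + l + q)) + x ≡ suc (2 + l + q + (2 + l + q + x))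
  e₂ = solve-∀

-- For a path covering half of the cycle: no pair is left over, and two pairs must pay `D` besides
-- the terms at q and k. Monotonicity reduces k ≤ q to both terms at q with `fᵉ` at q + 1, and k > q
-- + 1 to everything at k; k = q + 1 is the tight case.
even-both : ∀ {n q k K b D} → q < K → k ≤ K → suc (suc (K + K)) ≤ n → q ≤ b → k ≤ b → 1 ≤ b → 2 * b + 3 ≤ n →
    6 ≤ n →
  D + (2 * b + 2) ≡ 2 * n → f n q + f n k + D ≤ (fᵉ n K + fᵉ n K) + (fᵉ n K + fᵉ n K)
even-both {n} {q} {k} {K} {b} {D} q<K k≤K le q≤b k≤b 1≤b b≤ 6≤n D≡ = go (<-cmp k (suc q))
  where
  four : ∀ {i} → i ≤ K → (fᵉ n i + fᵉ n i) + (fᵉ n i + fᵉ n i) ≤ (fᵉ n K + fᵉ n K) + (fᵉ n K + fᵉ n K)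
  four i≤K = let t = fᵉ-mono n i≤K le in +-mono-≤ (+-mono-≤ t t) (+-mono-≤ t t)
  below : ∀ {i} → i ≤ K → suc (i + i) ≤ n
  below i≤K = ≤-trans (s≤s (+-mono-≤ i≤K i≤K)) (≤-trans (n≤1+n _) le)
  shape : ∀ q → suc (suc (suc q + suc q)) ≡ 2 * q + 4
  shape = solve-∀
  qn : 2 * q + 4 ≤ n
  qn = ≤-trans (≤-reflexive (sym (shape q))) (≤-trans (s≤s (s≤s (+-mono-≤ q<K q<K))) le)
  go : Tri (k < suc q) (k ≡ suc q) (suc q < k) → f n q + f n k + D ≤ (fᵉ n K + fᵉ n K) + (fᵉ n K + fᵉ n K)
  go (tri< k<sq _ _) = ≤-trans (+-monoˡ-≤ D (+-monoʳ-≤ (f n q) (f-mono n (s≤s⁻¹ k<sq) (below (<⇒≤ q<K)))))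
    (≤-trans (even-low qn q≤b 1≤b D≡) (four q<K))
  go (tri≈ _ refl _) = ≤-trans (even-middle qn k≤b b≤ 6≤n D≡) (four q<K)
  go (tri> _ _ k>sq) = ≤-trans (+-monoˡ-≤ D (+-monoˡ-≤ (f n k)
      (f-mono n (≤-trans (n≤1+n _) (<⇒≤ k>sq)) (below k≤K))))
    (≤-trans (even-high (≤-trans (s≤s (s≤s z≤n)) k>sq) k≤b b≤ D≡) (four k≤K))

f-strict : ∀ {n i m} → i < m → suc (m + m) ≤ n → f n i < f n m
f-strict {n} {i} {m} i<m le =
  let y , d = ∃-slack i<m
      x , e = ∃-slack le
      e′ = trans e (cong (λ z → suc (z + z) + x) d)
  in subst₂ _<_ (sym (f-at (i + 2 * y + 2 + x) (trans e′ (e₁ i y x))))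
       (sym (trans (f-at (m + x) (trans e (cong suc (+-assoc m m x)))) (cong (λ z → z * (z + x)) d)))
       (slack (2 * y + y * y + x + y * x) (e₂ i y x))
  where
  e₁ : ∀ i y x → suc ((suc i + y) + (suc i + y)) + x ≡ suc (i + (i + 2 * y + 2 + x))
  e₁ = solve-∀
  e₂ : ∀ i y x → (suc i + y) * (suc i + y + x) ≡ suc (i * (i + 2 * y + 2 + x)) + (2 * y + y * y + x + y * x)
  e₂ = solve-∀

triangle-off : ∀ {n D y₀ y₁ z} → n ≡ 3 + (y₀ + y₁ + z) → D + 4 ≤ 2 * n →
  D ≤ suc y₀ * suc y₁ + (suc y₁ * suc z + suc z * suc y₀)
triangle-off {n} {D} {y₀} {y₁} {z} n≡ D≤ = +-cancelʳ-≤ 4 _ _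
    (≤-trans D≤ (≤-trans (≤-reflexive (cong (2 *_) n≡)) (slack (1 + (y₀ * y₁ + (y₁ * z + z * y₀)))
    (eq y₀ y₁ z))))
  where
  eq : ∀ y₀ y₁ z → suc y₀ * suc y₁ + (suc y₁ * suc z + suc z * suc y₀) + 4 ≡ 2 * (3 + (y₀ + y₁ + z)) +
      (1 + (y₀ * y₁ + (y₁ * z + z * y₀)))
  eq = solve-∀

-- The contribution of the edges of a triangle with suc y₀, suc y₁ and suc z vertices over its corners.
Σ₃ : ℕ → ℕ → ℕ → ℕ
Σ₃ y₀ y₁ z = suc y₀ * suc y₁ + (suc y₁ * suc z + suc z * suc y₀)

-- Write κ for y₁. At κ = b the identity `critical` says f κ + D + z y₀ = Σ₃ + 1. The missing 1 is
-- made up as soon as z > 0 or q < κ, and only z = 0, q = b leaves it. For κ on either side of b the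
-- three sides suffice.
triangle-on : ∀ {n D q b y₀ y₁ z} → n ≡ 3 + (y₀ + y₁ + z) → D + (2 * b + 2) ≡ 2 * n → q ≤ y₁ → y₁ ≤ y₀ → q ≤ b
    → 1 ≤ b →
  f n q + D ≤ Σ₃ y₀ y₁ z ⊎ (z ≡ 0 × y₁ ≡ b × q ≡ b × f n q + D ≡ suc (Σ₃ y₀ y₁ z))
triangle-on {n} {D} {q} {b} {y₀} {κ} {z} n≡ D≡ q≤κ κ≤y₀ q≤b 1≤b = go (<-cmp κ b)
  where
  w : ℕ
  w = y₀ ∸ κ
  y₀≡ : y₀ ≡ κ + w
  y₀≡ = sym (m+[n∸m]≡n κ≤y₀)
  n≡′ : n ≡ 3 + (κ + w + κ + z)
  n≡′ = trans n≡ (cong (λ y → 3 + (y + κ + z)) y₀≡)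
  fκ : f n κ ≡ κ * (2 + κ + w + z)
  fκ = f-at (2 + κ + w + z) (trans n≡′ (e κ w z))
    where
    e : ∀ κ w z → 3 + (κ + w + κ + z) ≡ suc (κ + (2 + κ + w + z))
    e = solve-∀
  small : suc (κ + κ) ≤ n
  small = ≤-trans (slack (2 + w + z) (e κ w z)) (≤-reflexive (sym n≡′))
    where
    e : ∀ κ w z → 3 + (κ + w + κ + z) ≡ suc (κ + κ) + (2 + w + z)
    e = solve-∀
  reduce : ∀ {m x} → f n q ≤ f n m → f n m ≡ x → x + 2 * (3 + (κ + w + κ + z)) ≤ Σ₃ (κ + w) κ z + (2 * b + 2)
      → f n q + D ≤ Σ₃ y₀ κ z
  reduce {x = x} q≤ fm le = ≤-trans (+-monoˡ-≤ D q≤) (clear-D {N = n} fm (cong (λ y → Σ₃ y κ z) y₀≡) D≡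
    (subst (λ N → x + 2 * N ≤ Σ₃ (κ + w) κ z + (2 * b + 2)) (sym n≡′) le))
  critical : κ * (2 + κ + w + z) + 2 * (3 + (κ + w + κ + z)) + z * (κ + w) ≡ suc (Σ₃ (κ + w) κ z) +
      (2 * κ + 2)
  critical = e κ w z
    where
    e : ∀ κ w z → κ * (2 + κ + w + z) + 2 * (3 + (κ + w + κ + z)) + z * (κ + w) ≡
      suc (suc (κ + w) * suc κ + (suc κ * suc z + suc z * suc (κ + w))) + (2 * κ + 2)
    e = solve-∀
  go : Tri (κ < b) (κ ≡ b) (b < κ) → f n q + D ≤ Σ₃ y₀ κ z ⊎
      (z ≡ 0 × κ ≡ b × q ≡ b × f n q + D ≡ suc (Σ₃ y₀ κ z))
  go (tri< κ<b _ _) = inj₁ (reduce {κ} (f-mono n q≤κ small) fκ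
    (from-slack (λ b → κ * (2 + κ + w + z) + 2 * (3 + (κ + w + κ + z)) ≤ Σ₃ (κ + w) κ z + (2 * b + 2))
      (λ y → slack (1 + 2 * y + z * (κ + w)) (eq κ w z y)) κ<b))
    where
    eq : ∀ κ w z y → (suc (κ + w) * suc κ + (suc κ * suc z + suc z * suc (κ + w))) + (2 * (suc κ + y) + 2) ≡
      κ * (2 + κ + w + z) + 2 * (3 + (κ + w + κ + z)) + (1 + 2 * y + z * (κ + w))
    eq = solve-∀
  go (tri> _ _ b<κ) = inj₁ (reduce {b} (f-mono n q≤b (≤-trans (s≤s (+-mono-≤ (<⇒≤ b<κ) (<⇒≤ b<κ))) small))
    (f-at (b + 4 + 2 * y + w + z) (trans n≡′ (trans (cong (λ κ → 3 + (κ + w + κ + z)) κ≡) (e₁ b y w z))))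
    (subst (λ κ → b * (b + 4 + 2 * y + w + z) + 2 * (3 + (κ + w + κ + z)) ≤ Σ₃ (κ + w) κ z + (2 * b + 2))
        (sym κ≡)
      (slack (2 * y + y * y + w * (1 + y) + z * (b + 2 + 2 * y + w)) (eq b y w z))))
    where
    y : ℕ
    y = proj₁ (∃-slack b<κ)
    κ≡ : κ ≡ suc b + y
    κ≡ = proj₂ (∃-slack b<κ)
    e₁ : ∀ b y w z → 3 + (suc b + y + w + (suc b + y) + z) ≡ suc (b + (b + 4 + 2 * y + w + z))
    e₁ = solve-∀
    eq : ∀ b y w z → (suc (suc b + y + w) * suc (suc b + y) +
        (suc (suc b + y) * suc z + suc z * suc (suc b + y + w))) + (2 * b + 2) ≡
      b * (b + 4 + 2 * y + w + z) + 2 * (3 + (suc b + y + w + (suc b + y) + z)) +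
          (2 * y + y * y + w * (1 + y) + z * (b + 2 + 2 * y + w))
    eq = solve-∀
  go (tri≈ _ refl _) = at-b (m≤n⇒m<n∨m≡n q≤κ) z refl
    where
    balance : f n κ + D + z * (κ + w) ≡ suc (Σ₃ y₀ κ z)
    balance = +-cancelʳ-≡ (2 * κ + 2) _ _ (trans (move (f n κ) D (z * (κ + w)) (2 * κ + 2))
      (trans (cong₂ (λ x N → x + N + z * (κ + w)) fκ (trans D≡ (cong (2 *_) n≡′)))
        (trans critical (cong (λ y → suc (Σ₃ y κ z) + (2 * κ + 2)) (sym y₀≡)))))
      where
      move : ∀ a b c d → a + b + c + d ≡ a + (b + d) + c
      move = solve-∀
    at-b : q < κ ⊎ q ≡ κ → ∀ z′ → z ≡ z′ → f n q + D ≤ Σ₃ y₀ κ z ⊎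
        (z ≡ 0 × κ ≡ κ × q ≡ κ × f n q + D ≡ suc (Σ₃ y₀ κ z))
    at-b (inj₁ q<κ) _ _ = inj₁ (s≤s⁻¹ (≤-trans (+-monoˡ-≤ D (f-strict {n} q<κ small))
        (≤-trans (m≤m+n _ _) (≤-reflexive balance))))
    at-b (inj₂ q≡κ) zero z≡0 = inj₂ (z≡0 , refl , q≡κ , trans (cong (λ x → f n x + D) q≡κ)
      (trans (sym (+-identityʳ _)) (trans (cong (λ x → f n κ + D + x * (κ + w)) (sym z≡0)) balance)))
    at-b (inj₂ q≡κ) (suc z′) z≡ = inj₁ (s≤s⁻¹ (≤-trans (≤-reflexive (cong (λ x → suc (f n x + D)) q≡κ))
      (≤-trans (≤-trans (≤-reflexive (+-comm 1 (f n κ + D)))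
          (+-monoʳ-≤ (f n κ + D) (*-mono-≤ {1} {z} {1} (≤-trans (s≤s z≤n) (≤-reflexive (sym z≡)))
          (≤-trans 1≤b (m≤m+n κ w))))) (≤-reflexive balance))))

-- The lower bound

half : ∀ k → (∃[ m ] k ≡ m + m) ⊎ (∃[ m ] k ≡ suc (m + m))
half zero = inj₁ (0 , refl)
half (suc k) with half k
... | inj₁ (m , e) = inj₂ (m , cong suc e)
... | inj₂ (m , e) = inj₁ (suc m , trans (cong suc e) (cong suc (sym (+-suc m m))))

sum-map-++ : ∀ {A : Set} (h : A → ℕ) xs ys → sum (map h (xs ++ ys)) ≡ sum (map h xs) + sum (map h ys)
sum-map-++ h xs ys = trans (cong sum (map-++ h xs ys)) (sum-++ (map h xs) (map h ys))

Σ<-prefix : ∀ {m l} (g : ℕ → ℕ) → m ≤ l → Σ< m g ≤ Σ< l g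
Σ<-prefix {m} {l} g m≤l = ≤-trans (m≤m+n (Σ< m g) _)
  (≤-reflexive (trans (sym (Σ<-split m (l ∸ m) g)) (cong (λ x → Σ< x g) (m+[n∸m]≡n m≤l))))

-- e + 1 is the diameter and D = 2n − 2 − 2b.
module Target (n e b D : ℕ) where

  -- The least contribution of a bridge with i edges of the diametral path before it and e - i after
  -- it.
  term : ℕ → ℕ
  term i = f n (i ⊓ (e ∸ i))

  record Sizes : Set where
    field
      e≤     : e ≤ suc (b + b)
      1≤b    : 1 ≤ b
      e+2≤n  : 2 + e ≤ n
      6≤n    : 6 ≤ n
      2b+3≤n : 2 * b + 3 ≤ n
      D≡     : D + (2 * b + 2) ≡ 2 * n

    half≤b : ∀ {x} → x + x ≤ e → x ≤ b
    half≤b {x} le with x ℕₚ.≤? b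
    ... | yes p = p
    ... | no ¬p = contradiction (≤-trans (+-mono-≤ (≰⇒> ¬p) (≰⇒> ¬p)) (≤-trans le e≤))
        (<⇒≱ (≤-reflexive (cong suc (sym (+-suc b b)))))

    ⊓≤b : ∀ {x y} → x + y ≤ e → x ⊓ y ≤ b
    ⊓≤b {x} {y} le = half≤b (≤-trans (+-mono-≤ (m⊓n≤m x y) (m⊓n≤n x y)) le)

    position≤b : ∀ i → i ≤ e → i ⊓ (e ∸ i) ≤ b
    position≤b i i≤e = ⊓≤b (≤-reflexive (m+[n∸m]≡n i≤e))

module CycleSum {G : Graph n} (conn : Connected G) (F : CycleForest G) where

  open CycleForest F
  open Forest conn F
  open Counting conn F

  onCycle : ℕ
  onCycle = Σ< (suc k) (λ i → p (c i))

  sum-arc : sum (map p (arc 0 (suc k))) ≡ onCycle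
  sum-arc = sum-applyUpTo p c (suc k)

  c-back : ∀ j → c (k + suc j) ≡ c j
  c-back j = trans (cong c (trans (+-suc k j) (+-comm (suc k) j))) (c-period j)

  -- The pairs exhaust c 0, ..., c (2h - 1). On an odd cycle 2h = k, and the one unpaired edge is
  -- dropped.
  pairs≤ : ∀ {h} → h + h ≤ suc k → Σ< h (λ j → p (c j) + p (c (h + j))) ≤ onCycle
  pairs≤ {h} 2h≤ = ≤-trans (≤-reflexive (trans (Σ<-+ h (λ j → p (c j)) (λ j → p (c (h + j))))
      (sym (Σ<-split h h (λ i → p (c i))))))
    (Σ<-prefix (λ i → p (c i)) 2h≤)

  -- The two sides of the edge {c j , c (suc j)}.
  module Sides (m j : ℕ) (j≤m : j ≤ m) (m<k : m < k) where

    j<k : j < k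
    j<k = ≤-trans (s≤s j≤m) m<k

    Fⱼ : CycleForest G
    Fⱼ = rotate F (suc j) j<k

    open CycleEdges conn Fⱼ using (before; after) public
    module Cⱼ = Counting conn Fⱼ
    module Oⱼ = Opposite conn Fⱼ m
    open CycleForest Fⱼ using () renaming (ρ to ρⱼ) public

    c-partner : c (m + suc j) ≡ c (suc m + j)
    c-partner = cong c (+-suc m j)

    before-≥ : ∀ u → ρⱼ u < suc m → suc m + δ u ≤ before (suc m)
    before-≥ u ρ< = Cⱼ.count-ρ (ℕₚ._<? suc m) 0 (suc m) (≤-trans m<k (n≤1+n k)) (λ _ x → x) u ρ<

    after-≥ : ∀ l i → suc l + i ≤ suc k → ∀ u → l < ρⱼ u → i + δ u ≤ after l
    after-≥ l i fits u ρ> = Cⱼ.count-ρ (l ℕₚ.<?_) (suc l) i fits (λ x _ → x) u ρ>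

  module OddCycle (m : ℕ) (k≡ : k ≡ suc m + suc m) where

    m<k : m < k
    m<k = ≤-trans (m≤m+n (suc m) (suc m)) (≤-reflexive (sym k≡))

    module _ (j : ℕ) (j≤m : j ≤ m) where
      open Sides m j j≤m m<k

      odd-pair-≥ : ∀ {K} → K ≤ before (suc m) → K ≤ after (suc m) →
        f n K + K * suc m ≤ p (c j) + p (c (suc m + j))
      odd-pair-≥ {K} K≤ K≤′ = ≤-trans (≤-reflexive (cong (_+ K * suc m) (f-def n K)))
        (≤-trans (Oⱼ.odd-pair k≡ K≤ K≤′) (≤-reflexive (cong₂ (λ x y → p x + p y) (c-back j) c-partner)))

      odd-room : ∀ {K} → K ≤ before (suc m) → K ≤ after (suc m) → suc (K + K) ≤ n
      odd-room {K} K≤ K≤′ = begin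
        suc (K + K) ≡⟨ +-suc K K ⟨
        K + suc K ≤⟨ +-mono-≤ K≤ (+-mono-≤ nonempty K≤′) ⟩
        before (suc m) + (level (suc m) + after (suc m)) ≡⟨ partition (suc m) ⟩
        n ∎
        where
        open ≤-Reasoning
        open CycleEdges conn Fⱼ using (level; partition)
        nonempty : 1 ≤ level (suc m)
        nonempty = count-Unique (λ z → ρⱼ z ℕₚ.≟ suc m) {CycleForest.c Fⱼ (suc m) ∷ []} ([] ∷ [])
          (CycleForest.ρ-c Fⱼ m<k ∷ [])

      trivial-before : suc m ≤ before (suc m)
      trivial-before = ≤-trans (m≤m+n (suc m) _) (before-≥ (CycleForest.c Fⱼ 0)
          (s≤s (≤-trans (≤-reflexive (CycleForest.ρ-c Fⱼ z≤n)) z≤n)))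

      trivial-after : suc m ≤ after (suc m)
      trivial-after = ≤-trans (m≤m+n (suc m) _) (after-≥ (suc m) (suc m) (s≤s (≤-reflexive (sym k≡)))
          (CycleForest.c Fⱼ k)
        (≤-trans (s≤s (m≤m+n (suc m) m)) (≤-trans (≤-reflexive (sym (trans k≡ (+-suc (suc m) m))))
            (≤-reflexive (sym (CycleForest.ρ-c Fⱼ ≤-refl))))))

    pairs-odd : Σ< (suc m) (λ j → p (c j) + p (c (suc m + j))) ≤ onCycle
    pairs-odd = pairs≤ (≤-trans (≤-reflexive (sym k≡)) (n≤1+n k))

  module EvenCycle (m : ℕ) (k≡ : k ≡ suc (m + m)) where

    1≤m : 1 ≤ m
    1≤m = go m k≡
      where
      go : ∀ m → k ≡ suc (m + m) → 1 ≤ m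
      go zero e = contradiction (subst (2 ≤_) e 2≤k) (<⇒≱ ≤-refl)
      go (suc m) e = s≤s z≤n

    m<k : m < k
    m<k = ≤-trans (s≤s (m≤m+n m m)) (≤-reflexive (sym k≡))

    module _ (j : ℕ) (j≤m : j ≤ m) where
      open Sides m j j≤m m<k

      even-pair-≥ : ∀ {K} → suc K ≤ before (suc m) → suc K ≤ after m → fᵉ n K + fᵉ n K ≤ p (c j) + p
          (c (suc m + j))
      even-pair-≥ {K} K< K<′ = let q₁ , q₂ = Oⱼ.even-pair k≡ K< K<′ in
        ≤-trans (≤-reflexive (cong₂ _+_ (fᵉ-def n K) (fᵉ-def n K)))
          (≤-trans (+-mono-≤ q₁ q₂) (≤-reflexive (cong₂ (λ x y → p x + p y) (c-back j) c-partner)))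

      even-room : ∀ {K} → suc K ≤ before (suc m) → suc K ≤ after m → suc (suc (K + K)) ≤ n
      even-room {K} K< K<′ = ≤-trans (≤-reflexive (cong suc (sym (+-suc K K))))
        (≤-trans (+-mono-≤ K< K<′) (≤-reflexive (CycleEdges.Even.partition′ conn Fⱼ m k≡)))

      trivial-before : suc m ≤ before (suc m)
      trivial-before = ≤-trans (m≤m+n (suc m) _) (before-≥ (CycleForest.c Fⱼ 0)
          (s≤s (≤-trans (≤-reflexive (CycleForest.ρ-c Fⱼ z≤n)) z≤n)))

      trivial-after : suc m ≤ after m
      trivial-after = ≤-trans (m≤m+n (suc m) _) (after-≥ m (suc m)
          (≤-reflexive (trans (cong suc (+-suc m m)) (cong suc (sym k≡)))) (CycleForest.c Fⱼ k)
        (≤-trans m<k (≤-reflexive (sym (CycleForest.ρ-c Fⱼ ≤-refl)))))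

    pairs-even : Σ< (suc m) (λ j → p (c j) + p (c (suc m + j))) ≤ onCycle
    pairs-even = pairs≤ (≤-trans (≤-reflexive (trans (cong suc (+-suc m m)) (cong suc (sym k≡)))) ≤-refl)

  module Triangle (k≡2 : k ≡ 2) where

    open CycleEdges conn F using (level)

    x₀ x₁ x₂ : ℕ
    x₀ = level 0
    x₁ = level 1
    x₂ = level 2

    private
      1<k : 1 < k
      1<k = 2≤k
      0<k : 0 < k
      0<k = ≤-trans (s≤s z≤n) 2≤k
      module S₁ = CycleEdges conn (rotate F 1 0<k)
      module S₂ = CycleEdges conn (rotate F 2 1<k)
      module S₀ = CycleEdges conn F

      ρ≤2 : ∀ z → ρ z ≤ 2
      ρ≤2 z = ≤-trans (ρ≤k z) (≤-reflexive k≡2)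

    edge₂ : x₀ * x₂ ≤ p (c 2)
    edge₂ = ≤-trans (*-mono-≤
      (∑-mono λ z → ⟦⟧-mono (ρ z ℕₚ.≟ 0) (ρ z ℕₚ.<? 1) (λ e → s≤s (≤-reflexive e)))
      (∑-mono λ z → ⟦⟧-mono (ρ z ℕₚ.≟ 2) (1 ℕₚ.<? ρ z) (λ e → ≤-reflexive (sym e))))
      (≤-trans (S₀.Odd.edge-bound 1 k≡2) (≤-reflexive (cong (p ∘ c) k≡2)))

    edge₀ : x₁ * x₀ ≤ p (c 0)
    edge₀ = ≤-trans (*-mono-≤
      (∑-mono λ z → ⟦⟧-mono (ρ z ℕₚ.≟ 1) (renumber k 1 (ρ z) ℕₚ.<? 1)
          (λ e → s≤s (≤-reflexive (trans (cong (renumber k 1) e) (renumber-≥ k {1} {1} ≤-refl)))))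
      (∑-mono λ z → ⟦⟧-mono (ρ z ℕₚ.≟ 0) (1 ℕₚ.<? renumber k 1 (ρ z))
          (λ e → ≤-reflexive (sym (trans (cong (renumber k 1) e)
          (trans (renumber-< k {1} {0} (s≤s z≤n)) k≡2))))))
      (≤-trans (S₁.Odd.edge-bound 1 k≡2) (≤-reflexive (cong p (c-back 0))))

    edge₁ : x₂ * x₁ ≤ p (c 1)
    edge₁ = ≤-trans (*-mono-≤
      (∑-mono λ z → ⟦⟧-mono (ρ z ℕₚ.≟ 2) (renumber k 2 (ρ z) ℕₚ.<? 1)
          (λ e → s≤s (≤-reflexive (trans (cong (renumber k 2) e) (renumber-≥ k {2} {2} ≤-refl)))))
      (∑-mono λ z → ⟦⟧-mono (ρ z ℕₚ.≟ 1) (1 ℕₚ.<? renumber k 2 (ρ z))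
          (λ e → ≤-reflexive (sym (trans (cong (renumber k 2) e)
          (trans (renumber-< k {2} {1} ≤-refl) k≡2))))))
      (≤-trans (S₂.Odd.edge-bound 1 k≡2) (≤-reflexive (cong p (c-back 1))))

    -- What hangs over the third corner is equidistant from the ends of a side, so a side is
    -- credited with the product of the numbers of vertices over its own two corners.
    triangle≤ : x₀ * x₁ + (x₁ * x₂ + x₂ * x₀) ≤ onCycle
    triangle≤ = ≤-trans (+-mono-≤ (≤-trans (≤-reflexive (*-comm x₀ x₁)) edge₀)
        (+-mono-≤ (≤-trans (≤-reflexive (*-comm x₁ x₂)) edge₁)
            (≤-trans (≤-reflexive (*-comm x₂ x₀)) (≤-trans edge₂ (≤-reflexive (sym (+-identityʳ _)))))))
      (≤-reflexive (cong (λ l → Σ< (suc l) (λ i → p (c i))) (sym k≡2)))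

    sizes : x₀ + (x₁ + x₂) ≡ n
    sizes = trans (cong (x₀ +_) (sym (∑-+ _ _))) (trans (sym (∑-+ _ _))
        (trans (∑-cong (λ z → one (ρ z) (ρ≤2 z))) (∑-one n)))
      where
      one : ∀ x → x ≤ 2 → ⟦ x ℕₚ.≟ 0 ⟧ + (⟦ x ℕₚ.≟ 1 ⟧ + ⟦ x ℕₚ.≟ 2 ⟧) ≡ 1
      one 0 _ = refl
      one 1 _ = refl
      one 2 _ = refl
      one (suc (suc (suc _))) (s≤s (s≤s ()))

    level-≥ : ∀ u → suc (δ u) ≤ level (ρ u)
    level-≥ u = count-ρ (ℕₚ._≟ ρ u) (ρ u) 1 (≤-trans (≤-reflexive (+-comm (ρ u) 1)) (s≤s (ρ≤k u)))
      (λ l x → ≤-antisym (s≤s⁻¹ (≤-trans x (≤-reflexive (+-comm (ρ u) 1)))) l) u refl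

-- The additional term of `G` will be a pair that the path does not use. It pays what it can of `D`,
-- and term `j` pays the truncated remainder `D ∸ G t`.
Σ<-excess-last : ∀ t {F G : ℕ → ℕ} {D} j → j < t → (∀ {i} → i < t → F i ≤ G i) → F j + D ≤ G j + G t →
  Σ< t F + D ≤ Σ< (suc t) G
Σ<-excess-last t {F} {G} {D} j j<t le ex = begin
  Σ< t F + D                    ≤⟨ +-monoʳ-≤ (Σ< t F) (m≤n+m∸n D (G t)) ⟩
  Σ< t F + (G t + (D ∸ G t))    ≡⟨ trans (cong (Σ< t F +_) (+-comm (G t) _)) (sym (+-assoc (Σ< t F) _ (G t)))
      ⟩
  Σ< t F + (D ∸ G t) + G t      ≤⟨ +-monoˡ-≤ (G t) (Σ<-excess t j j<t le rest) ⟩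
  Σ< t G + G t                  ≡⟨ Σ<-last t G ⟨
  Σ< (suc t) G                  ∎
  where
  open ≤-Reasoning
  rest : F j + (D ∸ G t) ≤ G j
  rest with ≤-total D (G t)
  ... | inj₁ D≤ = ≤-trans (≤-reflexive (trans (cong (F j +_) (m≤n⇒m∸n≡0 D≤)) (+-identityʳ (F j)))) (le j<t)
  ... | inj₂ D≥ = +-cancelʳ-≤ (G t) _ _ (≤-trans (≤-reflexive
      (trans (+-assoc (F j) _ (G t)) (cong (F j +_) (m∸n+n≡m D≥)))) ex)

module Lower {G : Graph n} (conn : Connected G) (F : CycleForest G) (e b D : ℕ) (sizes : Target.Sizes n e b D)
    where

  open CycleForest F
  open Forest conn F hiding (D)
  open Counting conn F
  open CycleSum conn F
  open Target n e b D
  open Target.Sizes sizes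

  Φ : ℕ
  Φ = Σ< (suc e) term

  term-reverse : ∀ {i} → i ≤ e → term (e ∸ i) ≡ term i
  term-reverse {i} i≤e = cong (f n) (trans (cong ((e ∸ i) ⊓_) (m∸[m∸n]≡n i≤e)) (⊓-comm (e ∸ i) i))

  δ≤dist : ∀ z x → δ x ≡ 0 → δ z ≤ distance G z x
  δ≤dist z x e = ≤-potential δ e up down z
    where
    up : ∀ v → δ v ≤ suc (δ (σ v))
    up v with δ v in eq
    ... | zero = z≤n
    ... | suc j = s≤s (≤-reflexive (sym (δ-σ v eq)))
    down : ∀ v → δ (σ v) ≤ suc (δ v)
    down v with δ v in eq
    ... | zero = ≤-trans (≤-reflexive (δ-σ₀ v eq)) z≤n
    ... | suc j = ≤-trans (≤-reflexive (δ-σ v eq)) (≤-trans (n≤1+n j) (n≤1+n _))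

  dist-cycle : ∀ u → distance G u (c (ρ u)) ≡ δ u
  dist-cycle u = ≤-antisym (dist-root u) (δ≤dist u (c (ρ u)) (δ-c (ρ u)))

  -- Only cycle edges change `ρ`, so the last vertex over `c x` before the walk leaves is `c x`
  -- itself.
  through-root : ∀ m {z v x} → Walk G m z v → ρ z ≡ x → ρ v ≢ x → distance G z (c x) + distance G (c x) v ≤ m
  through-root zero refl p q = contradiction p q
  through-root (suc m) {z} {v} {x} (w , a , W) p q with ρ w ℕₚ.≟ x
  ... | yes r = ≤-trans (+-monoˡ-≤ _ (dist-adj G conn (c x) a)) (s≤s (through-root m W r q))
  ... | no r = ≤-trans (≤-reflexive (cong (_+ distance G (c x) v)
      (trans (cong (distance G z) cx) (dist-self G z))))
                 (≤-trans (≤-reflexive (cong (λ y → distance G y v) cx)) (dist-minimal G (w , a , W)))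
    where
    z-on : δ z ≡ 0
    z-on with adj-σ a
    ... | inj₁ refl with δ z in eq
    ...   | zero = refl
    ...   | suc j = contradiction (trans (ρ-σ z eq) p) r
    z-on | inj₂ refl with δ w in eq
    ...   | zero = δ-σ₀ w eq
    ...   | suc j = contradiction (trans (sym (ρ-σ w eq)) p) r
    cx : c x ≡ z
    cx = trans (cong c (sym p)) (c-ρ z z-on)

  dist-split : ∀ {u v} → ρ u ≢ ρ v → distance G u v ≡ δ u + distance G (c (ρ u)) v
  dist-split {u} {v} ρ≢ = ≤-antisym
    (≤-trans (dist-triangle G conn u (c (ρ u)) v) (+-monoˡ-≤ _ (dist-root u)))
    (≤-trans (≤-reflexive (cong (_+ distance G (c (ρ u)) v) (sym (dist-cycle u))))
        (through-root _ (dist-walk G conn u v) refl (ρ≢ ∘ sym)))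

  climb-root : ∀ u → climb (δ u) u ≡ c (ρ u)
  climb-root u = let p₁ , p₂ = climb-δρ (δ u) u (sym (+-identityʳ (δ u)))
                 in trans (sym (c-ρ _ p₁)) (cong c p₂)

  dist-climb : ∀ i u → distance G u (climb i u) ≤ i
  dist-climb zero u = ≤-reflexive (dist-self G u)
  dist-climb (suc i) u = ≤-trans (dist-triangle G conn u (climb i u) _)
    (≤-trans (+-mono-≤ (dist-climb i u) (≤-trans (dist-adj G conn _ (σ-adj (climb i u)))
        (s≤s (≤-reflexive (dist-self G _))))) (≤-reflexive (+-comm i 1)))

  chain-dist : ∀ {u v i} → ρ u ≢ ρ v → i ≤ δ u → distance G u (climb i u) ≡ i × distance G (climb i u) v ≡
      distance G u v ∸ i
  chain-dist {u} {v} {i} ρ≢ i≤ = d₁ , sym (trans (cong (_∸ i)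
      (≤-antisym (≤-trans (dist-triangle G conn u w v) (+-monoˡ-≤ _ (dist-climb i u))) upper))
      (m+n∸m≡n i (distance G w v)))
    where
    w : V
    w = climb i u
    upper : i + distance G w v ≤ distance G u v
    upper = begin
      i + distance G w v ≤⟨ +-monoʳ-≤ i (dist-triangle G conn w (c (ρ w)) v) ⟩
      i + (distance G w (c (ρ w)) + distance G (c (ρ w)) v)
          ≡⟨ cong₂ (λ x y → i + (x + distance G (c y) v)) (trans (dist-cycle w) (climb-δ i≤)) (climb-ρ i≤) ⟩
      i + (δ u ∸ i + distance G (c (ρ u)) v) ≡⟨ trans (sym (+-assoc i _ _))
          (cong (_+ distance G (c (ρ u)) v) (m+[n∸m]≡n i≤)) ⟩
      δ u + distance G (c (ρ u)) v ≡⟨ dist-split ρ≢ ⟨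
      distance G u v ∎
      where open ≤-Reasoning
    d₁ : distance G u w ≡ i
    d₁ = ≤-antisym (dist-climb i u) (+-cancelʳ-≤ (distance G w v) _ _
        (≤-trans upper (dist-triangle G conn u w v)))

  -- By `closer-≥` the i edges of a shortest path from `u` to `x` are on one side of the bridge and
  -- the e - i from `v` to `y` on the other. `ends` allows the path to cross the bridge towards the
  -- cycle or away from it.
  path-bridge : ∀ {u v i x y w} → i ≤ e → 0 < δ w → w ≡ x × σ w ≡ y ⊎ w ≡ y × σ w ≡ x →
    distance G u x ≡ i → distance G u y ≡ suc i → distance G v y ≡ e ∸ i → distance G v x ≡ suc (e ∸ i) → term
        i ≤ p w
  path-bridge {u} {v} {i} {x} {y} {w} i≤e δ> ends ux uy vy vx with δ w in eq
  ... | suc j with ends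
  ...   | inj₁ (refl , refl) = ≤-trans (≤-reflexive (f-def n (i ⊓ (e ∸ i)))) (Bridge.bridge-bound w eq
            (≤-trans (m⊓n≤m i _) (≤-trans (≤-reflexive (sym ux))
                (closer-≥ u (σ-adj w) (trans uy (cong suc (sym ux))))))
            (≤-trans (m⊓n≤n i _) (≤-trans (≤-reflexive (sym vy))
                (closer-≥ v (symm G (σ-adj w)) (trans vx (cong suc (sym vy)))))))
  ...   | inj₂ (refl , refl) = ≤-trans (≤-reflexive (f-def n (i ⊓ (e ∸ i)))) (Bridge.bridge-bound w eq
            (≤-trans (m⊓n≤n i _) (≤-trans (≤-reflexive (sym vy))
                (closer-≥ v (σ-adj w) (trans vx (cong suc (sym vy))))))
            (≤-trans (m⊓n≤m i _) (≤-trans (≤-reflexive (sym ux))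
                (closer-≥ u (symm G (σ-adj w)) (trans uy (cong suc (sym ux)))))))

  module _ {u v} (d≡ : distance G u v ≡ suc e) where

    -- Used when the path avoids the cycle edges, so that the whole cycle is surplus. Two pairs
    -- suffice on an even cycle, one on an odd cycle of length at least five (q = 0), and the three
    -- sides on a triangle.
    off-cycle-gain : D ≤ onCycle
    off-cycle-gain with half k
    ... | inj₂ (m , k≡) = ≤-trans (even-off {n} {m} {D} {b} 1≤m
        (even-room 0 z≤n (trivial-before 0 z≤n) (trivial-after 0 z≤n)) 1≤b 6≤n D≡)
        (≤-trans (+-mono-≤ (even-pair-≥ 0 z≤n (trivial-before 0 z≤n) (trivial-after 0 z≤n))
            (even-pair-≥ 1 1≤m (trivial-before 1 1≤m) (trivial-after 1 1≤m)))
          (≤-trans (≤-trans (≤-reflexive (cong (pair 0 +_) (sym (+-identityʳ (pair 1)))))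
              (Σ<-prefix pair (s≤s 1≤m))) pairs-even))
      where
      open EvenCycle m k≡
      pair : ℕ → ℕ
      pair j = p (c j) + p (c (suc m + j))
    ... | inj₁ (zero , k≡) = contradiction (subst (2 ≤_) k≡ 2≤k) λ ()
    ... | inj₁ (suc zero , k≡) = ≤-trans (triangle-off {y₀ = y₀} {y₁} {y₂} n≡ (D-bound {n} 1≤b D≡))
        (≤-trans (≤-reflexive (cong₂ _+_ (cong₂ _*_ e₀ e₁) (cong₂ _+_ (cong₂ _*_ e₁ e₂) (cong₂ _*_ e₂ e₀))))
        triangle≤)
      where
      open Triangle k≡
      nonempty : ∀ i → i ≤ k → 1 ≤ CycleEdges.level conn F i
      nonempty i i≤k = count-Unique (λ z → ρ z ℕₚ.≟ i) {c i ∷ []} ([] ∷ []) (ρ-c i≤k ∷ [])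
      y₀ y₁ y₂ : ℕ
      y₀ = x₀ ∸ 1
      y₁ = x₁ ∸ 1
      y₂ = x₂ ∸ 1
      e₀ : suc y₀ ≡ x₀
      e₀ = m+[n∸m]≡n (nonempty 0 z≤n)
      e₁ : suc y₁ ≡ x₁
      e₁ = m+[n∸m]≡n (nonempty 1 (≤-trans (s≤s z≤n) 2≤k))
      e₂ : suc y₂ ≡ x₂
      e₂ = m+[n∸m]≡n (nonempty 2 2≤k)
      n≡ : n ≡ 3 + (y₀ + y₁ + y₂)
      n≡ = trans (sym sizes₃) (trans (sym (cong₂ _+_ e₀ (cong₂ _+_ e₁ e₂))) (shuffle y₀ y₁ y₂))
        where
        sizes₃ : x₀ + (x₁ + x₂) ≡ n
        sizes₃ = Triangle.sizes k≡
        shuffle : ∀ a b c → suc a + (suc b + suc c) ≡ 3 + (a + b + c)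
        shuffle = solve-∀
    ... | inj₁ (suc (suc m) , k≡) = ≤-trans (m≤n+m D (f n 0))
        (≤-trans (odd-excess {n} {0} {suc (suc m)} {b} {D} (s≤s (s≤s z≤n)) (odd-room 0 z≤n before≥ after≥) z≤n
        D≡)
        (≤-trans (odd-pair-≥ 0 z≤n before≥ after≥) (≤-trans (m≤m+n _ _) pairs-odd)))
      where
      open OddCycle (suc m) k≡
      before≥ : suc (suc m) + 0 ≤ _
      before≥ = ≤-trans (≤-reflexive (+-identityʳ _)) (trivial-before 0 z≤n)
      after≥ : suc (suc m) + 0 ≤ _
      after≥ = ≤-trans (≤-reflexive (+-identityʳ _)) (trivial-after 0 z≤n)

    lower-same-root : ρ u ≡ ρ v → Φ + D ≤ edgeSzeged G
    lower-same-root ρ≡ = begin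
      Φ + D ≤⟨ +-mono-≤ (Σ<-mono (suc e) on-path) off-cycle-gain ⟩
      Σ< (suc e) (p ∘ edgeAt P) + onCycle ≡⟨ cong₂ _+_ (sum-applyUpTo p (edgeAt P) (suc e)) sum-arc ⟨
      sum (map p (applyUpTo (edgeAt P) (suc e))) + sum (map p (arc 0 (suc k)))
          ≡⟨ sum-map-++ p (applyUpTo (edgeAt P) (suc e)) _ ⟨
      sum (map p (applyUpTo (edgeAt P) (suc e) ++ arc 0 (suc k)))
          ≤⟨ ∑-Unique (Uniqueₚ.++⁺ (edges-Unique P) (arc-Unique ≤-refl)
          (λ (x , y) → <⇒≢ (All.lookup (Allₚ.applyUpTo⁺₁ (edgeAt P) (suc e) off) x)
              (sym (All.lookup (arc-δ 0 (suc k)) y)))) p ⟩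
      ∑ p ≡⟨ Sz≡∑p ⟨
      edgeSzeged G ∎
      where
      open ≤-Reasoning
      P : Geodesic G conn (suc e) u v
      P = subst (λ d → Geodesic G conn d u v) d≡ (geodesic G conn u v)
      open Geodesic P
      -- A cycle edge on the path would make it longer than δ u + δ v, but the route through the
      -- common corner is no longer than that.
      off : ∀ {i} → i < suc e → 0 < δ (edgeAt P i)
      off {i} i< with δ (edgeAt P i) in eq
      ... | suc _ = s≤s z≤n
      ... | zero = contradiction d≤ (<⇒≱ d>)
        where
        ends : δ (at i) ≡ 0 × δ (at (suc i)) ≡ 0
        ends with edgeAt-ends P i<
        ... | inj₁ (q₁ , q₂) = trans (cong δ (sym q₁)) eq , trans (cong δ (sym q₂)) (δ-σ₀ _ eq)
        ... | inj₂ (q₁ , q₂) = trans (cong δ (sym q₂)) (δ-σ₀ _ eq) , trans (cong δ (sym q₁)) eq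
        s≤i : δ u ≤ i
        s≤i = ≤-trans (δ≤dist u (at i) (proj₁ ends)) (≤-reflexive (fromStart (<⇒≤ i<)))
        r≤ : δ v ≤ e ∸ i
        r≤ = ≤-trans (δ≤dist v (at (suc i)) (proj₂ ends))
            (≤-reflexive (trans (dist-sym G conn v _) (toEnd i<)))
        d> : δ u + δ v < suc e
        d> = s≤s (≤-trans (+-mono-≤ s≤i r≤) (≤-reflexive (m+[n∸m]≡n (s≤s⁻¹ i<))))
        d≤ : suc e ≤ δ u + δ v
        d≤ = ≤-trans (≤-reflexive (sym d≡)) (≤-trans (dist-triangle G conn u (c (ρ u)) v)
               (+-mono-≤ (dist-root u) (≤-trans (≤-reflexive
                   (trans (dist-sym G conn (c (ρ u)) v) (cong (λ x → distance G v (c x)) ρ≡)))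
                   (dist-root v))))
      on-path : ∀ {i} → i < suc e → term i ≤ p (edgeAt P i)
      on-path {i} i< = path-bridge (s≤s⁻¹ i<) (off i<) (edgeAt-ends P i<) (fromStart (<⇒≤ i<)) (fromStart i<)
        (trans (dist-sym G conn v _) (toEnd i<)) (trans (dist-sym G conn v _)
            (trans (toEnd (<⇒≤ i<)) (+-∸-assoc 1 (s≤s⁻¹ i<))))

    chain-term : ρ u ≢ ρ v → ∀ {i} → i < δ u → term i ≤ p (climb i u)
    chain-term ρ≢ {i} i< = path-bridge i≤e (≤-trans (m<n⇒0<n∸m i<) (≤-reflexive (sym (climb-δ (<⇒≤ i<)))))
        (inj₁ (refl , refl)) (proj₁ here₁) (proj₁ next₁)
        (trans (dist-sym G conn v _) (trans (proj₂ next₁) (cong (_∸ suc i) d≡)))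
        (trans (dist-sym G conn v _) (trans (proj₂ here₁) (trans (cong (_∸ i) d≡) (+-∸-assoc 1 i≤e))))
      where
      here₁ : distance G u (climb i u) ≡ i × distance G (climb i u) v ≡ distance G u v ∸ i
      here₁ = chain-dist ρ≢ (<⇒≤ i<)
      next₁ : distance G u (climb (suc i) u) ≡ suc i × distance G (climb (suc i) u) v ≡ distance G u v ∸ suc i
      next₁ = chain-dist ρ≢ i<
      i≤e : i ≤ e
      i≤e = s≤s⁻¹ (≤-trans i< (≤-trans (m≤m+n (δ u) _) (≤-reflexive (trans (sym (dist-split ρ≢)) d≡))))

  module Trees {u v} (ρ≢ : ρ u ≢ ρ v) where

    trees : List V
    trees = chain u ++ (chain v ++ arc 0 (suc k))

    trees-Unique : Unique trees
    trees-Unique = Uniqueₚ.++⁺ (chain-Unique u)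
      (Uniqueₚ.++⁺ (chain-Unique v) (arc-Unique ≤-refl) (λ (x , y) → <⇒≢ (All.lookup (chain-δ v) x)
          (sym (All.lookup (arc-δ 0 (suc k)) y))))
      (λ (x , y) → All.lookup apart y (All.lookup (chain-ρ u) x) (All.lookup (chain-δ u) x))
      where
      apart : All (λ w → ρ w ≡ ρ u → ¬ 0 < δ w) (chain v ++ arc 0 (suc k))
      apart = Allₚ.++⁺ (All.map (λ ρw ρw′ _ → ρ≢ (trans (sym ρw′) ρw)) (chain-ρ v))
                       (All.map (λ δw _ 0<δ → <⇒≢ 0<δ (sym δw)) (arc-δ 0 (suc k)))

    sum-trees : sum (map p trees) ≡ Σ< (δ u) (λ i → p (climb i u)) +
        (Σ< (δ v) (λ i → p (climb i v)) + onCycle)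
    sum-trees = trans (sum-map-++ p (chain u) _) (cong₂ _+_ (sum-applyUpTo p (λ i → climb i u) (δ u))
      (trans (sum-map-++ p (chain v) _) (cong₂ _+_ (sum-applyUpTo p (λ i → climb i v) (δ v)) sum-arc)))

    trees≤ : Σ< (δ u) (λ i → p (climb i u)) + (Σ< (δ v) (λ i → p (climb i v)) + onCycle) ≤ edgeSzeged G
    trees≤ = ≤-trans (≤-reflexive (sym sum-trees)) (≤-trans (∑-Unique trees-Unique p)
        (≤-reflexive (sym Sz≡∑p)))

    trees-and : ∀ {w} → All (w ≢_) trees →
      p w + (Σ< (δ u) (λ i → p (climb i u)) + (Σ< (δ v) (λ i → p (climb i v)) + onCycle)) ≤ edgeSzeged G
    trees-and {w} w∉ = ≤-trans (≤-reflexive (cong (p w +_) (sym sum-trees)))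
        (≤-trans (∑-Unique (w∉ ∷ trees-Unique) p) (≤-reflexive (sym Sz≡∑p)))

halve : ∀ {x y} → x + x ≤ suc (y + y) → x ≤ y
halve {x} {y} le with x ℕₚ.≤? y
... | yes p = p
... | no ¬p = contradiction (≤-trans (+-mono-≤ (≰⇒> ¬p) (≰⇒> ¬p)) le)
    (<⇒≱ (s≤s (≤-reflexive (sym (+-suc y y)))))

-- The diametral path runs down from u to c 0, along c 0, …, c t and up to v.
module Across {G : Graph n} (conn : Connected G) (F : CycleForest G) (e b D : ℕ)
    (sizes : Target.Sizes n e b D)
  (u v : Fin n) (d≡ : distance G u v ≡ suc e)
  (ρu : CycleForest.ρ F u ≡ 0) (0<ρv : 0 < CycleForest.ρ F v)
      (ρv≤ : CycleForest.ρ F v + CycleForest.ρ F v ≤ suc (CycleForest.k F)) where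

  open CycleForest F
  open Forest conn F hiding (D)
  open Counting conn F
  open CycleSum conn F
  open Target n e b D
  open Target.Sizes sizes
  open Lower conn F e b D sizes

  s t r q : ℕ
  s = δ u
  t = ρ v
  r = δ v
  q = s ⊓ r

  ρ≢ : ρ u ≢ ρ v
  ρ≢ ρ≡ = <⇒≢ 0<ρv (trans (sym ρu) ρ≡)

  length≡ : s + (t + r) ≡ suc e
  length≡ = trans (sym (trans (dist-split ρ≢) (cong (s +_) (begin
    distance G (c (ρ u)) v ≡⟨ trans (dist-sym G conn (c (ρ u)) v) (cong (λ x → distance G v (c x)) ρu) ⟩
    distance G v (c 0) ≡⟨ dist-c₀ v ⟩
    r + (t ⊓ (suc k ∸ t)) ≡⟨ cong (r +_) (m≤n⇒m⊓n≡m (m+n≤o⇒m≤o∸n t ρv≤)) ⟩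
    r + t ≡⟨ +-comm r t ⟩
    t + r ∎)))) d≡
    where open ≡-Reasoning

  Φ-split : Φ ≡ Σ< s term + (Σ< t (λ j → term (s + j)) + Σ< r term)
  Φ-split = begin
    Σ< (suc e) term ≡⟨ cong (λ x → Σ< x term) length≡ ⟨
    Σ< (s + (t + r)) term ≡⟨ Σ<-split s (t + r) term ⟩
    Σ< s term + Σ< (t + r) (λ i → term (s + i)) ≡⟨ cong (Σ< s term +_) (Σ<-split t r _) ⟩
    Σ< s term + (Σ< t (λ j → term (s + j)) + Σ< r (λ i → term (s + (t + i))))
        ≡⟨ cong (λ x → Σ< s term + (Σ< t (λ j → term (s + j)) + x))
        (trans (Σ<-cong r flip) (Σ<-reverse r term)) ⟩
    Σ< s term + (Σ< t (λ j → term (s + j)) + Σ< r term) ∎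
    where
    open ≡-Reasoning
    -- The final part of the path is read from `v`, by the symmetry of `term` under exchanging i and
    -- e - i.
    flip : ∀ {i} → i < r → term (s + (t + i)) ≡ term (r ∸ suc i)
    flip {i} i<r = trans (cong term eq) (term-reverse r≤e)
      where
      x : ℕ
      x = r ∸ suc i
      total : s + (t + i) + x ≡ e
      total = suc-injective (trans (shuffle s t i x) (trans (cong (λ y → s + (t + y)) (m+[n∸m]≡n i<r))
          length≡))
        where
        shuffle : ∀ s t i x → suc (s + (t + i) + x) ≡ s + (t + (suc i + x))
        shuffle = solve-∀
      r≤e : x ≤ e
      r≤e = ≤-trans (m≤n+m x (s + (t + i))) (≤-reflexive total)
      eq : s + (t + i) ≡ e ∸ x
      eq = trans (sym (m+n∸n≡m (s + (t + i)) x)) (cong (_∸ x) total)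

  open Trees ρ≢

  chain-u : Σ< s term ≤ Σ< s (λ i → p (climb i u))
  chain-u = Σ<-mono s (chain-term d≡ ρ≢)

  dvu : distance G v u ≡ suc e
  dvu = trans (dist-sym G conn v u) d≡

  chain-v : Σ< r term ≤ Σ< r (λ i → p (climb i v))
  chain-v = Σ<-mono r (chain-term dvu (ρ≢ ∘ sym))

  combine : ∀ {x y z s′ r′} → Φ ≡ s′ + (x + r′) → x + y ≤ z → Φ + y ≤ s′ + (r′ + z)
  combine {x} {y} {z} {s′} {r′} refl′ le = ≤-trans (≤-reflexive
      (trans (cong (_+ y) refl′) (shuffle s′ x r′ y)))
    (+-monoʳ-≤ s′ (+-monoʳ-≤ r′ le))
    where
    shuffle : ∀ s x r y → s + (x + r) + y ≡ s + (r + (x + y))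
    shuffle = solve-∀

  lower-from-gain : ∀ {y} → Σ< t (λ j → term (s + j)) + y ≤ onCycle → Φ + y ≤ edgeSzeged G
  lower-from-gain gain = ≤-trans (combine {s′ = Σ< s term} {r′ = Σ< r term} Φ-split gain)
    (≤-trans (+-mono-≤ chain-u (+-monoˡ-≤ onCycle chain-v)) trees≤)

  position : ℕ → ℕ
  position j = (s + j) ⊓ (e ∸ (s + j))

  from-v : ∀ {j} → j < t → e ∸ (s + j) ≡ r + (t ∸ suc j)
  from-v {j} j<t = trans (cong (_∸ (s + j)) (sym total)) (m+n∸m≡n (s + j) _)
    where
    shuffle : ∀ s j r x → suc (s + j + (r + x)) ≡ s + (suc j + x + r)
    shuffle = solve-∀
    total : s + j + (r + (t ∸ suc j)) ≡ e
    total = suc-injective (trans (shuffle s j r (t ∸ suc j))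
        (trans (cong (λ x → s + (x + r)) (m+[n∸m]≡n j<t)) length≡))

  within : ∀ {j} → j < t → s + j ≤ e
  within {j} j<t = s≤s⁻¹ (≤-trans (≤-reflexive (sym (+-suc s j)))
      (≤-trans (+-monoʳ-≤ s (≤-trans j<t (m≤m+n t r))) (≤-reflexive length≡)))

  position≤ : ∀ {m j} → t ≤ suc m → j < t → position j ≤ q + m
  position≤ {m} {j} t≤ j<t with ≤-total s r
  ... | inj₁ s≤r = ≤-trans (m⊓n≤m (s + j) _) (+-mono-≤ (≤-reflexive (sym (m≤n⇒m⊓n≡m s≤r)))
      (s≤s⁻¹ (≤-trans j<t t≤)))
  ... | inj₂ r≤s = ≤-trans (m⊓n≤n (s + j) _) (≤-trans (≤-reflexive (from-v j<t))
        (+-mono-≤ (≤-reflexive (sym (m≥n⇒m⊓n≡n r≤s))) (≤-trans (∸-monoʳ-≤ t (s≤s (z≤n {j})))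
            (∸-monoˡ-≤ 1 t≤))))

  last : ℕ
  last = t ∸ 1

  last<t : last < t
  last<t = ≤-reflexive (m+[n∸m]≡n 0<ρv)

  -- The first cycle edge of the path has `s` path edges before it and the last one has `r` after
  -- it; `q` is one of these two. The surplus will be taken at that edge.
  nearest : position 0 ≤ q ⊎ position last ≤ q
  nearest with ≤-total s r
  ... | inj₁ s≤r = inj₁ (≤-trans (m⊓n≤m (s + 0) _) (≤-reflexive
      (trans (+-identityʳ s) (sym (m≤n⇒m⊓n≡m s≤r)))))
  ... | inj₂ r≤s = inj₂ (≤-trans (m⊓n≤n (s + last) _) (≤-reflexive (trans (from-v last<t)
        (trans (cong (λ x → r + (t ∸ x)) (m+[n∸m]≡n 0<ρv))
            (trans (cong (r +_) (n∸n≡0 t)) (trans (+-identityʳ r) (sym (m≥n⇒m⊓n≡n r≤s))))))))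

  q≤b : q ≤ b
  q≤b = ⊓≤b (s≤s⁻¹ (≤-trans (s≤s (≤-reflexive refl)) (≤-trans
      (≤-trans (≤-reflexive (sym (+-suc s r))) (+-monoʳ-≤ s (+-monoˡ-≤ r 0<ρv))) (≤-reflexive length≡))))

  module SideBounds (m j : ℕ) (j≤m : j ≤ m) (m<k : m < k) (j<t : j < t) (t≤ : t ≤ suc m) where
    open Sides m j j≤m m<k

    ρⱼv< : ρⱼ v < suc m
    ρⱼv< = s≤s (≤-trans (≤-reflexive (renumber-≥ k j<t))
        (≤-trans (∸-monoʳ-≤ t (s≤s (z≤n {j}))) (∸-monoˡ-≤ 1 t≤)))

    ρⱼu : ρⱼ u ≡ k ∸ j
    ρⱼu = trans (cong (renumber k (suc j)) ρu) (renumber-< k {suc j} {0} (s≤s z≤n))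

    -- Each side of a cycle edge of the path contains, besides its half of the cycle, one of the
    -- chains of `u` and `v`; `q` bounds both lengths from below.
    before-q : suc m + q ≤ before (suc m)
    before-q = ≤-trans (+-monoʳ-≤ (suc m) (m⊓n≤n s r)) (before-≥ v ρⱼv<)

    after-q : ∀ l i → suc l + i ≤ suc k → l < k ∸ j → i + q ≤ after l
    after-q l i fits l< = ≤-trans (+-monoʳ-≤ i (m⊓n≤m s r))
        (after-≥ l i fits u (≤-trans l< (≤-reflexive (sym ρⱼu))))

  gain : k ≢ 2 → Σ< t (λ j → term (s + j)) + D ≤ onCycle
  gain k≢2 with half k
  ... | inj₁ (zero , k≡) = contradiction (subst (2 ≤_) k≡ 2≤k) λ ()
  ... | inj₁ (suc zero , k≡) = contradiction k≡ k≢2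
  ... | inj₁ (suc (suc m) , k≡) = ≤-trans sum≤ (≤-trans (Σ<-prefix pair t≤) pairs-odd)
    where
    h : ℕ
    h = suc (suc m)
    open OddCycle (suc m) k≡
    pair : ℕ → ℕ
    pair j = p (c j) + p (c (h + j))
    t≤ : t ≤ h
    t≤ = halve (≤-trans ρv≤ (s≤s (≤-reflexive k≡)))
    j≤ : ∀ {j} → j < t → j ≤ suc m
    j≤ j<t = s≤s⁻¹ (≤-trans j<t t≤)
    module _ {j} (j<t : j < t) where
      open SideBounds (suc m) j (j≤ j<t) m<k j<t t≤
      after-h : h + q ≤ CycleEdges.after conn (Sides.Fⱼ (suc m) j (j≤ j<t) m<k) h
      after-h = after-q h h (s≤s (≤-reflexive (sym k≡)))
          (m+n≤o⇒m≤o∸n (suc h) (≤-trans (s≤s (+-monoʳ-≤ h (j≤ j<t)))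
          (≤-reflexive (trans (sym (+-suc h (suc m))) (sym k≡)))))
      pair-≥ : f n (h + q) + (h + q) * h ≤ pair j
      pair-≥ = odd-pair-≥ j (j≤ j<t) before-q after-h
      room : suc ((h + q) + (h + q)) ≤ n
      room = odd-room j (j≤ j<t) before-q after-h
      each : term (s + j) ≤ pair j
      each = ≤-trans (f-mono n (≤-trans (position≤ t≤ j<t)
          (≤-trans (≤-reflexive (+-comm q (suc m))) (n≤1+n _))) room) (≤-trans (m≤m+n _ _) pair-≥)
      best : position j ≤ q → term (s + j) + D ≤ pair j
      best pos = ≤-trans (+-monoˡ-≤ D (f-mono n pos (≤-trans (s≤s (+-mono-≤ (m≤n+m q h) (m≤n+m q h))) room)))
        (≤-trans (odd-excess {n} {q} {h} {b} {D} (s≤s (s≤s z≤n)) room q≤b D≡) pair-≥)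
    sum≤ : Σ< t (λ j → term (s + j)) + D ≤ Σ< t pair
    sum≤ with nearest
    ... | inj₁ pos = Σ<-excess t 0 0<ρv each (best 0<ρv pos)
    ... | inj₂ pos = Σ<-excess t last last<t each (best last<t pos)
  ... | inj₂ (m , k≡) = ≤-trans sum≤ pairs-even
    where
    h : ℕ
    h = suc m
    open EvenCycle m k≡
    pair : ℕ → ℕ
    pair j = p (c j) + p (c (h + j))
    t≤ : t ≤ h
    t≤ = halve (≤-trans ρv≤ (≤-trans (s≤s (≤-reflexive k≡))
        (≤-trans (≤-reflexive (cong suc (sym (+-suc m m)))) (n≤1+n _))))
    j≤ : ∀ {j} → j < t → j ≤ m
    j≤ j<t = s≤s⁻¹ (≤-trans j<t t≤)
    K : ℕ
    K = m + q
    q<K : q < K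
    q<K = +-monoˡ-≤ q 1≤m
    module _ {j} (j<t : j < t) where
      open SideBounds m j (j≤ j<t) m<k j<t t≤
      after-h : suc K ≤ CycleEdges.after conn (Sides.Fⱼ m j (j≤ j<t) m<k) m
      after-h = after-q m h (≤-reflexive (trans (cong suc (+-suc m m)) (cong suc (sym k≡))))
          (m+n≤o⇒m≤o∸n h (≤-trans (s≤s (+-monoʳ-≤ m (j≤ j<t))) (≤-reflexive (sym k≡))))
      pair-≥ : fᵉ n K + fᵉ n K ≤ pair j
      pair-≥ = even-pair-≥ j (j≤ j<t) before-q after-h
      room : suc (suc (K + K)) ≤ n
      room = even-room j (j≤ j<t) before-q after-h
      pos≤K : position j ≤ K
      pos≤K = ≤-trans (position≤ t≤ j<t) (≤-reflexive (+-comm q m))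
      each : term (s + j) ≤ pair j
      each = ≤-trans (f≤2fᵉ n pos≤K room) pair-≥
      q-room : suc (q + q) ≤ n
      q-room = ≤-trans (s≤s (+-mono-≤ (<⇒≤ q<K) (<⇒≤ q<K))) (≤-trans (n≤1+n _) room)
    apart : t < h → ∀ {j} → (j<t : j < t) → position j ≤ q → term (s + j) + D ≤ pair j + pair t
    apart t<h {j} j<t pos = ≤-trans (+-monoˡ-≤ D (f-mono n pos (q-room j<t)))
      (≤-trans (even-apart {n} {q} {K} {m} {D} {b} q<K (room j<t) 1≤m
          (even-room t t≤m (trivial-before t t≤m) (trivial-after t t≤m)) 1≤b D≡)
        (+-mono-≤ (pair-≥ j<t) (even-pair-≥ t t≤m (trivial-before t t≤m) (trivial-after t t≤m))))
      where
      t≤m : t ≤ m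
      t≤m = s≤s⁻¹ t<h
    both : ∀ {i j} (i<t : i < t) (j<t : j < t) → position i ≤ q → term (s + i) + term (s + j) + D ≤ pair i +
        pair j
    both {i} {j} i<t j<t pos = ≤-trans (+-monoˡ-≤ D (+-monoˡ-≤ (term (s + j)) (f-mono n pos (q-room i<t))))
      (≤-trans (even-both {n} {q} {position j} {K} {b} {D} q<K (pos≤K j<t) (room j<t) q≤b
          (position≤b (s + j) (within j<t)) 1≤b 2b+3≤n 6≤n D≡)
        (+-mono-≤ (pair-≥ i<t) (pair-≥ j<t)))
    sum≤ : Σ< t (λ j → term (s + j)) + D ≤ Σ< h pair
    sum≤ with m≤n⇒m<n∨m≡n t≤ | nearest
    ... | inj₁ t<h | inj₁ pos = ≤-trans (Σ<-excess-last t 0 0<ρv each (apart t<h 0<ρv pos))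
        (Σ<-prefix pair t<h)
    ... | inj₁ t<h | inj₂ pos = ≤-trans (Σ<-excess-last t last last<t each (apart t<h last<t pos))
        (Σ<-prefix pair t<h)
    ... | inj₂ t≡h | inj₁ pos = ≤-trans (Σ<-excess₂ t 0 last 0<last last<t each (both 0<ρv last<t pos))
        (Σ<-prefix pair t≤)
      where
      0<last : 0 < last
      0<last = ≤-trans 1≤m (∸-monoˡ-≤ 1 (≤-reflexive (sym t≡h)))
    ... | inj₂ t≡h | inj₂ pos = ≤-trans (Σ<-excess₂ t 0 last 0<last last<t each
            (≤-trans (≤-reflexive (cong (_+ D) (+-comm (term (s + 0)) _)))
                (≤-trans (both last<t 0<ρv pos) (≤-reflexive (+-comm (pair last) _))))) (Σ<-prefix pair t≤)
      where
      0<last : 0 < last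
      0<last = ≤-trans 1≤m (∸-monoˡ-≤ 1 (≤-reflexive (sym t≡h)))

-- The case of equality

∉⇒All : ∀ {A : Set} {x : A} xs → x ∉ xs → All (x ≢_) xs
∉⇒All [] _ = []
∉⇒All (y ∷ xs) x∉ = (λ e → x∉ (here e)) ∷ ∉⇒All xs (λ m → x∉ (there m))

-- The graph is extremal: a triangle with a path of a edges ending in u and one of b edges
-- ending in v, every further vertex being adjacent to the triangle vertex below u.
record Extremal {G : Graph n} (conn : Connected G) (F : CycleForest G) (a b : ℕ) : Set where
  open CycleForest F
  field
    u v   : Fin n
    k≡2   : k ≡ 2
    δu    : δ u ≡ a
    δv    : δ v ≡ b
    ι     : ℕ
    ι≤2   : ι ≤ 2
    ρ≢    : ρ u ≢ ρ v
    ι≢u   : ι ≢ ρ u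
    ι≢v   : ι ≢ ρ v
    third : ∀ {x} → x ≤ 2 → x ≢ ρ u → x ≢ ρ v → x ≡ ι
    rest  : ∀ w → δ w ≡ 0 ⊎ w ∈ Counting.chain conn F u ⊎ w ∈ Counting.chain conn F v ⊎ σ w ≡ c (ρ u)

-- Here `suc D` is 2n - 2 - 2b. The corner below `v` carries only the path and the third corner
-- nothing. It remains to show that every further edge is pendent at the corner below `u`, or else
-- the index is strictly larger than `base`.
module Equality {G : Graph n} (conn : Connected G) (F : CycleForest G) (e b D : ℕ)
    (sizes : Target.Sizes n e b (suc D))
  (u v : Fin n) (d≡ : distance G u v ≡ suc e) (k≡2 : CycleForest.k F ≡ 2)
  (ρ≢ : CycleForest.ρ F u ≢ CycleForest.ρ F v)
  (level-v : CycleEdges.level conn F (CycleForest.ρ F v) ≡ suc (CycleForest.δ F v))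
  (off-path : ∀ z → CycleForest.ρ F z ≢ CycleForest.ρ F u → CycleForest.ρ F z ≢ CycleForest.ρ F v →
      CycleForest.δ F z ≡ 0)
  (δu≤ : CycleForest.δ F u ≤ suc b)
  (δuv : CycleForest.δ F u + b ≡ e)
  where

  open CycleForest F
  open Forest conn F hiding (D)
  open Counting conn F
  open CycleSum conn F
  open Target n e b (suc D)
  open Target.Sizes sizes
  open Lower conn F e b (suc D) sizes
  open Trees ρ≢
  open Membership (_≟_ {n}) using (_∈?_)

  private
    base : ℕ
    base = Σ< (δ u) term + (Σ< (δ v) term + onCycle)

    chains : Σ< (δ u) term ≤ Σ< (δ u) (λ i → p (climb i u))
    chains = Σ<-mono (δ u) (chain-term d≡ ρ≢)

    chains′ : Σ< (δ v) term ≤ Σ< (δ v) (λ i → p (climb i v))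
    chains′ = Σ<-mono (δ v) (chain-term (trans (dist-sym G conn v u) d≡) (ρ≢ ∘ sym))

  Other : V → Set
  Other w = 0 < δ w × w ∉ chain u × w ∉ chain v

  -- The corner below `v` is full: its level has `suc (δ v)` vertices, taken up by `c (ρ v)` and the
  -- chain of `v`.
  other-ρ : ∀ {w} → Other w → ρ w ≡ ρ u
  other-ρ {w} (δ> , _ , w∉) with ρ w ℕₚ.≟ ρ u | ρ w ℕₚ.≟ ρ v
  ... | yes r | _ = r
  ... | no ¬r | no ¬r′ = contradiction (off-path w ¬r ¬r′) (<⇒≢ δ> ∘ sym)
  ... | no _ | yes r′ = contradiction too-many (<⇒≱ (≤-reflexive (cong suc level-v)))
    where
    too-many : suc (suc (δ v)) ≤ CycleEdges.level conn F (ρ v)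
    too-many = ≤-trans (≤-reflexive (cong (2 +_) (sym (length-applyUpTo (λ i → climb i v) (δ v)))))
      (count-Unique (λ z → ρ z ℕₚ.≟ ρ v) {w ∷ c (ρ v) ∷ chain v}
        (((λ w≡c → <⇒≢ δ> (sym (trans (cong δ w≡c) (δ-c (ρ v))))) ∷ ∉⇒All (chain v) w∉)
          ∷ (∉⇒All (chain v) (λ m → <⇒≢ (All.lookup (chain-δ v) m) (sym (δ-c (ρ v)))) ∷ chain-Unique v))
        (r′ ∷ ρ-c (ρ≤k v) ∷ chain-ρ v))

  not-in-arc : ∀ {w} → 0 < δ w → All (w ≢_) (arc 0 (suc k))
  not-in-arc δ> = All.map (λ {x} δx w≡x → <⇒≢ δ> (sym (trans (cong δ w≡x) δx))) (arc-δ 0 (suc k))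

  with-other : ∀ {w} → Other w → 1 ≤ p w → suc base ≤ edgeSzeged G
  with-other {w} (δ> , w∉u , w∉v) p> = ≤-trans
    (+-mono-≤ p> (+-mono-≤ chains (+-monoˡ-≤ onCycle chains′)))
    (trees-and (Allₚ.++⁺ (∉⇒All (chain u) w∉u) (Allₚ.++⁺ (∉⇒All (chain v) w∉v) (not-in-arc δ>))))

  away : ∀ {w} → 0 < δ w → ρ w ≡ ρ u → δ (σ w) + distance G (c (ρ u)) v ≤ C (σ w) w
  away {w} δ> ρ≡ with δ w in eq
  ... | suc j = ≤-trans (≤-reflexive (sym far))
        (closer-≥ v (symm G (σ-adj w)) (trans (trans (dist-sym G conn v w)
            (dist-split {w} {v} (λ r → ρ≢ (trans (sym ρ≡) r))))
          (trans (cong₂ (λ x y → x + distance G (c y) v) eq ρ≡)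
              (cong suc (trans (cong (_+ distance G (c (ρ u)) v) (sym (δ-σ w eq))) (sym far))))))
    where
    far : distance G v (σ w) ≡ δ (σ w) + distance G (c (ρ u)) v
    far = trans (dist-sym G conn v (σ w)) (trans (dist-split {σ w} {v}
        (λ r → ρ≢ (trans (sym ρ≡) (trans (sym (ρ-σ w eq)) r))))
            (cong (λ x → δ (σ w) + distance G (c x) v) (trans (ρ-σ w eq) ρ≡)))

  root-apart : 1 ≤ distance G (c (ρ u)) v
  root-apart with distance G (c (ρ u)) v in eq
  ... | suc _ = s≤s z≤n
  ... | zero = contradiction (trans (sym (ρ-c (ρ≤k u))) (cong ρ (dist≡0 G conn eq))) ρ≢

  away≥1 : ∀ {w} → 0 < δ w → ρ w ≡ ρ u → 1 ≤ C (σ w) w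
  away≥1 δ> ρ≡ = ≤-trans root-apart (≤-trans (m≤n+m _ _) (away δ> ρ≡))

  below-count : ∀ {y xs} → 0 < δ y → Unique xs → All (λ z → Forest.Below conn F y z × z ≢ y) xs → length xs ≤
      C y (σ y)
  below-count {y} {xs} δ> uniq all with δ y in eq
  ... | suc j = count-Unique (λ z → Forest.D conn F z y ℕₚ.<? Forest.D conn F z (σ y)) uniq
      (All.map (λ (bz , z≢) → Bridge.below-closer y eq bz z≢) all)

  child : ∀ {w} → 0 < δ w → Below (σ w) w
  child {w} δ> with δ w in eq
  ... | suc j = over eq here

  below-trans : ∀ {x y z} → Below x y → Below y z → Below x z
  below-trans b here = b
  below-trans b (over e b′) = over e (below-trans b b′)

  climb-below : ∀ i j x → i + j ≤ δ x → Below (climb (i + j) x) (climb j x)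
  climb-below zero j x le = here
  climb-below (suc i) j x le = below-trans (child (≤-trans (m<n⇒0<n∸m le)
      (≤-reflexive (sym (climb-δ (<⇒≤ le))))))
    (climb-below i j x (<⇒≤ le))

  f-gap : ∀ {i} → i < δ u → suc (f n i) ≤ f n (suc i)
  f-gap {i} i<s = f-strict {n} ≤-refl (begin
    suc (suc i + suc i) ≤⟨ s≤s (+-mono-≤ i<s (≤-trans i<s δu≤)) ⟩
    suc (δ u + suc b) ≡⟨ cong suc (trans (+-suc (δ u) b) (cong suc δuv)) ⟩
    2 + e ≤⟨ e+2≤n ⟩
    n ∎)
    where open ≤-Reasoning

  -- Below the bridge y = climb i u lie the `i` chain edges before it and also `w`. So it
  -- contributes at least f (i + 1), where `base` counts only f i, and `f` is still strictly
  -- increasing there since i < δ u ≤ b + 1.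
  strict-on-chain : ∀ {w i} → Other w → i < δ u → σ w ≡ climb i u → suc base ≤ edgeSzeged G
  strict-on-chain {w} {i} (δ> , w∉u , w∉v) i<s σw = ≤-trans
    (≤-reflexive (+-comm 1 base)) (≤-trans (≤-reflexive (shuffle (Σ< (δ u) term) _ 1))
    (≤-trans (+-mono-≤ (Σ<-excess (δ u) i i<s (chain-term d≡ ρ≢) gap) (+-monoˡ-≤ onCycle chains′)) trees≤))
    where
    shuffle : ∀ x y z → x + y + z ≡ x + z + y
    shuffle = solve-∀
    y : V
    y = climb i u
    δy : δ y ≡ δ u ∸ i
    δy = climb-δ (<⇒≤ i<s)
    0<δy : 0 < δ y
    0<δy = ≤-trans (m<n⇒0<n∸m i<s) (≤-reflexive (sym δy))
    lower : List V
    lower = applyUpTo (λ j → climb j u) i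
    lower∈ : ∀ {x} → x ∈ lower → x ∈ chain u
    lower∈ x∈ with j , j<i , refl ← ∈-applyUpTo⁻ (λ j → climb j u) x∈ = ∈-applyUpTo⁺ (λ j → climb j u)
        (<-trans j<i i<s)
    under : length (w ∷ lower) ≤ C y (σ y)
    under = below-count 0<δy
      (∉⇒All lower (λ m → w∉u (lower∈ m)) ∷ Uniqueₚ.applyUpTo⁺₁ _ i (λ {j} {l} j<l l<i → Uniqueness j<l l<i))
      ((subst (λ z → Below z w) σw (child δ>) , λ w≡y → w∉u (subst (_∈ chain u) (sym w≡y) y∈)) ∷
          Allₚ.applyUpTo⁺₁ _ i (λ {j} j<i →
        subst (λ m → Below (climb m u) (climb j u)) (m∸n+n≡m (<⇒≤ j<i))
            (climb-below (i ∸ j) j u (≤-trans (≤-reflexive (m∸n+n≡m (<⇒≤ j<i))) (<⇒≤ i<s))) ,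
        λ e′ → <⇒≢ j<i (climb-injective (<⇒≤ (<-trans j<i i<s)) (<⇒≤ i<s) e′)))
      where
      climb-injective : ∀ {j l} → j ≤ δ u → l ≤ δ u → climb j u ≡ climb l u → j ≡ l
      climb-injective j≤ l≤ e′ = ∸-cancelˡ-≡ j≤ l≤ (trans (sym (climb-δ j≤)) (trans (cong δ e′) (climb-δ l≤)))
      Uniqueness : ∀ {j l} → j < l → l < i → climb j u ≢ climb l u
      Uniqueness j<l l<i e′ = <⇒≢ j<l (climb-injective (<⇒≤ (<-trans (<-trans j<l l<i) i<s))
          (<⇒≤ (<-trans l<i i<s)) e′)
      y∈ : y ∈ chain u
      y∈ = ∈-applyUpTo⁺ (λ j → climb j u) i<s
    i≤b : i ≤ b
    i≤b = s≤s⁻¹ (≤-trans i<s δu≤)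
    across : distance G (c (ρ u)) v ≡ suc b
    across = +-cancelˡ-≡ (δ u) _ _ (trans (sym (dist-split ρ≢))
        (trans d≡ (trans (cong suc (sym δuv)) (sym (+-suc (δ u) b)))))
    position : i ⊓ (e ∸ i) ≡ i
    position = m≤n⇒m⊓n≡m (m+n≤o⇒m≤o∸n i (≤-trans (+-mono-≤ (<⇒≤ i<s) i≤b) (≤-reflexive δuv)))
    bridge : suc i * (n ∸ 1 ∸ suc i) ≤ p y
    bridge with δ y in eq
    ... | zero = contradiction eq (<⇒≢ 0<δy ∘ sym)
    ... | suc _ = Bridge.bridge-bound y eq (≤-trans (≤-reflexive
        (cong suc (sym (length-applyUpTo (λ j → climb j u) i)))) under)
            (≤-trans (s≤s i≤b) (≤-trans (≤-reflexive (sym across))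
                (≤-trans (m≤n+m _ (δ (σ y))) (away 0<δy (climb-ρ (<⇒≤ i<s))))))
    gap : term i + 1 ≤ p y
    gap = begin
      term i + 1 ≡⟨ trans (cong (λ x → f n x + 1) position) (+-comm (f n i) 1) ⟩
      suc (f n i) ≤⟨ f-gap i<s ⟩
      f n (suc i) ≡⟨ f-def n (suc i) ⟩
      suc i * (n ∸ 1 ∸ suc i) ≤⟨ bridge ⟩
      p y ∎
      where open ≤-Reasoning

  strict-or-extremal : suc base ≤ edgeSzeged G ⊎ (∀ w → δ w ≡ 0 ⊎ w ∈ chain u ⊎ w ∈ chain v ⊎ σ w ≡ c (ρ u))
  strict-or-extremal with any? (λ w → (0 ℕₚ.<? δ w) ×-dec ¬? (w ∈? chain u) ×-dec ¬? (w ∈? chain v) ×-dec ¬?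
      (σ w ≟ c (ρ u)))
  ... | no none = inj₂ classify
    where
    classify : ∀ w → δ w ≡ 0 ⊎ w ∈ chain u ⊎ w ∈ chain v ⊎ σ w ≡ c (ρ u)
    classify w with 0 ℕₚ.<? δ w | w ∈? chain u | w ∈? chain v | σ w ≟ c (ρ u)
    ... | no δ≯0 | _ | _ | _ = inj₁ (n≤0⇒n≡0 (≮⇒≥ δ≯0))
    ... | yes _ | yes m | _ | _ = inj₂ (inj₁ m)
    ... | yes _ | no _ | yes m | _ = inj₂ (inj₂ (inj₁ m))
    ... | yes _ | no _ | no _ | yes q = inj₂ (inj₂ (inj₂ q))
    ... | yes q₁ | no q₂ | no q₃ | no q₄ = contradiction (w , q₁ , q₂ , q₃ , q₄) none
  ... | yes (w , 0<δ , w∉u , w∉v , σw≢) = inj₁ (strict (σ w ∈? chain u))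
    where
    other : Other w
    other = 0<δ , w∉u , w∉v
    ρσ : ρ (σ w) ≡ ρ u
    ρσ with δ w in eq
    ... | zero = contradiction 0<δ λ ()
    ... | suc j = trans (ρ-σ w eq) (other-ρ (≤-trans (s≤s z≤n) (≤-reflexive (sym eq)) , w∉u , w∉v))
    0<δσ : 0 < δ (σ w)
    0<δσ with δ (σ w) in eq
    ... | suc _ = s≤s z≤n
    ... | zero = contradiction (trans (sym (c-ρ (σ w) eq)) (cong c ρσ)) σw≢
    strict : Dec (σ w ∈ chain u) → suc base ≤ edgeSzeged G
    strict (yes m) with i , i<s , q ← ∈-applyUpTo⁻ (λ j → climb j u) m = strict-on-chain other i<s q
    -- Now `σ w` names a further edge outside `base`, with `w` below it and the way to `v` on its
    -- other side; it contributes at least 1.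
    strict (no σw∉u) = with-other (0<δσ , σw∉u , λ m → ρ≢ (trans (sym ρσ) (All.lookup (chain-ρ v) m)))
      (*-mono-≤ {1} {_} {1} (below-count 0<δσ ([] ∷ []) ((child 0<δ , σ≢ w) ∷ [])) (away≥1 0<δσ ρσ))

module OnTriangle {G : Graph n} (conn : Connected G) (F : CycleForest G) (e a b D : ℕ)
    (sizes : Target.Sizes n e b (suc D))
  (u v : Fin n) (d≡ : distance G u v ≡ suc e)
  (ρu : CycleForest.ρ F u ≡ 0) (0<ρv : 0 < CycleForest.ρ F v)
      (ρv≤ : CycleForest.ρ F v + CycleForest.ρ F v ≤ suc (CycleForest.k F))
  (k≡2 : CycleForest.k F ≡ 2) (e≡ : a + b ≡ e) (a≤ : a ≤ suc b) where

  open CycleForest F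
  open Forest conn F hiding (D)
  open Counting conn F
  open CycleSum conn F
  open Target n e b (suc D)
  open Target.Sizes sizes
  open Lower conn F e b (suc D) sizes
  open Across conn F e b (suc D) sizes u v d≡ ρu 0<ρv ρv≤
  open Triangle k≡2 hiding (sizes)

  private
    t≡1 : t ≡ 1
    t≡1 = ≤-antisym (halve (≤-trans ρv≤ (s≤s (≤-reflexive k≡2)))) 0<ρv

    y₀ y₁ z : ℕ
    y₀ = x₀ ∸ 1
    y₁ = x₁ ∸ 1
    z = x₂ ∸ 1

    level-u : suc s ≤ x₀
    level-u = subst (λ i → suc s ≤ CycleEdges.level conn F i) ρu (level-≥ u)

    level-v : suc r ≤ x₁
    level-v = subst (λ i → suc r ≤ CycleEdges.level conn F i) t≡1 (level-≥ v)

    x₀≡ : suc y₀ ≡ x₀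
    x₀≡ = m+[n∸m]≡n (≤-trans (s≤s z≤n) level-u)

    x₁≡ : suc y₁ ≡ x₁
    x₁≡ = m+[n∸m]≡n (≤-trans (s≤s z≤n) level-v)

    x₂≡ : suc z ≡ x₂
    x₂≡ = m+[n∸m]≡n (≤-trans (s≤s z≤n) (subst (λ i → suc (δ (c 2)) ≤ CycleEdges.level conn F i) (ρ-c 2≤k)
        (level-≥ (c 2))))

    s≤y₀ : s ≤ y₀
    s≤y₀ = ∸-monoˡ-≤ 1 level-u

    r≤y₁ : r ≤ y₁
    r≤y₁ = ∸-monoˡ-≤ 1 level-v

    s+r≡e : s + r ≡ e
    s+r≡e = suc-injective (trans (sym (+-suc s r)) (trans (cong (λ x → s + (x + r)) (sym t≡1)) length≡))

    n≡ : n ≡ 3 + (y₀ + y₁ + z)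
    n≡ = trans (sym (Triangle.sizes k≡2)) (trans (sym (cong₂ _+_ x₀≡ (cong₂ _+_ x₁≡ x₂≡))) (shuffle y₀ y₁ z))
      where
      shuffle : ∀ a b c → suc a + (suc b + suc c) ≡ 3 + (a + b + c)
      shuffle = solve-∀

    middle : Σ< t (λ j → term (s + j)) ≡ f n q
    middle = trans (cong (λ x → Σ< x (λ j → term (s + j))) t≡1) (trans (+-identityʳ _)
      (cong (f n) (cong₂ _⊓_ (+-identityʳ s) (trans (from-v 0<ρv)
          (trans (cong (λ x → r + (x ∸ 1)) t≡1) (+-identityʳ r))))))

    triangle-≤ : Σ₃ y₀ y₁ z ≤ onCycle
    triangle-≤ = ≤-trans (≤-reflexive (cong₂ _+_ (cong₂ _*_ x₀≡ x₁≡)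
        (cong₂ _+_ (cong₂ _*_ x₁≡ x₂≡) (cong₂ _*_ x₂≡ x₀≡)))) triangle≤

    Σ₃-sym : ∀ x y z → Σ₃ x y z ≡ Σ₃ y x z
    Σ₃-sym x y z = eq x y z
      where
      eq : ∀ x y z → suc x * suc y + (suc y * suc z + suc z * suc x) ≡ suc y * suc x +
          (suc x * suc z + suc z * suc y)
      eq = solve-∀

  Conclusion : Set
  Conclusion = Φ + suc D ≤ edgeSzeged G ⊎ (Φ + D ≤ edgeSzeged G × Extremal conn F a b)

  private
    enough : f n q + suc D ≤ Σ₃ y₀ y₁ z → Conclusion
    enough le = inj₁ (lower-from-gain (≤-trans (+-monoˡ-≤ (suc D) (≤-reflexive middle))
        (≤-trans le triangle-≤)))

    just-enough : f n q + suc D ≡ suc (Σ₃ y₀ y₁ z) → Σ< t (λ j → term (s + j)) + D ≤ onCycle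
    just-enough eq = ≤-trans (+-monoˡ-≤ D (≤-reflexive middle))
        (≤-trans (≤-reflexive (suc-injective (trans (sym (+-suc (f n q) D)) eq))) triangle-≤)

    off-path : z ≡ 0 → ∀ w → ρ w ≢ 0 → ρ w ≢ t → δ w ≡ 0
    off-path z≡0 w ρ≢0 ρ≢t = n≤0⇒n≡0 (s≤s⁻¹ (≤-trans (level-≥ w)
        (≤-reflexive (trans (cong (CycleEdges.level conn F)
        (two (ρ w) (≤-trans (ρ≤k w) (≤-reflexive k≡2)) ρ≢0 (λ q → ρ≢t (trans q (sym t≡1)))))
        (trans (sym x₂≡) (cong suc z≡0))))))
      where
      two : ∀ x → x ≤ 2 → x ≢ 0 → x ≢ 1 → x ≡ 2
      two 0 _ p _ = contradiction refl p
      two 1 _ _ p = contradiction refl p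
      two 2 _ _ _ = refl
      two (suc (suc (suc _))) (s≤s (s≤s ())) _ _

    third : ∀ {x} → x ≤ 2 → x ≢ 0 → x ≢ t → x ≡ 2
    third {0} _ p _ = contradiction refl p
    third {1} _ _ p = contradiction (sym t≡1) p
    third {2} _ _ _ = refl
    third {suc (suc (suc _))} (s≤s (s≤s ())) _ _

    2≢t : 2 ≢ t
    2≢t q = contradiction (trans q t≡1) λ ()

    -- From q ≤ r ≤ y₁ and y₁ = b = q follows r = b, and then s = a because s + r = e. So the chain
    -- of `v` fills its corner, as `Equality` requires; `u-small` is the mirror image.
    v-small : z ≡ 0 → y₁ ≡ b → q ≡ b → f n q + suc D ≡ suc (Σ₃ y₀ y₁ z) → Conclusion
    v-small z≡0 y₁≡b q≡b eq = decide (Equality.strict-or-extremal conn F e b D sizes u v d≡ k≡2 ρ≢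
        (trans (cong (CycleEdges.level conn F) t≡1) (trans (sym x₁≡) (cong suc (trans y₁≡b (sym r≡b)))))
        (λ w ρ≢u ρ≢v → off-path z≡0 w (λ q → ρ≢u (trans q (sym ρu))) ρ≢v)
        (≤-trans (≤-reflexive s≡a) a≤) (trans (cong (_+ b) s≡a) e≡))
      where
      r≡b : r ≡ b
      r≡b = ≤-antisym (≤-trans r≤y₁ (≤-reflexive y₁≡b)) (≤-trans (≤-reflexive (sym q≡b)) (m⊓n≤n s r))
      s≡a : s ≡ a
      s≡a = +-cancelʳ-≡ b s a (trans (cong (s +_) (sym r≡b)) (trans s+r≡e (sym e≡)))
      base : ℕ
      base = Σ< s term + (Σ< r term + onCycle)
      ≤base : Φ + D ≤ base
      ≤base = combine {s′ = Σ< s term} {r′ = Σ< r term} Φ-split (just-enough eq)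
      decide : suc base ≤ edgeSzeged G ⊎ (∀ w → δ w ≡ 0 ⊎ w ∈ chain u ⊎ w ∈ chain v ⊎ σ w ≡ c (ρ u)) →
          Conclusion
      decide (inj₁ lt) = inj₁ (≤-trans (≤-reflexive (+-suc Φ D)) (≤-trans (s≤s ≤base) lt))
      decide (inj₂ rest) = inj₂ (lower-from-gain (just-enough eq) , record
        { u = u ; v = v ; k≡2 = k≡2 ; δu = s≡a ; δv = r≡b ; ι = 2 ; ι≤2 = ≤-refl ; ρ≢ = ρ≢
        ; ι≢u = λ q → contradiction (trans q ρu) λ () ; ι≢v = 2≢t
        ; third = λ x≤ p p′ → third x≤ (λ q → p (trans q (sym ρu))) p′ ; rest = rest })

    u-small : z ≡ 0 → y₀ ≡ b → q ≡ b → f n q + suc D ≡ suc (Σ₃ y₀ y₁ z) → Conclusion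
    u-small z≡0 y₀≡b q≡b eq = decide (Equality.strict-or-extremal conn F e b D sizes v u dvu k≡2 (ρ≢ ∘ sym)
        (trans (cong (CycleEdges.level conn F) ρu) (trans (sym x₀≡) (cong suc (trans y₀≡b (sym s≡b)))))
        (λ w ρ≢v ρ≢u → off-path z≡0 w (λ q → ρ≢u (trans q (sym ρu))) ρ≢v)
        (≤-trans (≤-reflexive r≡a) a≤) (trans (cong (_+ b) r≡a) e≡))
      where
      s≡b : s ≡ b
      s≡b = ≤-antisym (≤-trans s≤y₀ (≤-reflexive y₀≡b)) (≤-trans (≤-reflexive (sym q≡b)) (m⊓n≤m s r))
      r≡a : r ≡ a
      r≡a = +-cancelʳ-≡ b r a (trans (+-comm r b) (trans (cong (_+ r) (sym s≡b)) (trans s+r≡e (sym e≡))))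
      base : ℕ
      base = Σ< r term + (Σ< s term + onCycle)
      ≤base : Φ + D ≤ base
      ≤base = ≤-trans (combine {s′ = Σ< s term} {r′ = Σ< r term} Φ-split (just-enough eq))
          (≤-reflexive (shuffle (Σ< s term) (Σ< r term) onCycle))
        where
        shuffle : ∀ x y z → x + (y + z) ≡ y + (x + z)
        shuffle = solve-∀
      decide : suc base ≤ edgeSzeged G ⊎ (∀ w → δ w ≡ 0 ⊎ w ∈ chain v ⊎ w ∈ chain u ⊎ σ w ≡ c (ρ v)) →
          Conclusion
      decide (inj₁ lt) = inj₁ (≤-trans (≤-reflexive (+-suc Φ D)) (≤-trans (s≤s ≤base) lt))
      decide (inj₂ rest) = inj₂ (lower-from-gain (just-enough eq) , record
        { u = v ; v = u ; k≡2 = k≡2 ; δu = r≡a ; δv = s≡b ; ι = 2 ; ι≤2 = ≤-refl ; ρ≢ = ρ≢ ∘ sym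
        ; ι≢u = 2≢t ; ι≢v = λ q → contradiction (trans q ρu) λ ()
        ; third = λ x≤ p p′ → third x≤ (λ q → p′ (trans q (sym ρu))) p ; rest = rest })

  conclusion : Conclusion
  conclusion with ≤-total y₁ y₀
  ... | inj₁ y₁≤y₀ = [ enough , (λ (z≡0 , y≡b , q≡b , eq) → v-small z≡0 y≡b q≡b eq) ]
        (triangle-on {n} {suc D} {q} {b} {y₀} {y₁} {z} n≡ D≡ (≤-trans (m⊓n≤n s r) r≤y₁) y₁≤y₀ q≤b 1≤b)
  ... | inj₂ y₀≤y₁ = [ (λ le → enough (≤-trans le (≤-reflexive (Σ₃-sym y₁ y₀ z)))) ,
      (λ (z≡0 , y≡b , q≡b , eq) → u-small z≡0 y≡b q≡b (trans eq (cong suc (Σ₃-sym y₁ y₀ z)))) ]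
        (triangle-on {n} {suc D} {q} {b} {y₁} {y₀} {z} (trans n≡ (cong (λ x → 3 + (x + z)) (+-comm y₀ y₁))) D≡
            (≤-trans (m⊓n≤m s r) s≤y₀) y₀≤y₁ q≤b 1≤b)

module _ {G : Graph n} (conn : Connected G) (e a b D : ℕ) (sizes : Target.Sizes n e b (suc D))
    (e≡ : a + b ≡ e) (a≤ : a ≤ suc b) where

  private
    Φ : ℕ
    Φ = Σ< (suc e) (Target.term n e b D)

  -- With `D` the excess of the extremal graph, the first alternative exceeds its index; the second
  -- allows equality but fixes the structure.
  Dichotomy : Set
  Dichotomy = Φ + suc D ≤ edgeSzeged G ⊎ (Φ + D ≤ edgeSzeged G × ∃[ F ] Extremal conn F a b)

  across : (F : CycleForest G) (u v : Fin n) → distance G u v ≡ suc e → CycleForest.ρ F u ≡ 0 → 0 <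
      CycleForest.ρ F v →
    CycleForest.ρ F v + CycleForest.ρ F v ≤ suc (CycleForest.k F) → Dichotomy
  across F u v d≡ ρu 0<ρv ρv≤ with CycleForest.k F ℕₚ.≟ 2
  ... | no k≢2 = inj₁ (Across.lower-from-gain conn F e b (suc D) sizes u v d≡ ρu 0<ρv ρv≤
      (Across.gain conn F e b (suc D) sizes u v d≡ ρu 0<ρv ρv≤ k≢2))
  ... | yes k≡2 with OnTriangle.conclusion conn F e a b D sizes u v d≡ ρu 0<ρv ρv≤ k≡2 e≡ a≤
  ...   | inj₁ lt = inj₁ lt
  ...   | inj₂ (le , ext) = inj₂ (le , F , ext)

  dichotomy : CycleForest G → (u v : Fin n) → distance G u v ≡ suc e → Dichotomy
  dichotomy F u v d≡ with CycleForest.ρ F u ℕₚ.≟ CycleForest.ρ F v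
  ... | yes ρ≡ = inj₁ (Lower.lower-same-root conn F e b (suc D) sizes d≡ ρ≡)
  ... | no ρ≢ = place ((t + t) ℕₚ.≤? suc k)
    where
    open CycleForest F using (k; ρ; ρ≤k; c; c-ρ)
    F′ : CycleForest G
    F′ = rotate F (ρ u) (ρ≤k u)
    t : ℕ
    t = renumber k (ρ u) (ρ v)
    t≤k : t ≤ k
    t≤k = CycleForest.ρ≤k F′ v
    ρ′u : renumber k (ρ u) (ρ u) ≡ 0
    ρ′u = trans (renumber-≥ k {ρ u} {ρ u} ≤-refl) (n∸n≡0 (ρ u))
    0<t : 0 < t
    0<t with ρ u ℕₚ.≤? ρ v
    ... | yes le = m<n⇒0<n∸m (≤∧≢⇒< le ρ≢)
    ... | no ¬le = m<n⇒0<n∸m (≤-trans (s≤s (ρ≤k u)) (m≤n+m (suc k) (ρ v)))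
    place : Dec (t + t ≤ suc k) → Dichotomy
    place (yes t≤) = across F′ u v d≡ ρ′u 0<t t≤
    -- The forward arc from the corner of `u` to that of `v` is more than half of the cycle.
    -- Exchanging the two ends and renumbering from the other corner replaces its length t by k + 1
    -- - t.
    place (no t≰) = across (rotate F′ t t≤k) v u (trans (dist-sym G conn v u) d≡)
      (trans (renumber-≥ k {t} {t} ≤-refl) (n∸n≡0 t))
      (≤-trans (m<n⇒0<n∸m (s≤s t≤k)) (≤-reflexive (sym ρ″u)))
      (≤-trans (≤-reflexive (cong₂ _+_ ρ″u ρ″u)) (≤-trans
          (+-monoʳ-≤ (suc k ∸ t) (m≤n+o⇒m∸n≤o (suc k) t (<⇒≤ (≰⇒> t≰))))
          (≤-reflexive (m∸n+n≡m (≤-trans t≤k (n≤1+n k))))))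
      where
      ρ″u : renumber k t (renumber k (ρ u) (ρ u)) ≡ suc k ∸ t
      ρ″u = trans (cong (renumber k t) ρ′u) (renumber-< k 0<t)

-- Isomorphism with the extremal graph

injective-hits : (φ : Fin n → Fin n) → (∀ {i j} → φ i ≡ φ j → i ≡ j) → ∀ x → ∃[ i ] φ i ≡ x
injective-hits {n} φ inj x with any? (λ i → φ i ≟ x)
... | yes hit = hit
... | no miss = contradiction (Finₚ.injective⇒≤ {f = φ′} injective′) 1+n≰n
  where
  φ′ : Fin (suc n) → Fin n
  φ′ zero = x
  φ′ (suc i) = φ i
  injective′ : ∀ {i j} → φ′ i ≡ φ′ j → i ≡ j
  injective′ {zero} {zero} _ = refl
  injective′ {zero} {suc j} e = contradiction (j , sym e) miss
  injective′ {suc i} {zero} e = contradiction (i , e) miss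
  injective′ {suc i} {suc j} e = cong suc (inj e)

-- Because of closed, such a copy of H is an induced subgraph of G.
record Copy {m} (H : Graph m) {G : Graph n} (F : CycleForest G) : Set where
  open CycleForest F
  field
    φ         : Fin m → Fin n
    injective : ∀ {i j} → φ i ≡ φ j → i ≡ j
    preserves : ∀ {i j} → Adj H i j → Adj G (φ i) (φ j)
    closed    : ∀ i → ∃[ j ] Adj H i j × φ j ≡ σ (φ i)

  Hit : Fin n → Set
  Hit x = ∃[ i ] φ i ≡ x

module _ {H : Graph m} {G : Graph n} {F : CycleForest G} (R : Copy H F) where

  open Copy R
  open CycleForest F

  attach : ∀ x v → ¬ Hit x → σ x ≡ φ v → Copy (attachVertex H v) F
  attach x v x∉ σx = record { φ = φ′ ; injective = λ {i} {j} → injective′ {i} {j} ; preserves = λ {i} {j} →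
      preserves′ {i} {j} ; closed = closed′ }
    where
    φ′ : Fin (suc m) → Fin n
    φ′ zero = x
    φ′ (suc i) = φ i
    injective′ : ∀ {i j} → φ′ i ≡ φ′ j → i ≡ j
    injective′ {zero} {zero} _ = refl
    injective′ {zero} {suc j} e = contradiction (j , sym e) x∉
    injective′ {suc i} {zero} e = contradiction (i , e) x∉
    injective′ {suc i} {suc j} e = cong suc (injective e)
    preserves′ : ∀ {i j} → Adj (attachVertex H v) i j → Adj G (φ′ i) (φ′ j)
    preserves′ {zero} {suc j} refl = subst (Adj G x) σx (σ-adj x)
    preserves′ {suc i} {zero} refl = symm G (subst (Adj G x) σx (σ-adj x))
    preserves′ {suc i} {suc j} a = preserves a
    closed′ : ∀ i → ∃[ j ] Adj (attachVertex H v) i j × φ′ j ≡ σ (φ′ i)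
    closed′ zero = suc v , refl , sym σx
    closed′ (suc i) = let j , a , e = closed i in suc j , a , e

-- Every edge of `G` is {x , σ x}. `closed` provides an edge of `H` with this image, and injectivity
-- identifies its ends, so adjacency is reflected as well as preserved.
spanning⇒≅ : {H : Graph n} {G : Graph n} {F : CycleForest G} → Copy H F → G ≅ H
spanning⇒≅ {n} {H} {G} {F} R = record
  { bijection = mk↔ₛ′ ψ φ (λ i → injective (φψ (φ i))) φψ
  ; adj⇔ = λ u v → mk⇔ (λ a → reflects (subst₂ (Adj G) (sym (φψ u)) (sym (φψ v)) a))
                        (λ a → subst₂ (Adj G) (φψ u) (φψ v) (preserves a)) }
  where
  open Copy R
  open CycleForest F
  ψ : Fin n → Fin n
  ψ x = proj₁ (injective-hits φ injective x)
  φψ : ∀ x → φ (ψ x) ≡ x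
  φψ x = proj₂ (injective-hits φ injective x)
  reflects : ∀ {i j} → Adj G (φ i) (φ j) → Adj H i j
  reflects {i} {j} a with adj-σ a
  ... | inj₁ e = let l , b , q = closed i in subst (Adj H i) (injective (trans q (sym e))) b
  ... | inj₂ e = let l , b , q = closed j in symm H (subst (Adj H j) (injective (trans q (sym e))) b)

module _ {G : Graph n} (conn : Connected G) (F : CycleForest G) where

  open CycleForest F
  open Counting conn F

  record PathCopy {m} (H : Graph m) (R₀ : Copy H F) (y : Fin n) (v : Fin m) (i : ℕ) : Set where
    field
      copy : Copy (attachPath i H v) F
      end  : Copy.φ copy (pathEnd i v) ≡ climb (δ y ∸ i) y
      old  : ∀ j → Copy.φ copy (i ↑ʳ j) ≡ Copy.φ R₀ j
      new  : ∀ j → (∃[ l ] Copy.φ copy j ≡ Copy.φ R₀ l) ⊎ (ρ (Copy.φ copy j) ≡ ρ y × δ (Copy.φ copy j) ≤ i)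
      hits : ∀ {j} → j < i → Copy.Hit copy (climb (δ y ∸ suc j) y)

  -- The path is laid from the cycle outwards. By `clear` and `new` everything placed so far over
  -- the corner of `y` has height at most i, so the next vertex, of height i + 1, is fresh.
  attach-path : ∀ {m} {H : Graph m} (R₀ : Copy H F) y v → Copy.φ R₀ v ≡ c (ρ y) →
      (∀ j → ρ (Copy.φ R₀ j) ≡ ρ y → δ (Copy.φ R₀ j) ≡ 0) →
    ∀ i → i ≤ δ y → PathCopy H R₀ y v i
  attach-path R₀ y v φv clear zero _ = record
    { copy = R₀ ; end = trans φv (sym (climb-root y)) ; old = λ _ → refl ; new = λ j → inj₁ (j , refl) ; hits
        = λ () }
    where
    climb-root : ∀ u → climb (δ u) u ≡ c (ρ u)
    climb-root u = let p₁ , p₂ = climb-δρ (δ u) u (sym (+-identityʳ (δ u))) in trans (sym (c-ρ _ p₁)) (cong c p₂)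
  attach-path {H = H} R₀ y v φv clear (suc i) i<δ = record
    { copy = copy′ ; end = refl ; old = old
    ; new = λ { zero → inj₂ (climb-ρ (m∸n≤m (δ y) (suc i)) , ≤-reflexive δx) ; (suc j) → map₂
        (λ (r , d) → r , ≤-trans d (n≤1+n i)) (new j) }
    ; hits = λ {j} j≤i → [ (λ j<i → let l , q = hits j<i in suc l , q) , (λ { refl → zero , refl }) ] (m≤n⇒m<n∨m≡n (s≤s⁻¹ j≤i)) }
    where
    open PathCopy (attach-path R₀ y v φv clear i (<⇒≤ i<δ))
    x : Fin n
    x = climb (δ y ∸ suc i) y
    δx : δ x ≡ suc i
    δx = trans (climb-δ (m∸n≤m (δ y) (suc i))) (m∸[m∸n]≡n i<δ)
    x∉ : ¬ Copy.Hit copy x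
    x∉ (j , q) with new j
    ... | inj₁ (l , q′) = contradiction (trans (sym δx) (trans (cong δ (trans (sym q) q′))
        (clear l (trans (cong ρ (trans (sym q′) q)) (climb-ρ (m∸n≤m (δ y) (suc i))))))) λ ()
    ... | inj₂ (_ , d) = 1+n≰n (≤-trans (≤-reflexive (trans (sym δx) (cong δ (sym q)))) d)
    σx : σ x ≡ Copy.φ copy (pathEnd i v)
    σx = trans (cong (λ l → climb l y) (sym (+-∸-assoc 1 i<δ))) (sym end)
    copy′ : Copy (attachPath (suc i) H v) F
    copy′ = attach copy x (pathEnd i v) x∉ σx

  -- Every vertex missing from `R₀` hangs at the image of `v`, so any vertex not yet hit may come
  -- next; one exists while fewer than n are placed.
  attach-pendants : ∀ {m} {H : Graph m} (R₀ : Copy H F) v → (∀ x → ¬ Copy.Hit R₀ x → σ x ≡ Copy.φ R₀ v) →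
    ∀ i → i + m ≤ n → ∃[ R ] (Copy.φ {H = attachPendants i H v} {F = F} R (i ↑ʳ v) ≡ Copy.φ R₀ v ×
        (∀ {x} → Copy.Hit R₀ x → Copy.Hit R x))
  attach-pendants R₀ v rest zero _ = R₀ , refl , λ h → h
  attach-pendants {m} {H} R₀ v rest (suc i) le =
    let R , φv , hit = attach-pendants R₀ v rest i (<⇒≤ le)
        x , x∉ = missed (Copy.φ R) le
    in attach R x (i ↑ʳ v) x∉ (trans (rest x (x∉ ∘ hit)) (sym φv)) , φv , λ h → let j , q = hit h in suc j , q
    where
    missed : ∀ {l} (φ : Fin l → Fin n) → l < n → ∃[ x ] ¬ (∃[ i ] φ i ≡ x)
    missed φ l<n = ¬∀⟶∃¬ n (λ x → ∃[ i ] φ i ≡ x) (λ x → any? (λ i → φ i ≟ x)) λ all →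
      <⇒≱ l<n (Finₚ.injective⇒≤ {f = λ x → proj₁ (all x)}
          (λ {x} {y} e → trans (sym (proj₂ (all x))) (trans (cong φ e) (proj₂ (all y)))))

  module _ {a b p} (ext : Extremal conn F a b) (n≡ : p + (b + (a + 3)) ≡ n) where

    open Extremal ext

    private
      v₁ v₂ : Fin 3
      v₁ = zero
      v₂ = suc zero

      corner : Fin 3 → ℕ
      corner zero = ρ u
      corner (suc zero) = ρ v
      corner (suc (suc zero)) = ι

      corner≤ : ∀ i → corner i ≤ k
      corner≤ zero = ρ≤k u
      corner≤ (suc zero) = ρ≤k v
      corner≤ (suc (suc zero)) = ≤-trans ι≤2 (≤-reflexive (sym k≡2))

      corner≤2 : ∀ i → corner i ≤ 2
      corner≤2 i = ≤-trans (corner≤ i) (≤-reflexive k≡2)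

      step : ∀ i → Adj G (c i) (c (suc i))
      step i = subst (Adj G (c i)) (σ-c i) (σ-adj (c i))

      corner-injective : ∀ {i j} → corner i ≡ corner j → i ≡ j
      corner-injective {zero} {zero} _ = refl
      corner-injective {zero} {suc zero} e = contradiction e ρ≢
      corner-injective {zero} {suc (suc zero)} e = contradiction (sym e) ι≢u
      corner-injective {suc zero} {zero} e = contradiction (sym e) ρ≢
      corner-injective {suc zero} {suc zero} _ = refl
      corner-injective {suc zero} {suc (suc zero)} e = contradiction (sym e) ι≢v
      corner-injective {suc (suc zero)} {zero} e = contradiction e ι≢u
      corner-injective {suc (suc zero)} {suc zero} e = contradiction e ι≢v
      corner-injective {suc (suc zero)} {suc (suc zero)} _ = refl

      corner-onto : ∀ x → x ≤ k → ∃[ i ] corner i ≡ x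
      corner-onto x x≤k with x ℕₚ.≟ ρ u | x ℕₚ.≟ ρ v
      ... | yes q | _ = zero , sym q
      ... | no _ | yes q = suc zero , sym q
      ... | no q | no q′ = suc (suc zero) , sym (third (≤-trans x≤k (≤-reflexive k≡2)) q q′)

      φ₀ : Fin 3 → Fin n
      φ₀ i = c (corner i)

      φ₀-injective : ∀ {i j} → φ₀ i ≡ φ₀ j → i ≡ j
      φ₀-injective {i} {j} e = corner-injective (trans (sym (ρ-c (corner≤ i)))
          (trans (cong ρ e) (ρ-c (corner≤ j))))

      cycle-hit : ∀ x → δ x ≡ 0 → ∃[ i ] φ₀ i ≡ x
      cycle-hit x δx = let i , q = corner-onto (ρ x) (ρ≤k x) in i , trans (cong c q) (c-ρ x δx)

      σφ₀ : ∀ i → ∃[ j ] i ≢ j × φ₀ j ≡ σ (φ₀ i)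
      σφ₀ i = let j , q = cycle-hit (σ (φ₀ i)) (trans (cong δ (σ-c (corner i))) (δ-c _))
              in j , (λ i≡j → irrefl G (trans (cong φ₀ i≡j) q) (σ-adj (φ₀ i))) , q

      side : ∀ x y → x ≤ 2 → y ≤ 2 → x ≢ y → Adj G (c x) (c y)
      side 0 0 _ _ q = contradiction refl q
      side 1 1 _ _ q = contradiction refl q
      side 2 2 _ _ q = contradiction refl q
      side 0 1 _ _ _ = step 0
      side 1 2 _ _ _ = step 1
      side 2 0 _ _ _ = subst (Adj G (c 2)) (trans (cong (c ∘ suc) (sym k≡2)) (c-period 0)) (step 2)
      side 1 0 p q _ = symm G (side 0 1 q p λ ())
      side 2 1 p q _ = symm G (side 1 2 q p λ ())
      side 0 2 p q _ = symm G (side 2 0 q p λ ())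
      side (suc (suc (suc _))) _ (s≤s (s≤s ())) _ _
      side 0 (suc (suc (suc _))) _ (s≤s (s≤s ())) _
      side 1 (suc (suc (suc _))) _ (s≤s (s≤s ())) _
      side 2 (suc (suc (suc _))) _ (s≤s (s≤s ())) _

      R₀ : Copy triangle F
      R₀ = record
        { φ = φ₀ ; injective = φ₀-injective ; closed = σφ₀
        ; preserves = λ {i} {j} i≢j → side (corner i) (corner j) (corner≤2 i) (corner≤2 j)
            (i≢j ∘ corner-injective) }

      R₁ : PathCopy triangle R₀ u v₁ a
      R₁ = attach-path R₀ u v₁ refl (λ j _ → δ-c (corner j)) a (≤-reflexive (sym δu))

      module R₁ = PathCopy R₁

      R₂ : PathCopy (attachPath a triangle v₁) R₁.copy v (a ↑ʳ v₂) b
      R₂ = attach-path R₁.copy v (a ↑ʳ v₂) (R₁.old v₂)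
        clear
        b (≤-reflexive (sym δv))
        where
        clear : ∀ j → ρ (Copy.φ R₁.copy j) ≡ ρ v → δ (Copy.φ R₁.copy j) ≡ 0
        clear j ρj with R₁.new j
        ... | inj₁ (l , q) = trans (cong δ q) (δ-c (corner l))
        ... | inj₂ (r , _) = contradiction (trans (sym r) ρj) ρ≢

      module R₂ = PathCopy R₂

      root-hit : Copy.φ R₂.copy (b ↑ʳ (a ↑ʳ v₁)) ≡ c (ρ u)
      root-hit = trans (R₂.old (a ↑ʳ v₁)) (R₁.old v₁)

      hit-≡ : ∀ {x y} → x ≡ y → Copy.Hit R₂.copy x → Copy.Hit R₂.copy y
      hit-≡ e (i , q) = i , trans q e

      from-R₁ : ∀ {x} → Copy.Hit R₁.copy x → Copy.Hit R₂.copy x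
      from-R₁ (i , q) = b ↑ʳ i , trans (R₂.old i) q

      from-R₀ : ∀ {x} → Copy.Hit R₀ x → Copy.Hit R₂.copy x
      from-R₀ (i , q) = from-R₁ (a ↑ʳ i , trans (R₁.old i) q)

      -- `chain` counts from the far end of the path and `hits` from the cycle.
      index : ∀ {l d e} → d ≡ e → l < d → d ∸ suc l < e × d ∸ suc (d ∸ suc l) ≡ l
      index {l} {d} refl l<d = ∸-monoʳ-< {d} {suc l} {0} (s≤s z≤n) l<d ,
        trans (cong (d ∸_) (sym (+-∸-assoc 1 l<d))) (m∸[m∸n]≡n (<⇒≤ l<d))

      outside : ∀ x → ¬ Copy.Hit R₂.copy x → σ x ≡ Copy.φ R₂.copy (b ↑ʳ (a ↑ʳ v₁))
      outside x miss with rest x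
      ... | inj₁ δx = contradiction (from-R₀ (cycle-hit x δx)) miss
      ... | inj₂ (inj₁ m) = let l , l< , q = ∈-applyUpTo⁻ (λ i → climb i u) m
                                j< , e = index δu l<
                            in contradiction (hit-≡ (trans (cong (λ i → climb i u) e) (sym q))
                                (from-R₁ (R₁.hits j<))) miss
      ... | inj₂ (inj₂ (inj₁ m)) = let l , l< , q = ∈-applyUpTo⁻ (λ i → climb i v) m
                                       j< , e = index δv l<
                                   in contradiction (hit-≡ (trans (cong (λ i → climb i v) e) (sym q))
                                       (R₂.hits j<)) miss
      ... | inj₂ (inj₂ (inj₂ q)) = trans q (sym root-hit)

    copy-C₃ : Copy (C₃ p a b) F
    copy-C₃ = proj₁ (attach-pendants R₂.copy (b ↑ʳ (a ↑ʳ v₁)) outside p (≤-reflexive n≡))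

extremal-≅ : ∀ {p a b} {G : Graph (p + (b + (a + 3)))} (conn : Connected G) (F : CycleForest G) → Extremal
    conn F a b → G ≅ C₃ p a b
extremal-≅ {p} {a} {b} conn F ext = spanning⇒≅ (copy-C₃ conn F {p = p} ext refl)

-- The edge Szeged index of the extremal graph

∑ᴱ-cong : (G : Graph n) {h h′ : Fin n → Fin n → ℕ} → (∀ u v → h u v ≡ h′ u v) → ∑ᴱ G h ≡ ∑ᴱ G h′
∑ᴱ-cong G eq = ∑-cong λ u → ∑-cong λ v → cong (⟦ u <? v ×-dec adj? G u v ⟧ *_) (eq u v)

∑ᴱ-+ : (G : Graph n) (h h′ : Fin n → Fin n → ℕ) → ∑ᴱ G (λ u v → h u v + h′ u v) ≡ ∑ᴱ G h + ∑ᴱ G h′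
∑ᴱ-+ G h h′ = trans (∑-cong λ u → trans (∑-cong λ v → *-distribˡ-+ ⟦ u <? v ×-dec adj? G u v ⟧ (h u v)
    (h′ u v)) (∑-+ _ _)) (∑-+ _ _)

∑ᴱ-zero : (G : Graph n) {h : Fin n → Fin n → ℕ} → (∀ u v → h u v ≡ 0) → ∑ᴱ G h ≡ 0
∑ᴱ-zero {n} G eq = trans (∑-cong λ u → trans (∑-cong λ v → trans
    (cong (⟦ u <? v ×-dec adj? G u v ⟧ *_) (eq u v)) (*-zeroʳ ⟦ u <? v ×-dec adj? G u v ⟧)) (∑-zero n))
    (∑-zero n)

module _ (G : Graph n) where

  closerTo : Fin n → Fin n → ℕ
  closerTo u w = ∑ᴱ G (λ a b → ⟦ distance G a u ⊓ distance G b u ℕₚ.<? distance G a w ⊓ distance G b w ⟧)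

  nearer : Fin n → Fin n → Fin n → ℕ
  nearer x u w = ⟦ distance G x u ℕₚ.<? distance G x w ⟧

  -- separators x y counts the edges separating x from y, and farSum x sums over the
  -- edges the number of edges on the side not containing x.
  separators : Fin n → Fin n → ℕ
  separators x y = ∑ᴱ G (λ u w → nearer x u w * nearer y w u + nearer x w u * nearer y u w)

  farSum : Fin n → ℕ
  farSum x = ∑ᴱ G (λ u w → nearer x u w * closerTo w u + nearer x w u * closerTo u w)

  Sz≡ : edgeSzeged G ≡ ∑ᴱ G (λ u w → closerTo u w * closerTo w u)
  Sz≡ = trans (Sz-∑ G) (∑ᴱ-cong G λ u w → cong₂ _*_ (closer-∑ G u w) (closer-∑ G w u))

  nearer-exclusive : ∀ x u w → nearer x u w * nearer x w u ≡ 0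
  nearer-exclusive x u w with distance G x u ℕₚ.<? distance G x w | distance G x w ℕₚ.<? distance G x u
  ... | no _ | _ = refl
  ... | yes _ | no _ = refl
  ... | yes p | yes q = contradiction p (<-asym q)

  separators-self : ∀ x → separators x x ≡ 0
  separators-self x = ∑ᴱ-zero G λ u w → cong₂ _+_ (nearer-exclusive x u w) (nearer-exclusive x w u)

module Attach (G : Graph n) (conn : Connected G) (v : Fin n) where

  private
    G′ : Graph (suc n)
    G′ = attachVertex G v

  ∑ᴱ-attach : ∀ h → ∑ᴱ G′ h ≡ h zero (suc v) + ∑ᴱ G (λ u w → h (suc u) (suc w))
  ∑ᴱ-attach h = trans (∑-suc _) (cong₂ _+_ first others)
    where
    first : ∑ (λ w → ⟦ zero {n} <? w ×-dec adj? G′ zero w ⟧ * h zero w) ≡ h zero (suc v)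
    first = trans (∑-suc _) (trans (cong₂ _+_
        (cong (_* h zero zero) (⟦⟧-no (zero {n} <? zero {n} ×-dec adj? G′ zero zero)
            (λ (q , _) → contradiction q λ ())))
        (trans (∑-cong λ w → cong (_* h zero (suc w)) (⟦⟧-cong (zero {n} <? suc w ×-dec adj? G′ zero (suc w))
            (w ≟ v) proj₂ (λ e → s≤s z≤n , e))) (∑-δ v (λ w → h zero (suc w))))) refl)
    others : ∑ (λ u → ∑ (λ w → ⟦ suc u <? w ×-dec adj? G′ (suc u) w ⟧ * h (suc u) w)) ≡ ∑ᴱ G
        (λ u w → h (suc u) (suc w))
    others = ∑-cong λ u → trans (∑-suc _) (cong₂ _+_
      (cong (_* h (suc u) zero) (⟦⟧-no (suc u <? zero {n} ×-dec adj? G′ (suc u) zero)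
          (λ (q , _) → contradiction q λ ())))
      (∑-cong λ w → cong (_* h (suc u) (suc w)) (⟦⟧-cong (suc u <? suc w ×-dec adj? G′ (suc u) (suc w))
          (u <? w ×-dec adj? G u w) (λ (q , a) → s≤s⁻¹ q , a) (λ (q , a) → s≤s q , a))))

  walk-suc : ∀ k {u w} → Walk G k u w → Walk G′ k (suc u) (suc w)
  walk-suc zero refl = refl
  walk-suc (suc k) (x , a , q) = suc x , a , walk-suc k q

  connected : Connected G′
  connected zero zero = 0 , refl
  connected zero (suc w) = let k , q = conn v w in suc k , suc v , refl , walk-suc k q
  connected (suc u) zero = let k , q = conn u v in suc k , walk-snoc G′ k (walk-suc k q) refl
  connected (suc u) (suc w) = let k , q = conn u w in k , walk-suc k q

  retract : Fin (suc n) → Fin n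
  retract zero = v
  retract (suc u) = u

  -- Folding the leaf onto `v` maps each edge to an edge or a point, so walks do not get longer.
  -- Hence old distances survive the attachment.
  retract-dist : ∀ k {x y} → Walk G′ k x y → distance G (retract x) (retract y) ≤ k
  retract-dist zero refl = ≤-trans (≤-reflexive (dist-self G _)) z≤n
  retract-dist (suc k) {zero} (suc x , refl , q) = ≤-trans (retract-dist k q) (n≤1+n k)
  retract-dist (suc k) {suc u} (zero , refl , q) = ≤-trans (retract-dist k q) (n≤1+n k)
  retract-dist (suc k) {suc u} (suc x , a , q) = ≤-trans (dist-adj G conn _ a) (s≤s (retract-dist k q))

  dist-old : ∀ u w → distance G′ (suc u) (suc w) ≡ distance G u w
  dist-old u w = ≤-antisym (dist-minimal G′ (walk-suc _ (dist-walk G conn u w)))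
      (retract-dist _ (dist-walk G′ connected (suc u) (suc w)))

  dist-new : ∀ w → distance G′ zero (suc w) ≡ suc (distance G v w)
  dist-new w = ≤-antisym (dist-minimal G′ (suc v , refl , walk-suc _ (dist-walk G conn v w)))
      (low _ (dist-walk G′ connected zero (suc w)))
    where
    low : ∀ k → Walk G′ k zero (suc w) → suc (distance G v w) ≤ k
    low (suc k) (suc x , refl , q) = s≤s (retract-dist k q)

  dist-new′ : ∀ u → distance G′ (suc u) zero ≡ suc (distance G u v)
  dist-new′ u = trans (dist-sym G′ connected (suc u) zero)
      (trans (dist-new u) (cong suc (dist-sym G conn v u)))

  nearer-old : ∀ x u w → nearer G′ (suc x) (suc u) (suc w) ≡ nearer G x u w
  nearer-old x u w = cong₂ (λ i j → ⟦ i ℕₚ.<? j ⟧) (dist-old x u) (dist-old x w)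

  nearer-new : ∀ u w → nearer G′ zero (suc u) (suc w) ≡ nearer G v u w
  nearer-new u w = trans (cong₂ (λ i j → ⟦ i ℕₚ.<? j ⟧) (dist-new u) (dist-new w))
      (⟦⟧-cong (suc (distance G v u) ℕₚ.<? suc (distance G v w)) (distance G v u ℕₚ.<? distance G v w) s≤s⁻¹
      s≤s)

  nearer-root : ∀ x → nearer G′ (suc x) (suc v) zero ≡ 1
  nearer-root x = ⟦⟧-yes (distance G′ (suc x) (suc v) ℕₚ.<? distance G′ (suc x) zero)
      (≤-reflexive (trans (cong suc (dist-old x v)) (sym (dist-new′ x))))

  nearer-leaf : ∀ x → nearer G′ (suc x) zero (suc v) ≡ 0
  nearer-leaf x = ⟦⟧-no (distance G′ (suc x) zero ℕₚ.<? distance G′ (suc x) (suc v))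
    (<⇒≯ (≤-reflexive (trans (cong suc (dist-old x v)) (sym (dist-new′ x)))))

  leaf-nearer : nearer G′ zero zero (suc v) ≡ 1
  leaf-nearer = ⟦⟧-yes (distance G′ zero zero ℕₚ.<? distance G′ zero (suc v))
      (≤-trans (s≤s (≤-reflexive (dist-self G′ zero))) (≤-trans (s≤s z≤n) (≤-reflexive (sym (dist-new v)))))

  leaf-nearer′ : nearer G′ zero (suc v) zero ≡ 0
  leaf-nearer′ = ⟦⟧-no (distance G′ zero (suc v) ℕₚ.<? distance G′ zero zero)
      (λ q → n≮0 (≤-trans q (≤-reflexive (dist-self G′ zero))))

  -- An old vertex reaches the new edge first at `v`, so this edge lies on the same side as `v`.
  closerTo-old : ∀ u w → closerTo G′ (suc u) (suc w) ≡ nearer G v u w + closerTo G u w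
  closerTo-old u w = trans (∑ᴱ-attach _) (cong₂ _+_
    (cong₂ (λ i j → ⟦ i ℕₚ.<? j ⟧) (new u) (new w))
    (∑ᴱ-cong G λ a b → cong₂ (λ i j → ⟦ i ℕₚ.<? j ⟧) (cong₂ _⊓_ (dist-old a u) (dist-old b u))
        (cong₂ _⊓_ (dist-old a w) (dist-old b w))))
    where
    new : ∀ u → distance G′ zero (suc u) ⊓ distance G′ (suc v) (suc u) ≡ distance G v u
    new u = trans (cong₂ _⊓_ (dist-new u) (dist-old v u)) (m≥n⇒m⊓n≡n (n≤1+n _))

  dist-edge-leaf : ∀ a b → distance G′ (suc a) zero ⊓ distance G′ (suc b) zero ≡ suc
      (distance G a v ⊓ distance G b v)
  dist-edge-leaf a b = cong₂ _⊓_ (dist-new′ a) (dist-new′ b)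

  closerTo-leaf : closerTo G′ zero (suc v) ≡ 0
  closerTo-leaf = trans (∑ᴱ-attach _) (cong₂ _+_
    (⟦⟧-no (_ ℕₚ.<? _) (λ q → n≮0 (≤-trans q (≤-trans (m⊓n≤n (distance G′ zero (suc v)) _)
        (≤-reflexive (dist-self G′ (suc v)))))))
    (∑ᴱ-zero G λ a b → ⟦⟧-no (_ ℕₚ.<? _) (<⇒≯ (≤-reflexive
        (trans (cong suc (cong₂ _⊓_ (dist-old a v) (dist-old b v))) (sym (dist-edge-leaf a b)))))))

  closerTo-root : closerTo G′ (suc v) zero ≡ size G
  closerTo-root = trans (∑ᴱ-attach _) (trans (cong₂ _+_
    (⟦⟧-no (_ ℕₚ.<? _) (λ q → n≮0 (≤-trans q (≤-trans (m⊓n≤m (distance G′ zero zero) _)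
        (≤-reflexive (dist-self G′ zero))))))
    (∑ᴱ-cong G λ a b → ⟦⟧-yes (_ ℕₚ.<? _) (≤-reflexive (trans
        (cong suc (cong₂ _⊓_ (dist-old a v) (dist-old b v))) (sym (dist-edge-leaf a b))))))
    (sym (size-∑ G)))

  size-attach : size G′ ≡ suc (size G)
  size-attach = trans (size-∑ G′) (trans (∑ᴱ-attach _) (cong suc (sym (size-∑ G))))

  separators-old : ∀ x y → separators G′ (suc x) (suc y) ≡ separators G x y
  separators-old x y = trans (∑ᴱ-attach _) (cong₂ _+_
    (cong₂ _+_ (cong (_* nearer G′ (suc y) (suc v) zero) (nearer-leaf x))
        (cong₂ _*_ (nearer-root x) (nearer-leaf y)))
    (∑ᴱ-cong G λ u w → cong₂ _+_ (cong₂ _*_ (nearer-old x u w) (nearer-old y w u))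
        (cong₂ _*_ (nearer-old x w u) (nearer-old y u w))))

  separators-new : ∀ y → separators G′ zero (suc y) ≡ suc (separators G v y)
  separators-new y = trans (∑ᴱ-attach _) (cong₂ _+_
    (cong₂ _+_ (cong₂ _*_ leaf-nearer (nearer-root y)) (cong (_* nearer G′ (suc y) zero (suc v))
        leaf-nearer′))
    (∑ᴱ-cong G λ u w → cong₂ _+_ (cong₂ _*_ (nearer-new u w) (nearer-old y w u))
        (cong₂ _*_ (nearer-new w u) (nearer-old y u w))))

  separators-new′ : ∀ x → separators G′ (suc x) zero ≡ suc (separators G x v)
  separators-new′ x = trans (∑ᴱ-attach _) (cong₂ _+_
    (cong₂ _+_ (cong (_* nearer G′ zero (suc v) zero) (nearer-leaf x))
        (cong₂ _*_ (nearer-root x) leaf-nearer))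
    (∑ᴱ-cong G λ u w → cong₂ _+_ (cong₂ _*_ (nearer-old x u w) (nearer-new w u))
        (cong₂ _*_ (nearer-old x w u) (nearer-new u w))))

  -- The pendent edge has no edge on the leaf's side and contributes 0. For an old edge the sides x
  -- and y become i + x and j + y, where i and j tell on which side `v` lies; i j = 0 leaves x y + i
  -- y + j x.
  Sz-attach : edgeSzeged G′ ≡ edgeSzeged G + farSum G v
  Sz-attach = begin
    edgeSzeged G′ ≡⟨ trans (Sz≡ G′) (∑ᴱ-attach _) ⟩
    closerTo G′ zero (suc v) * closerTo G′ (suc v) zero + ∑ᴱ G
        (λ u w → closerTo G′ (suc u) (suc w) * closerTo G′ (suc w) (suc u))
      ≡⟨ cong₂ _+_ (cong (_* closerTo G′ (suc v) zero) closerTo-leaf)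
          (∑ᴱ-cong G λ u w → trans (cong₂ _*_ (closerTo-old u w) (closerTo-old w u))
          (expand (nearer G v u w) (nearer G v w u) _ _ (nearer-exclusive G v u w))) ⟩
    ∑ᴱ G (λ u w → closerTo G u w * closerTo G w u + (nearer G v u w * closerTo G w u + nearer G v w u *
        closerTo G u w)) ≡⟨ ∑ᴱ-+ G _ _ ⟩
    ∑ᴱ G (λ u w → closerTo G u w * closerTo G w u) + farSum G v ≡⟨ cong (_+ farSum G v) (Sz≡ G) ⟨
    edgeSzeged G + farSum G v ∎
    where
    open ≡-Reasoning
    expand : ∀ i j x y → i * j ≡ 0 → (i + x) * (j + y) ≡ x * y + (i * y + j * x)
    expand i j x y e = trans (ring i j x y) (cong (_+ (x * y + (i * y + j * x))) e)
      where
      ring : ∀ i j x y → (i + x) * (j + y) ≡ i * j + (x * y + (i * y + j * x))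
      ring = solve-∀

  farSum-new : farSum G′ zero ≡ size G + farSum G v
  farSum-new = trans (∑ᴱ-attach _) (cong₂ _+_
    (trans (cong₂ _+_ (cong₂ _*_ leaf-nearer closerTo-root) (cong (_* closerTo G′ zero (suc v)) leaf-nearer′))
        (trans (+-identityʳ _) (+-identityʳ _)))
    (∑ᴱ-cong G λ u w → cong₂ _+_
      (trans (cong₂ _*_ (nearer-new u w) (closerTo-old w u))
          (drop (nearer G v u w) (nearer G v w u) _ (nearer-exclusive G v u w)))
      (trans (cong₂ _*_ (nearer-new w u) (closerTo-old u w))
          (drop (nearer G v w u) (nearer G v u w) _ (nearer-exclusive G v w u)))))
    where
    drop : ∀ i j x → i * j ≡ 0 → i * (j + x) ≡ i * x
    drop i j x e = trans (*-distribˡ-+ i j x) (cong (_+ i * x) e)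

  -- The new edge joins the side away from `x` exactly for the old edges that separate `x` from `v`;
  -- beyond the pendent edge itself there is nothing.
  farSum-old : ∀ x → farSum G′ (suc x) ≡ farSum G x + separators G x v
  farSum-old x = trans (∑ᴱ-attach _) (trans (cong₂ _+_
    (cong₂ _+_ (cong (_* closerTo G′ (suc v) zero) (nearer-leaf x)) (cong₂ _*_ (nearer-root x) closerTo-leaf))
    (trans (∑ᴱ-cong G λ u w → trans (cong₂ _+_ (cong₂ _*_ (nearer-old x u w) (closerTo-old w u))
        (cong₂ _*_ (nearer-old x w u) (closerTo-old u w)))
      (regroup (nearer G x u w) (nearer G x w u) (nearer G v w u) (nearer G v u w) (closerTo G w u)
          (closerTo G u w))) (∑ᴱ-+ G _ _))) refl)
    where
    regroup : ∀ i j k l x y → i * (k + x) + j * (l + y) ≡ (i * x + j * y) + (i * k + j * l)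
    regroup = solve-∀

Ecc : Graph n → Fin n → ℕ → Set
Ecc G x ε = ∀ w → distance G x w ≤ ε

Diam : Graph n → ℕ → Set
Diam G Δ = ∀ u w → distance G u w ≤ Δ

module _ {G : Graph n} (conn : Connected G) {v : Fin n} where

  open Attach G conn v

  ecc-new : ∀ {ε} → Ecc G v ε → Ecc (attachVertex G v) zero (suc ε)
  ecc-new h zero = ≤-trans (≤-reflexive (dist-self (attachVertex G v) zero)) z≤n
  ecc-new h (suc w) = ≤-trans (≤-reflexive (dist-new w)) (s≤s (h w))

  ecc-old : ∀ {x ε} → Ecc G x ε → suc (distance G x v) ≤ ε → Ecc (attachVertex G v) (suc x) ε
  ecc-old {x} h le zero = ≤-trans (≤-reflexive (dist-new′ x)) le
  ecc-old {x} h le (suc w) = ≤-trans (≤-reflexive (dist-old x w)) (h w)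

  diam-attach : ∀ {Δ ε} → Diam G Δ → Ecc G v ε → suc ε ≤ Δ → Diam (attachVertex G v) Δ
  diam-attach h e le zero w = ≤-trans (ecc-new e w) le
  diam-attach h e le (suc u) w = ecc-old (h u) (≤-trans (s≤s
      (≤-trans (≤-reflexive (dist-sym G conn u v)) (e u))) le) w

-- The quantities are carried together because their recursions interlock: the index needs `farSum`
-- at the end of the path, which needs the size, while `farSum` at an old vertex needs `separators`.
record PathStats {m} (H : Graph m) (v : Fin m) (i : ℕ) : Set where
  private
    G : Graph (i + m)
    G = attachPath i H v
    end : Fin (i + m)
    end = pathEnd i v
  field
    connected   : Connected G
    size≡       : size G ≡ i + size H
    sep-end-old : ∀ x → separators G end (i ↑ʳ x) ≡ i + separators H v x
    sep-old-end : ∀ x → separators G (i ↑ʳ x) end ≡ i + separators H x v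
    sep-old     : ∀ x y → separators G (i ↑ʳ x) (i ↑ʳ y) ≡ separators H x y
    far-end     : farSum G end ≡ farSum H v + Σ< i (λ l → l + size H)
    far-old     : ∀ x → farSum G (i ↑ʳ x) ≡ farSum H x + Σ< i (λ l → l + separators H x v)
    Sz          : edgeSzeged G ≡ edgeSzeged H + Σ< i (λ l → farSum H v + Σ< l (λ l → l + size H))
    dist-end    : ∀ x → distance G end (i ↑ʳ x) ≡ i + distance H v x
    dist-old    : ∀ x y → distance G (i ↑ʳ x) (i ↑ʳ y) ≡ distance H x y
    ecc-end     : ∀ {ε} → Ecc H v ε → Ecc G end (i + ε)
    ecc         : ∀ {x ε} → Ecc H x ε → i + distance H x v ≤ ε → Ecc G (i ↑ʳ x) ε
    diam        : ∀ {Δ ε} → Diam H Δ → Ecc H v ε → i + ε ≤ Δ → Diam G Δ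

path-stats : {H : Graph m} → Connected H → ∀ v i → PathStats H v i
path-stats conn v zero = record
  { connected = conn ; size≡ = refl ; sep-end-old = λ _ → refl ; sep-old-end = λ _ → refl ; sep-old = λ _ _ →
      refl
  ; far-end = sym (+-identityʳ _) ; far-old = λ _ → sym (+-identityʳ _) ; Sz = sym (+-identityʳ _)
  ; dist-end = λ _ → refl ; dist-old = λ _ _ → refl ; ecc-end = id ; ecc = λ h _ → h ; diam = λ h _ _ → h }
path-stats {H = H} conn v (suc i) = record
  { connected = A.connected
  ; size≡ = trans A.size-attach (cong suc size≡)
  ; sep-end-old = λ x → trans (A.separators-new _) (cong suc (sep-end-old x))
  ; sep-old-end = λ x → trans (A.separators-new′ _) (cong suc (sep-old-end x))
  ; sep-old = λ x y → trans (A.separators-old _ _) (sep-old x y)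
  ; far-end = trans A.farSum-new (trans (cong₂ _+_ size≡ far-end)
      (trans (shuffle (i + size H) (farSum H v) (Σ< i (λ l → l + size H)))
      (cong (farSum H v +_) (sym (Σ<-last i (λ l → l + size H))))))
  ; far-old = λ x → trans (A.farSum-old _) (trans (cong₂ _+_ (far-old x) (sep-old-end x))
      (trans (+-assoc (farSum H x) _ _) (cong (farSum H x +_)
      (sym (Σ<-last i (λ l → l + separators H x v))))))
  ; Sz = trans A.Sz-attach (trans (cong₂ _+_ Sz far-end)
      (trans (+-assoc (edgeSzeged H) _ _) (cong (edgeSzeged H +_)
      (sym (Σ<-last i (λ l → farSum H v + Σ< l (λ l → l + size H)))))))
  ; dist-end = λ x → trans (A.dist-new _) (cong suc (dist-end x))
  ; dist-old = λ x y → trans (A.dist-old _ _) (dist-old x y)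
  ; ecc-end = λ h → ecc-new connected (ecc-end h)
  ; ecc = λ {x} h le → ecc-old connected (ecc h (≤-trans (n≤1+n _) le))
      (≤-trans (≤-reflexive (cong suc (trans (dist-sym _ connected _ _)
          (trans (dist-end x) (cong (i +_) (dist-sym H conn v x)))))) le)
  ; diam = λ h e le → diam-attach connected (diam h e (≤-trans (n≤1+n _) le)) (ecc-end e) le
  }
  where
  open PathStats (path-stats {H = H} conn v i)
  module A = Attach (attachPath i H v) connected (pathEnd i v)
  shuffle : ∀ a b c → a + (b + c) ≡ b + (c + a)
  shuffle = solve-∀

record PendantStats {m} (H : Graph m) (v : Fin m) (i : ℕ) : Set where
  private
    G : Graph (i + m)
    G = attachPendants i H v
  field
    connected : Connected G
    size≡     : size G ≡ i + size H
    sep-root  : separators G (i ↑ʳ v) (i ↑ʳ v) ≡ 0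
    far-root  : farSum G (i ↑ʳ v) ≡ farSum H v
    Sz        : edgeSzeged G ≡ edgeSzeged H + i * farSum H v
    dist-old  : ∀ x y → distance G (i ↑ʳ x) (i ↑ʳ y) ≡ distance H x y
    ecc-root  : ∀ {ε} → 1 ≤ ε → Ecc H v ε → Ecc G (i ↑ʳ v) ε
    diam      : ∀ {Δ ε} → 1 ≤ ε → Diam H Δ → Ecc H v ε → suc ε ≤ Δ → Diam G Δ

pendant-stats : {H : Graph m} → Connected H → ∀ v i → PendantStats H v i
pendant-stats {H = H} conn v zero = record
  { connected = conn ; size≡ = refl ; sep-root = separators-self H v ; far-root = refl ; Sz = sym
      (+-identityʳ _)
  ; dist-old = λ _ _ → refl ; ecc-root = λ _ h → h ; diam = λ _ h _ _ → h }
pendant-stats {H = H} conn v (suc i) = record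
  { connected = A.connected
  ; size≡ = trans A.size-attach (cong suc size≡)
  ; sep-root = trans (A.separators-old _ _) sep-root
  ; far-root = trans (A.farSum-old _) (trans (cong₂ _+_ far-root sep-root) (+-identityʳ _))
  ; Sz = trans A.Sz-attach (trans (cong₂ _+_ Sz far-root)
      (trans (+-assoc (edgeSzeged H) _ _) (cong (edgeSzeged H +_) (+-comm (i * farSum H v) _))))
  ; dist-old = λ x y → trans (A.dist-old _ _) (dist-old x y)
  ; ecc-root = λ 1≤ε h → ecc-old connected (ecc-root 1≤ε h) (≤-trans (s≤s (≤-reflexive (dist-self _ _))) 1≤ε)
  ; diam = λ 1≤ε h e le → diam-attach connected (diam 1≤ε h e le) (ecc-root 1≤ε e) le
  }
  where
  open PendantStats (pendant-stats {H = H} conn v i)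
  module A = Attach (attachPendants i H v) connected (i ↑ʳ v)

triangle-connected : Connected triangle
triangle-connected zero zero = 0 , refl
triangle-connected zero (suc zero) = 1 , _ , (λ ()) , refl
triangle-connected zero (suc (suc zero)) = 1 , _ , (λ ()) , refl
triangle-connected (suc zero) zero = 1 , _ , (λ ()) , refl
triangle-connected (suc zero) (suc zero) = 0 , refl
triangle-connected (suc zero) (suc (suc zero)) = 1 , _ , (λ ()) , refl
triangle-connected (suc (suc zero)) zero = 1 , _ , (λ ()) , refl
triangle-connected (suc (suc zero)) (suc zero) = 1 , _ , (λ ()) , refl
triangle-connected (suc (suc zero)) (suc (suc zero)) = 0 , refl

opaque
  -- The values on three vertices are found by evaluation, for which distances and sums must
  -- compute.
  unfolding distance ∑

  triangle-far₀ : farSum triangle zero ≡ 2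
  triangle-far₀ = refl

  triangle-far₁ : farSum triangle (suc zero) ≡ 2
  triangle-far₁ = refl

  triangle-sep₀₁ : separators triangle zero (suc zero) ≡ 1
  triangle-sep₀₁ = refl

  triangle-sep₁₀ : separators triangle (suc zero) zero ≡ 1
  triangle-sep₁₀ = refl

  triangle-dist₀₁ : distance triangle zero (suc zero) ≡ 1
  triangle-dist₀₁ = refl

  triangle-dist₁₀ : distance triangle (suc zero) zero ≡ 1
  triangle-dist₁₀ = refl

  triangle-diam : Diam triangle 1
  triangle-diam zero zero = z≤n
  triangle-diam zero (suc zero) = s≤s z≤n
  triangle-diam zero (suc (suc zero)) = s≤s z≤n
  triangle-diam (suc zero) zero = s≤s z≤n
  triangle-diam (suc zero) (suc zero) = z≤n
  triangle-diam (suc zero) (suc (suc zero)) = s≤s z≤n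
  triangle-diam (suc (suc zero)) zero = s≤s z≤n
  triangle-diam (suc (suc zero)) (suc zero) = s≤s z≤n
  triangle-diam (suc (suc zero)) (suc (suc zero)) = z≤n

-- This is i choose 2, and `Σ< i Σid` is i choose 3. Neither is evaluated: both the index and the
-- lower bound are linear in them, so the final comparison is a polynomial identity.
Σid : ℕ → ℕ
Σid i = Σ< i id

Σ<-const : ∀ i x → Σ< i (λ _ → x) ≡ i * x
Σ<-const zero x = refl
Σ<-const (suc i) x = cong (x +_) (Σ<-const i x)

Σ<-shift : ∀ i x → Σ< i (λ l → l + x) ≡ Σid i + i * x
Σ<-shift i x = trans (Σ<-+ i id (λ _ → x)) (cong (Σid i +_) (Σ<-const i x))

Σ<-* : ∀ i x (g : ℕ → ℕ) → Σ< i (λ l → g l * x) ≡ Σ< i g * x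
Σ<-* zero x g = refl
Σ<-* (suc i) x g = trans (cong (g 0 * x +_) (Σ<-* i x (g ∘ suc))) (sym (*-distribʳ-+ x (g 0) _))

module _ (p a b : ℕ) where

  private
    v₁ v₂ : Fin 3
    v₁ = zero
    v₂ = suc zero
    module A = PathStats (path-stats triangle-connected v₁ a)
    module B = PathStats (path-stats A.connected (a ↑ʳ v₂) b)
    module P = PendantStats (pendant-stats B.connected (b ↑ʳ (a ↑ʳ v₁)) p)

  C₃-connected : Connected (C₃ p a b)
  C₃-connected = P.connected

  C₃-size : size (C₃ p a b) ≡ p + (b + (a + 3))
  C₃-size = trans P.size≡ (cong (p +_) (trans B.size≡ (cong (b +_) A.size≡)))

  C₃-diam : 1 ≤ a → 1 ≤ b → Diam (C₃ p a b) (suc (a + b))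
  C₃-diam 1≤a 1≤b = P.diam {ε = a + b} (≤-trans 1≤a (m≤m+n a b))
    (B.diam {ε = suc a} (λ u w → ≤-trans (A.diam {ε = 1} (λ u w → ≤-trans (triangle-diam u w) (s≤s z≤n))
        (triangle-diam v₁) (≤-reflexive (+-comm a 1)) u w) (s≤s (m≤m+n a b))) ecc₂
        (≤-reflexive (trans (+-suc b a) (cong suc (+-comm b a)))))
    (B.ecc (λ w → ≤-trans (ecc₁ w) (m≤m+n a b)) (≤-trans
        (≤-reflexive (cong (b +_) (trans (A.dist-old v₁ v₂) triangle-dist₀₁)))
        (≤-trans (≤-reflexive (+-comm b 1)) (+-monoˡ-≤ b 1≤a))))
    ≤-refl
    where
    ecc₂ : Ecc (attachPath a triangle v₁) (a ↑ʳ v₂) (suc a)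
    ecc₂ = A.ecc (λ w → ≤-trans (triangle-diam v₂ w) (s≤s z≤n))
        (≤-reflexive (trans (cong (a +_) triangle-dist₁₀) (+-comm a 1)))
    ecc₁ : Ecc (attachPath a triangle v₁) (a ↑ʳ v₁) a
    ecc₁ = A.ecc (λ w → ≤-trans (triangle-diam v₁ w) 1≤a)
        (≤-reflexive (trans (cong (a +_) (dist-self triangle v₁)) (+-identityʳ a)))

  C₃-far : ∃[ u ] ∃[ w ] distance (C₃ p a b) u w ≡ suc (a + b)
  C₃-far = p ↑ʳ pathEnd b (a ↑ʳ v₂) , p ↑ʳ (b ↑ʳ pathEnd a v₁) , (begin
    distance (C₃ p a b) (p ↑ʳ pathEnd b (a ↑ʳ v₂)) (p ↑ʳ (b ↑ʳ pathEnd a v₁)) ≡⟨ P.dist-old _ _ ⟩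
    distance (attachPath b (attachPath a triangle v₁) (a ↑ʳ v₂)) (pathEnd b (a ↑ʳ v₂)) (b ↑ʳ pathEnd a v₁)
        ≡⟨ B.dist-end (pathEnd a v₁) ⟩
    b + distance (attachPath a triangle v₁) (a ↑ʳ v₂) (pathEnd a v₁)
        ≡⟨ cong (b +_) (dist-sym _ A.connected (a ↑ʳ v₂) (pathEnd a v₁)) ⟩
    b + distance (attachPath a triangle v₁) (pathEnd a v₁) (a ↑ʳ v₂) ≡⟨ cong (b +_) (A.dist-end v₂) ⟩
    b + (a + distance triangle v₁ v₂) ≡⟨ cong (λ x → b + (a + x)) triangle-dist₀₁ ⟩
    b + (a + 1) ≡⟨ shuffle a b ⟩
    suc (a + b) ∎)
    where
    open ≡-Reasoning
    shuffle : ∀ a b → b + (a + 1) ≡ suc (a + b)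
    shuffle = solve-∀

  -- The summands come from the triangle with its first path, from the second path, and from the
  -- pendent vertices. Each of the latter adds the same `farSum` of v₁, which pendent vertices at v₁
  -- do not change.
  C₃-Sz : edgeSzeged (C₃ p a b) ≡
    3 + 2 * a + 3 * Σid a + Σ< a Σid + (2 * b + a * b + b * Σid a + (3 + a) * Σid b + Σ< b Σid) + p *
        (2 + Σid a + Σid b + b)
  C₃-Sz = trans P.Sz (cong₂ _+_ (trans B.Sz (cong₂ _+_ Sz-A Sz-B)) (cong (p *_) far-B))
    where
    open ≡-Reasoning
    inner : ∀ i x y → Σ< i (λ l → y + Σ< l (λ l → l + x)) ≡ i * y + (Σ< i Σid + Σid i * x)
    inner i x y = trans (Σ<-+ i (λ _ → y) _) (cong₂ _+_ (Σ<-const i y)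
        (trans (Σ<-cong i (λ {l} _ → Σ<-shift l x)) (trans (Σ<-+ i Σid (λ l → l * x))
        (cong (Σ< i Σid +_) (Σ<-* i x id)))))
    Sz-A : edgeSzeged (attachPath a triangle v₁) ≡ 3 + 2 * a + 3 * Σid a + Σ< a Σid
    Sz-A = trans A.Sz (trans (cong (3 +_) (inner a 3 (farSum triangle v₁)))
        (trans (cong (λ x → 3 + (a * x + (Σ< a Σid + Σid a * 3))) triangle-far₀) (ring a (Σid a) (Σ< a Σid))))
      where
      ring : ∀ a s t → 3 + (a * 2 + (t + s * 3)) ≡ 3 + 2 * a + 3 * s + t
      ring = solve-∀
    far-A₂ : farSum (attachPath a triangle v₁) (a ↑ʳ v₂) ≡ 2 + (Σid a + a * 1)
    far-A₂ = trans (A.far-old v₂) (cong₂ _+_ triangle-far₁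
        (trans (cong (λ x → Σ< a (λ l → l + x)) triangle-sep₁₀) (Σ<-shift a 1)))
    Sz-B : Σ< b (λ l → farSum (attachPath a triangle v₁) (a ↑ʳ v₂) + Σ< l
        (λ l → l + size (attachPath a triangle v₁))) ≡
      2 * b + a * b + b * Σid a + (3 + a) * Σid b + Σ< b Σid
    Sz-B = trans (inner b _ _) (trans (cong₂ (λ x y → b * x + (Σ< b Σid + Σid b * y)) far-A₂ A.size≡)
        (ring a b (Σid a) (Σid b) (Σ< b Σid)))
      where
      ring : ∀ a b s t u → b * (2 + (s + a * 1)) + (u + t * (a + 3)) ≡ 2 * b + a * b + b * s + (3 + a) * t + u
      ring = solve-∀
    far-B : farSum (attachPath b (attachPath a triangle v₁) (a ↑ʳ v₂)) (b ↑ʳ (a ↑ʳ v₁)) ≡ 2 + Σid a + Σid b +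
        b
    far-B = trans (B.far-old (a ↑ʳ v₁)) (trans (cong₂ _+_
      (trans (A.far-old v₁) (cong₂ _+_ triangle-far₀ (trans
          (cong (λ x → Σ< a (λ l → l + x)) (separators-self triangle v₁)) (Σ<-shift a 0))))
      (trans (cong (λ x → Σ< b (λ l → l + x)) (trans (A.sep-old v₁ v₂) triangle-sep₀₁)) (Σ<-shift b 1)))
      (ring (Σid a) (Σid b) a b))
      where
      ring : ∀ s t a b → 2 + (s + a * 0) + (t + b * 1) ≡ 2 + s + t + b
      ring = solve-∀

-- The diameter as a maximum that is attained

private
  distances : Graph n → List ℕ
  distances {n} G = map (uncurry (dist G)) (cartesianProduct (allFin n) (allFin n))

  ∈-distances : ∀ {G : Graph n} {x} → x ∈ distances G → ∃[ u ] ∃[ w ] x ≡ distance G u w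
  ∈-distances {G = G} x∈ = let (u , w) , _ , q = ∈-map⁻ (uncurry (dist G)) x∈ in u , w , trans q (sym (dist≡ G u w))

diameter-≡ : {G : Graph n} → Diam G m → (∃[ u ] ∃[ w ] distance G u w ≡ m) → diameter G ≡ m
diameter-≡ {n} {m} {G} h (u , w , e) = ≤-antisym
  (max≤v⁺ {xs = distances G} z≤n (All.tabulate λ x∈ → let u , w , q = ∈-distances {G = G} x∈ in ≤-trans (≤-reflexive q) (h u w)))
  (v≤max⁺ 0 (distances G) (inj₂ (Any.map (λ q → ≤-reflexive (trans (sym e) (trans (dist≡ G u w) q)))
    (∈-map⁺ (uncurry (dist G)) (∈-cartesianProduct⁺ (∈-allFin u) (∈-allFin w))))))

diametral-pair : {G : Graph n} → diameter G ≡ suc m → ∃[ u ] ∃[ w ] distance G u w ≡ suc m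
diametral-pair {G = G} e with argmax-sel id 0 (distances G)
-- The default 0 of `max` is excluded because the diameter is positive.
... | inj₁ z = contradiction (trans (sym e) z) λ ()
... | inj₂ x∈ = let u , w , q = ∈-distances {G = G} x∈ in u , w , trans (sym q) e

-- For n = i + M + 1 the summand is l (i - l + M). The sum of l (i - l) over l < i is i + 1 choose
-- 3, split by Pascal's rule into the two unevaluated coefficients.
Σ<-f : ∀ i M → Σ< i (f (suc (i + M))) ≡ Σ< i Σid + Σid i + Σid i * M
Σ<-f i M = begin
  Σ< i (f (suc (i + M)))                     ≡⟨ Σ<-cong i
      (λ {l} l<i → f-at (i ∸ l + M) (cong suc (trans (cong (_+ M) (sym (m+[n∸m]≡n (<⇒≤ l<i))))
      (+-assoc l (i ∸ l) M)))) ⟩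
  Σ< i (λ l → l * (i ∸ l + M))               ≡⟨ Σ<-cong i (λ {l} _ → *-distribˡ-+ l (i ∸ l) M) ⟩
  Σ< i (λ l → l * (i ∸ l) + l * M)           ≡⟨ Σ<-+ i (λ l → l * (i ∸ l)) (λ l → l * M) ⟩
  Σ< i (λ l → l * (i ∸ l)) + Σ< i (λ l → l * M) ≡⟨ cong₂ _+_ (products i) (Σ<-* i M id) ⟩
  Σ< i Σid + Σid i + Σid i * M ∎
  where
  open ≡-Reasoning
  products : ∀ i → Σ< i (λ l → l * (i ∸ l)) ≡ Σ< i Σid + Σid i
  products zero = refl
  products (suc i) = begin
    Σ< (suc i) (λ l → l * (suc i ∸ l)) ≡⟨ Σ<-last i (λ l → l * (suc i ∸ l)) ⟩
    Σ< i (λ l → l * (suc i ∸ l)) + i * (suc i ∸ i) ≡⟨ cong₂ _+_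
        (trans (Σ<-cong i (λ {l} l<i → trans (cong (l *_) (+-∸-assoc 1 (<⇒≤ l<i))) (*-suc l (i ∸ l))))
        (Σ<-+ i id (λ l → l * (i ∸ l)))) (trans (cong (i *_) (m+n∸n≡m 1 i)) (*-identityʳ i)) ⟩
    Σid i + Σ< i (λ l → l * (i ∸ l)) + i ≡⟨ cong (λ x → Σid i + x + i) (products i) ⟩
    Σid i + (Σ< i Σid + Σid i) + i ≡⟨ shuffle (Σid i) (Σ< i Σid) i ⟩
    (Σ< i Σid + Σid i) + (Σid i + i) ≡⟨ cong₂ _+_ (Σ<-last i Σid) (Σ<-last i id) ⟨
    Σ< (suc i) Σid + Σid (suc i) ∎
    where
    shuffle : ∀ s t i → s + (t + s) + i ≡ (t + s) + (s + i)
    shuffle = solve-∀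

-- Comparison of the extremal graph with the lower bound

module _ (p a b : ℕ) (1≤b : 1 ≤ b) (b≤a : b ≤ a) (a≤ : a ≤ suc b) (6≤n : 6 ≤ p + (b + (a + 3))) where

  private
    N e D : ℕ
    N = p + (b + (a + 3))
    e = a + b
    D = 2 * p + 2 * a + 3

  sizes : Target.Sizes N e b (suc D)
  sizes = record
    { e≤ = +-monoˡ-≤ b a≤
    ; 1≤b = 1≤b
    ; e+2≤n = slack (p + 1) (e₁ p a b)
    ; 6≤n = 6≤n
    ; 2b+3≤n = ≤-trans (≤-trans (≤-reflexive (e₂ b)) (+-monoʳ-≤ b (+-monoˡ-≤ 3 b≤a))) (m≤n+m _ p)
    ; D≡ = e₃ p a b
    }
    where
    e₁ : ∀ p a b → p + (b + (a + 3)) ≡ 2 + (a + b) + (p + 1)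
    e₁ = solve-∀
    e₂ : ∀ b → 2 * b + 3 ≡ b + (b + 3)
    e₂ = solve-∀
    e₃ : ∀ p a b → suc (2 * p + 2 * a + 3) + (2 * b + 2) ≡ 2 * (p + (b + (a + 3)))
    e₃ = solve-∀

  -- Since b ≤ a ≤ b + 1, the minimum of i and e - i runs through 0, ..., a - 1 and then through b,
  -- ..., 0.
  Φ≡ : Σ< (suc e) (Target.term N e b (suc D)) ≡ Σ< a (f N) + (Σ< b (f N) + f N b)
  Φ≡ = begin
    Σ< (suc e) term ≡⟨ cong (λ x → Σ< x term) (+-suc a b) ⟨
    Σ< (a + suc b) term ≡⟨ Σ<-split a (suc b) term ⟩
    Σ< a term + Σ< (suc b) (λ i → term (a + i)) ≡⟨ cong₂ _+_ (Σ<-cong a near)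
        (trans (Σ<-cong (suc b) far) (trans (Σ<-reverse (suc b) (f N)) (Σ<-last b (f N)))) ⟩
    Σ< a (f N) + (Σ< b (f N) + f N b) ∎
    where
    open ≡-Reasoning
    open Target N e b (suc D) using (term)
    near : ∀ {i} → i < a → term i ≡ f N i
    near {i} i<a = cong (f N) (m≤n⇒m⊓n≡m (m+n≤o⇒m≤o∸n i (+-mono-≤ (<⇒≤ i<a) (s≤s⁻¹ (≤-trans i<a a≤)))))
    far : ∀ {i} → i < suc b → term (a + i) ≡ f N (suc b ∸ suc i)
    far {i} i≤b = cong (f N) (trans (cong ((a + i) ⊓_) ([m+n]∸[m+o]≡n∸o a b i))
        (m≥n⇒m⊓n≡n (≤-trans (m∸n≤m b i) (≤-trans b≤a (m≤m+n a i)))))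

  -- The excess 2p + 2a + 3 is 2n - 3 - 2b without subtraction, as n = p + b + a + 3. So the
  -- extremal graph meets the bound of the second alternative in `Dichotomy` exactly.
  Sz-C₃ : edgeSzeged (C₃ p a b) ≡ Σ< (suc e) (Target.term N e b (suc D)) + D
  Sz-C₃ = trans (C₃-Sz p a b) (sym (trans (cong (_+ D) (trans Φ≡ (cong₂ _+_ sum-a (cong₂ _+_ sum-b at-b))))
    (ring p a b (Σid a) (Σid b) (Σ< a Σid) (Σ< b Σid))))
    where
    e₁ : ∀ p a b → p + (b + (a + 3)) ≡ suc (a + (p + b + 2))
    e₁ = solve-∀
    e₂ : ∀ p a b → p + (b + (a + 3)) ≡ suc (b + (p + a + 2))
    e₂ = solve-∀
    sum-a : Σ< a (f N) ≡ Σ< a Σid + Σid a + Σid a * (p + b + 2)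
    sum-a = trans (cong (λ n → Σ< a (f n)) (e₁ p a b)) (Σ<-f a (p + b + 2))
    sum-b : Σ< b (f N) ≡ Σ< b Σid + Σid b + Σid b * (p + a + 2)
    sum-b = trans (cong (λ n → Σ< b (f n)) (e₂ p a b)) (Σ<-f b (p + a + 2))
    at-b : f N b ≡ b * (p + a + 2)
    at-b = f-at (p + a + 2) (e₂ p a b)
    ring : ∀ p a b s t x y → x + s + s * (p + b + 2) + (y + t + t * (p + a + 2) + b * (p + a + 2)) +
        (2 * p + 2 * a + 3) ≡
      3 + 2 * a + 3 * s + x + (2 * b + a * b + b * s + (3 + a) * t + y) + p * (2 + s + t + b)
    ring = solve-∀

  C₃-diameter : diameter (C₃ p a b) ≡ suc e
  C₃-diameter = diameter-≡ {G = C₃ p a b} (C₃-diam p a b (≤-trans 1≤b b≤a) 1≤b) (C₃-far p a b)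

  minimum : ∀ {k} (H : Graph k) → k ≡ N → Connected H → size H ≡ N → diameter H ≡ suc e →
    edgeSzeged (C₃ p a b) < edgeSzeged H ⊎ (edgeSzeged (C₃ p a b) ≤ edgeSzeged H × H ≅ C₃ p a b)
  minimum H refl conn size≡ diam≡ with diametral-pair {G = H} diam≡
  ... | u , w , d≡ with dichotomy conn e a b D sizes refl a≤ (cycleForest conn size≡ (hasCycle conn size≡ u))
      u w d≡
  ...   | inj₁ le = inj₁ (≤-trans (≤-reflexive (trans (cong suc Sz-C₃) (sym (+-suc _ D)))) le)
  ...   | inj₂ (le , F , ext) = inj₂ (≤-trans (≤-reflexive Sz-C₃) le , extremal-≅ {p} {a} {b} conn F ext)

⌈n/2⌉≤1+⌊n/2⌋ : ∀ n → ⌈ n /2⌉ ≤ suc ⌊ n /2⌋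
⌈n/2⌉≤1+⌊n/2⌋ zero = z≤n
⌈n/2⌉≤1+⌊n/2⌋ (suc zero) = ≤-refl
⌈n/2⌉≤1+⌊n/2⌋ (suc (suc n)) = s≤s (⌈n/2⌉≤1+⌊n/2⌋ n)

theorem1p1 : (n d : ℕ) → 6 ≤ n → 3 ≤ d → d ≤ n ∸ 2 →
    HasMinimumEdgeSzeged n d (extremal n d) ×
    (∀ {m} (G : Graph m) → HasMinimumEdgeSzeged n d G → G ≅ extremal n d)
theorem1p1 n d 6≤n 3≤d d≤n∸2 = extremal-minimum , unique
  where
  p a b : ℕ
  p = n ∸ d ∸ 2
  a = ⌈ d ∸ 1 /2⌉
  b = ⌊ d ∸ 1 /2⌋
  d≡ : suc (a + b) ≡ d
  d≡ = trans (cong suc (trans (+-comm a b) (⌊n/2⌋+⌈n/2⌉≡n (d ∸ 1)))) (m+[n∸m]≡n (≤-trans (s≤s z≤n) 3≤d))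
  n≡ : p + (b + (a + 3)) ≡ n
  n≡ = begin
    p + (b + (a + 3))         ≡⟨ shuffle p a b ⟩
    p + 2 + suc (a + b)       ≡⟨ cong (p + 2 +_) d≡ ⟩
    n ∸ d ∸ 2 + 2 + d         ≡⟨ cong (_+ d) (m∸n+n≡m (m+n≤o⇒m≤o∸n 2
        (≤-trans (≤-reflexive (+-comm 2 d)) d+2≤n))) ⟩
    n ∸ d + d                 ≡⟨ m∸n+n≡m (≤-trans (m≤m+n d 2) d+2≤n) ⟩
    n                         ∎
    where
    open ≡-Reasoning
    shuffle : ∀ p a b → p + (b + (a + 3)) ≡ p + 2 + suc (a + b)
    shuffle = solve-∀
    d+2≤n : d + 2 ≤ n
    d+2≤n = ≤-trans (+-monoˡ-≤ 2 d≤n∸2) (≤-reflexive (m∸n+n≡m (≤-trans (s≤s (s≤s z≤n)) 6≤n)))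
  1≤b : 1 ≤ b
  1≤b = ⌊n/2⌋-mono (∸-monoˡ-≤ 1 3≤d)
  bound : ∀ {k} (H : Graph k) → UnicyclicWithDiameter n d H →
    edgeSzeged (extremal n d) < edgeSzeged H ⊎ (edgeSzeged (extremal n d) ≤ edgeSzeged H × H ≅ extremal n d)
  bound H unicyclic = minimum p a b 1≤b (⌊n/2⌋≤⌈n/2⌉ (d ∸ 1)) (⌈n/2⌉≤1+⌊n/2⌋ (d ∸ 1))
      (≤-trans 6≤n (≤-reflexive (sym n≡)))
    H (trans order≡ (sym n≡)) connected (trans size≡ (sym n≡)) (trans diameter≡ (sym d≡))
    where open UnicyclicWithDiameter unicyclic
  extremal-member : UnicyclicWithDiameter n d (extremal n d)
  extremal-member = record
    { order≡ = n≡ ; connected = C₃-connected p a b ; size≡ = trans (C₃-size p a b) n≡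
    ; diameter≡ = trans (C₃-diameter p a b 1≤b (⌊n/2⌋≤⌈n/2⌉ (d ∸ 1)) (⌈n/2⌉≤1+⌊n/2⌋ (d ∸ 1))
        (≤-trans 6≤n (≤-reflexive (sym n≡)))) d≡ }
  minimal : ∀ {k} (H : Graph k) → UnicyclicWithDiameter n d H → edgeSzeged (extremal n d) ≤ edgeSzeged H
  minimal H unicyclic with bound H unicyclic
  ... | inj₁ lt = <⇒≤ lt
  ... | inj₂ (le , _) = le
  extremal-minimum : HasMinimumEdgeSzeged n d (extremal n d)
  extremal-minimum = record { member = extremal-member ; minimal = minimal }
  unique : ∀ {m} (G : Graph m) → HasMinimumEdgeSzeged n d G → G ≅ extremal n d
  unique G min with bound G (HasMinimumEdgeSzeged.member min)
  ... | inj₁ lt = contradiction (HasMinimumEdgeSzeged.minimal min (extremal n d) extremal-member) (<⇒≱ lt)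
  ... | inj₂ (_ , iso) = iso
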